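{- Let $p$ be a prime, $q=p^e$, and let $A=\mathbb{Z}_{n_1}\times\cdots\times\mathbb{Z}_{n_h}$ be an abelian group of exponent $N$ with $\gcd(N,q)=1$. Let $m=\mathrm{ord}_N(q)$ and for each $\ell\in[h]$ let $\gamma_\ell$ be a primitive $n_\ell$-th root of unity in $\mathbb{F}_{q^m}$. Let $(s_{i,1},\dots,s_{i,h})\in A$ for $1\le i\le k$, and let $C\subseteq\mathbb{F}_q[A]$ be the code \[C=\Big\{\Big(\mathrm{Tr}_{q^m/q}\Big(\sum_{i=1}^k\alpha_i\prod_{\ell=1}^h\gamma_\ell^{s_{i,\ell}j_\ell}\Big)\Big)_{(j_1,\dots,j_h)\in A}:(\alpha_1,\dots,\alpha_k)\in\mathbb{F}_{q^m}^k\Big\}.\] Then the $p$-adic valuation of $C$ equals the minimum of $\frac{1}{p-1}\sum_{i=1}^kS_p(r_i)-e$ over all $\boldsymbol{r}=(r_1,\dots,r_k)\in[0,q^m-1]^k$ such that $|\boldsymbol{r}|=\sum_ir_i>0$, $|\boldsymbol{r}|\equiv0\pmod{q-1}$, and $\sum_{i=1}^k r_is_{i,\ell}\equiv0\pmod{n_\ell}$ for all $1\le\ell\le h$.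
   Context: The $p$-adic valuation of a linear code over $\mathbb{F}_q$ is the greatest integer $t$ such that the Hamming weight of every codeword is divisible by $p^t$. $S_p(a)$ is the sum of the base-$p$ digits of $a$; $[a,b]=\{i\in\mathbb{Z}:a\le i\le b\}$, $[h]=[1,h]$. $\mathrm{Tr}_{q^m/q}$ is the trace from $\mathbb{F}_{q^m}$ to $\mathbb{F}_q$. -}

module Defs where

open import Level using (Level; 0ℓ; _⊔_)
open import Algebra.Apartness.Bundles using (HeytingField; HeytingCommutativeRing)
open import Algebra.Bundles using (Semiring; CommutativeRing)
import Algebra.Definitions.RawMonoid as RawMonoidDefs
import Algebra.Definitions.RawSemiring as RawSemiringDefs
open import Algebra.Morphism.Structures using (module RingMorphisms)
open import Data.Digit using (toDigits)
open import Data.Fin.Base using (Fin; toℕ)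
import Data.Fin.Properties as Fin
open import Data.Integer.Base using (+_)
open import Data.List.Base as List using (List; []; _∷_; [_]; allFin; cartesianProductWith; filter; length)
open import Data.Nat.Base hiding (_⊔_)
open import Data.Nat.Divisibility using (_∣_)
open import Data.Nat.ListAction using () renaming (sum to sumₗ)
open import Data.Nat.Primality using (Prime; prime⇒nonTrivial)
open import Data.Nat.Properties using (m<n⇒0<n∸m)
open import Data.Product.Base using (_×_; ∃-syntax; Σ-syntax; proj₁)
open import Data.Rational.Base as ℚ using (ℚ)
open import Data.Vec.Base using (Vec; []; _∷_; lookup)
open import Data.Vec.Functional using (Vector)
open import Data.Vec.Relation.Unary.All using (All; []; _∷_)
open import Data.Vec.Relation.Unary.All.Properties using (lookup⁺)
open import Function.Bundles using (Inverse)
open import Function.Properties.Inverse using (Inverse⇒Injection)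
open import Relation.Binary.Definitions using (Decidable)
open import Relation.Binary.PropositionalEquality.Core using (_≡_)
import Relation.Binary.PropositionalEquality.Properties as ≡
open import Relation.Nullary.Decidable using (fromWitness; via-injection; ¬?)
open import Relation.Nullary.Negation.Core using (¬_)
open import Relation.Unary using (Pred)

open HeytingField using (Carrier)

private
  variable
    a b ℓ ℓ₁ ℓ₂ ℓ₃ ℓ₄ : Level
    h k : ℕ

------------------------------------------------------------------------
-- Extrema

IsGreatest : Pred ℕ ℓ → Pred ℕ ℓ
IsGreatest P t = P t × (∀ u → P u → u ≤ t)

-- μ = min { f x ∣ P x }, the minimum being attained.
IsMinimumOf : {X : Set a} → Pred X ℓ → (X → ℚ) → Pred ℚ (a ⊔ ℓ)
IsMinimumOf P f μ = (∃[ x ] P x × f x ≡ μ) × (∀ x → P x → μ ℚ.≤ f x)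

------------------------------------------------------------------------
-- Natural numbers

sum : Vector ℕ k → ℕ
sum = RawMonoidDefs.sum +-0-rawMonoid

digitSum : (p : ℕ) .{{_ : NonTrivial p}} → ℕ → ℕ
digitSum p n = sumₗ (List.map toℕ (proj₁ (toDigits p {fromWitness (nonTrivial⇒n>1 p)} n)))

-- m = ord_N(q), with q^d ≡ 1 (mod N) written using truncated subtraction
-- (harmless since q ≥ 1).
IsMultiplicativeOrder : (N q m : ℕ) → Set
IsMultiplicativeOrder N q m =
  1 ≤ m × N ∣ q ^ m ∸ 1 × (∀ d → 1 ≤ d → N ∣ q ^ d ∸ 1 → m ≤ d)

------------------------------------------------------------------------
-- The group ℤ_{n₁} × ⋯ × ℤ_{n_h}

-- The residue classes modulo n are represented by Fin n.  Heterogeneous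
-- lists are used rather than functions out of Fin h, so that equality of
-- group elements is propositional equality.
ProductGroup : Vec ℕ h → Set
ProductGroup ns = All Fin ns

coord : {ns : Vec ℕ h} → ProductGroup ns → Fin h → ℕ
coord x l = toℕ (lookup⁺ x l)

elements : (ns : Vec ℕ h) → List (ProductGroup ns)
elements []       = [ [] ]
elements (n ∷ ns) = cartesianProductWith _∷_ (allFin n) (elements ns)

-- N · x = 0 for all x, componentwise in ℤ_{n_l}.
Annihilates : Vec ℕ h → ℕ → Set
Annihilates ns N = ∀ (x : ProductGroup ns) l → lookup ns l ∣ N * coord x l

IsExponent : Vec ℕ h → ℕ → Set
IsExponent ns N =
  1 ≤ N × Annihilates ns N × (∀ d → 1 ≤ d → Annihilates ns d → N ≤ d)

------------------------------------------------------------------------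
-- Finite fields

ring : HeytingField a ℓ₁ ℓ₂ → CommutativeRing a ℓ₁
ring K = HeytingCommutativeRing.commutativeRing (HeytingField.heytingCommutativeRing K)

module _ (K : HeytingField a ℓ₁ ℓ₂) where
  private
    open CommutativeRing (ring K) using (_≈_; 1#; setoid; semiring)
    open RawSemiringDefs (Semiring.rawSemiring semiring) using () renaming (_^_ to _^ᴷ_)

  -- In a field with finitely many elements equality is decidable and the
  -- apartness relation coincides with inequality, so that a HeytingField of
  -- order n is a finite field in the usual sense.
  HasOrder : ℕ → Set (a ⊔ ℓ₁)
  HasOrder n = Inverse setoid (≡.setoid (Fin n))

  ≈-dec : ∀ {n} → HasOrder n → Decidable _≈_
  ≈-dec order = via-injection (Inverse⇒Injection order) Fin._≟_

  IsPrimitiveRootOfUnity : ℕ → Pred (Carrier K) ℓ₁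
  IsPrimitiveRootOfUnity n x =
    x ^ᴷ n ≈ 1# × (∀ d → 1 ≤ d → d < n → ¬ (x ^ᴷ d ≈ 1#))

  -- Σ_{i<m} x^(q^i): when K has order q^m, this is Tr_{q^m/q}(x), seen as an
  -- element of K.
  trace : (q m : ℕ) → Carrier K → Carrier K
  trace q m x = RawSemiringDefs.sum (Semiring.rawSemiring semiring)
                  {m} (λ i → x ^ᴷ (q ^ toℕ i))

IsFieldEmbedding : (F : HeytingField a ℓ₁ ℓ₂) (K : HeytingField b ℓ₃ ℓ₄) →
                   Pred (Carrier F → Carrier K) (a ⊔ ℓ₁ ⊔ ℓ₃)
IsFieldEmbedding F K =
  RingMorphisms.IsRingMonomorphism (CommutativeRing.rawRing (ring F)) (CommutativeRing.rawRing (ring K))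

------------------------------------------------------------------------
-- Codes

-- Elements of F[A] are given by their coefficient functions A → F.
Word : HeytingField a ℓ₁ ℓ₂ → Vec ℕ h → Set a
Word F ns = ProductGroup ns → Carrier F

module _ (F : HeytingField a ℓ₁ ℓ₂) {q : ℕ} (F-order : HasOrder F q) {ns : Vec ℕ h} where

  hammingWeight : Word F ns → ℕ
  hammingWeight c =
    length (filter (λ j → ¬? (≈-dec F F-order (c j) (HeytingField.0# F))) (elements ns))

  IsValuation : ℕ → Pred (Word F ns) ℓ → Pred ℕ (a ⊔ ℓ)
  IsValuation p C = IsGreatest (λ t → ∀ c → C c → p ^ t ∣ hammingWeight c)

module _ (F : HeytingField a ℓ₁ ℓ₂) (K : HeytingField b ℓ₃ ℓ₄)
         (ι : Carrier F → Carrier K) (q m : ℕ) {ns : Vec ℕ h} where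
  private
    open CommutativeRing (ring K) using (_≈_; semiring)
      renaming (_*_ to _*ᴷ_)
    open RawSemiringDefs (Semiring.rawSemiring semiring) using (product)
      renaming (_^_ to _^ᴷ_; sum to sumᴷ)

  -- Coefficients lie in F, traces in K: they are compared through the
  -- inclusion ι of F in K.
  TraceCode : Vector (Carrier K) h → Vector (ProductGroup ns) k →
              Pred (Word F ns) (b ⊔ ℓ₃)
  TraceCode {k = k} γ s c = Σ[ α ∈ Vector (Carrier K) k ] ∀ j →
    ι (c j) ≈ trace K q m
      (sumᴷ λ i → α i *ᴷ product λ l → γ l ^ᴷ (coord (s i) l * coord j l))

------------------------------------------------------------------------
-- The minimisation problem

Admissible : (q m : ℕ) {ns : Vec ℕ h} → Vector (ProductGroup ns) k → Pred (Vector ℕ k) 0ℓ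
Admissible q m {ns} s r =
  (∀ i → r i ≤ q ^ m ∸ 1) ×
  sum r > 0 ×
  q ∸ 1 ∣ sum r ×
  (∀ l → lookup ns l ∣ sum (λ i → r i * coord (s i) l))

-- (1 / (p - 1)) Σᵢ S_p(rᵢ) - e
objective : {p : ℕ} → Prime p → (e : ℕ) → Vector ℕ k → ℚ
objective {p = p} p-prime e r =
  (+ sum (λ i → digitSum p (r i)) ℚ./ (p ∸ 1)) ℚ.- (+ e ℚ./ 1)
  where
  instance
    p-nonTrivial : NonTrivial p
    p-nonTrivial = prime⇒nonTrivial p-prime
    p∸1-nonZero : NonZero (p ∸ 1)
    p∸1-nonZero = >-nonZero (m<n⇒0<n∸m (nonTrivial⇒n>1 p))

{-# OPTIONS --safe #-}

-- Let Q = q^m, f(j) = Σᵢ αᵢ Πₗ γₗ^(sᵢₗ jₗ) and ψ(x) = ζ^(tr x), ζ a primitive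
-- p-th root of unity and tr the trace from K to the prime field.  Counting the
-- zeros of a codeword c by characters gives
--   q (|A| - wt c) = Σ_j Σ_(x ∈ F) ψ(x f(j)).
-- Expand (Q - 1) ψ(x) = Σ_(0 ≤ r < Q) ψ̂(r) τ(x)^r over Teichmüller
-- representatives.  After summing over j and x only r = 0 and the admissible r
-- are left, so that
--   - (Q - 1)^k q wt c = (q - 1) |A| Σ_(r admissible) ψ̂(r₁) ⋯ ψ̂(r_k) τ(α^r).
-- The ψ̂(r) are Gauss sums, and Stickelberger's congruence makes ψ̂(r) a unit
-- times (1 - ζ)^S(r), S being the digit sum, where (1 - ζ)^(p-1) is p times a
-- unit.  This bounds the valuation from below.  The terms of least valuation
-- reduce to a nonzero polynomial over K of degree at most Q - 1 in each αᵢ;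
-- it does not vanish on all of K^k, so the bound is attained.
--
-- The Witt vectors of K are replaced by the monoid ring ℤ[K]: all that is
-- needed is that p^v x ∈ I^(v+1) implies x ∈ I, for I the kernel of ℤ[K] → K,
-- and this follows from the p-derivation δ x = (φ x - x^p) / p, where
-- φ [x] = [x^p].

module Submission where

open import Defs hiding (sum; ring)
open import Algebra.Apartness.Bundles using (HeytingField)
open import Algebra.Bundles using (CommutativeRing; CommutativeMonoid)
open import Algebra.Morphism.Structures using (module RingMorphisms)
import Algebra.Properties.CommutativeMonoid.Sum as MonoidSum
import Algebra.Properties.CommutativeSemiring.Binomial as Binomial
import Algebra.Properties.CommutativeSemiring.Exp as Exp
import Algebra.Properties.Ring as RingProperties
import Algebra.Properties.Semiring.Mult as Mult
import Algebra.Properties.Semiring.Sum as Sum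
import Algebra.Solver.Ring as RingSolver
import Algebra.Solver.Ring.AlmostCommutativeRing as Almost
open import Level using (_⊔_)
open import Data.Digit using (Expansion; fromDigits; toDigits)
open import Data.Empty using (⊥-elim)
open import Data.Fin.Base as Fin using (Fin; toℕ; fromℕ<; inject≤)
import Data.Fin.Permutation as Perm
import Data.Fin.Properties as Fin
open import Data.Integer.Base as ℤ using (ℤ; +_; -[1+_])
import Data.Integer.Properties as ℤ
open import Data.List.Base as List using (List; []; _∷_; _++_)
import Data.List.Properties as List
import Data.Maybe.Base as Maybe
open import Data.Nat.Base as ℕ using (ℕ; zero; suc; NonZero; _≤_; _<_; z≤n; s≤s; _∸_; _!)
open import Data.Nat.Combinatorics using (nCn≡1; nCk+nC[k+1]≡[n+1]C[k+1]; k![n∸k]!∣n!) renaming (_C_ to _choose_)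
open import Data.Nat.Combinatorics.Specification using (nCk≡n!/k![n-k]!)
open import Data.Nat.Coprimality using (Coprime; coprime-Bézout)
open import Data.Nat.DivMod using (m/n*n≡m)
import Data.Nat.DivMod as ℕ
open import Data.Nat.Divisibility using (_∣_; divides; ∣⇒≤)
import Data.Nat.Divisibility as ∣
open import Data.Nat.GCD using (gcd; module Bézout)
open import Data.Nat.Induction using (<-rec)
open import Data.Nat.ListAction using () renaming (sum to sumₗ)
open import Data.Nat.Primality using (Prime; prime⇒irreducible; euclidsLemma; prime⇒nonTrivial; prime⇒nonZero)
import Data.Nat.Properties as ℕ
open import Data.Nat.Solver using (module +-*-Solver)
open import Data.Product.Base using (_×_; _,_; ∃; ∃-syntax; proj₁; proj₂)
open import Data.Rational.Base as ℚ using (_/_)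
import Data.Rational.Properties as ℚ
import Data.Rational.Unnormalised.Base as ℚᵘ
import Data.Rational.Unnormalised.Properties as ℚᵘ
open import Data.Sum.Base using (inj₁; inj₂)
open import Data.Vec.Base as Vec using (Vec; lookup)
open import Data.Vec.Functional using (Vector)
import Data.Vec.Properties as Vec
open import Data.Vec.Relation.Unary.All as All using (All)
open import Data.Vec.Relation.Unary.All.Properties using (lookup⁺)
open import Function.Base using (_∘_; id; const)
open import Function.Bundles using (Inverse; _⇔_; mk⇔)
open import Relation.Binary.PropositionalEquality.Core as ≡ using (_≡_; _≢_)
import Relation.Binary.PropositionalEquality.Properties as ≡
import Relation.Binary.Reasoning.Setoid as SetoidReasoning
open import Relation.Nullary using (¬_; Dec; yes; no; contradiction)
open import Relation.Nullary.Decidable using (dec⇒maybe; ¬?; _×-dec_; decidable-stable; fromWitness; map′)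

-- The rings that lift K are not domains: in ℤ[K] the element [0] is a proper idempotent, and in the
-- truncated ring p is nilpotent. So no valuation is defined on them, and divisibility is read off
-- through the residue map π alone. An element is recorded as a power of 1 - ζ times something of
-- nonzero residue, and p^v x = p^v y yields π x = π y as long as v does not exceed the precision n.
-- For integers this is enough because K has characteristic p: once q wt = z p^v, the residue of z
-- decides whether p divides z. Truncation is forced by ℤ[K] itself, where [0] is not 0 and 1 - [x]
-- is never invertible. But [0] is an idempotent in I, and elements outside I are invertible modulo
-- every power of I, so both defects disappear on dividing by I^(n+1). The precision needed is the
-- minimum W of Σ S(r_i) / (p - 1), since no power beyond p^W is cancelled. What is computed in this
-- way is the valuation of q wt; the factor q = p^e is the origin of the term -e.

m∸1+1≡m : ∀ {m} → 1 ≤ m → suc (m ∸ 1) ≡ m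
m∸1+1≡m (s≤s _) = ≡.refl

-- Primes and binomial coefficients

prime⇒1<p : ∀ {p} → Prime p → 1 < p
prime⇒1<p {p} pr = ℕ.nonTrivial⇒n>1 p where instance _ = prime⇒nonTrivial pr

p∤k! : ∀ {p} → Prime p → ∀ k → k < p → ¬ p ∣ k !
p∤k! pr zero    k<p p∣1 = ℕ.<⇒≱ (prime⇒1<p pr) (∣⇒≤ p∣1)
p∤k! pr (suc k) k<p p∣k! with euclidsLemma (suc k) (k !) pr p∣k!
... | inj₁ p∣k  = ℕ.<⇒≱ k<p (∣⇒≤ p∣k)
... | inj₂ p∣k! = p∤k! pr k (ℕ.<-trans (ℕ.n<1+n k) k<p) p∣k!

p∣pCk : ∀ {p} → Prime p → ∀ k → 0 < k → k < p → p ∣ p choose k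
p∣pCk {p} pr k 0<k k<p with euclidsLemma (p choose k) (k ! ℕ.* (p ∸ k) !) pr p∣
  where
  instance _ = k ℕ.!* (p ∸ k) !≢0
  p! : (p choose k) ℕ.* (k ! ℕ.* (p ∸ k) !) ≡ p !
  p! = ≡.trans (≡.cong (ℕ._* (k ! ℕ.* (p ∸ k) !)) (nCk≡n!/k![n-k]! (ℕ.<⇒≤ k<p)))
               (m/n*n≡m (k![n∸k]!∣n! (ℕ.<⇒≤ k<p)))
  p∣ : p ∣ (p choose k) ℕ.* (k ! ℕ.* (p ∸ k) !)
  p∣ = ≡.subst (p ∣_) (≡.sym p!) (≡.subst (λ n → n ∣ n !) (m∸1+1≡m (ℕ.<-trans 0<k k<p)) (∣.m∣m*n _))
... | inj₁ p∣C = p∣C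
... | inj₂ p∣k![p∸k]! with euclidsLemma (k !) ((p ∸ k) !) pr p∣k![p∸k]!
...   | inj₁ p∣k!     = contradiction p∣k! (p∤k! pr k k<p)
...   | inj₂ p∣[p∸k]! = contradiction p∣[p∸k]! (p∤k! pr (p ∸ k) (ℕ.∸-monoʳ-< 0<k (ℕ.<⇒≤ k<p)))

-- Commutative rings

module IntegerCoefficients {a ℓ} (R : CommutativeRing a ℓ) where

  private
    open module R = CommutativeRing R using (Carrier; 0#; 1#; _≈_; _+_; _*_; _-_; -_; refl; sym; trans; reflexive; setoid; semiring; +-cong; +-congˡ; +-congʳ; +-comm; +-assoc; +-identityˡ; +-identityʳ; *-cong; -‿cong; -‿inverseʳ)
  open RingProperties R.ring using (-‿distribˡ-*; -‿distribʳ-*; -‿+-comm; -0#≈0#; -‿involutive)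
  open Mult semiring using (×-homo-+; ×1-homo-*) renaming (_×_ to _·_)
  private module ≈-Reasoning = SetoidReasoning setoid

  ⌜_⌝ : ℕ → Carrier
  ⌜ n ⌝ = n · 1#

  ⌜⌝-+ : ∀ m n → ⌜ m ℕ.+ n ⌝ ≈ ⌜ m ⌝ + ⌜ n ⌝
  ⌜⌝-+ = ×-homo-+ 1#

  ⌜⌝-* : ∀ m n → ⌜ m ℕ.* n ⌝ ≈ ⌜ m ⌝ * ⌜ n ⌝
  ⌜⌝-* = ×1-homo-*

  ⌜1⌝ : ⌜ 1 ⌝ ≈ 1#
  ⌜1⌝ = +-identityʳ 1#

  ⌜⌝-cong : ∀ {m n} → m ≡ n → ⌜ m ⌝ ≈ ⌜ n ⌝
  ⌜⌝-cong ≡.refl = refl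

  int : ℤ → Carrier
  int (+ n)    = ⌜ n ⌝
  int -[1+ n ] = - ⌜ suc n ⌝

  private
    cancel-1 : ∀ x y → x - y ≈ (1# + x) - (1# + y)
    cancel-1 x y = sym (begin
      (1# + x) - (1# + y)      ≈⟨ +-cong (+-comm 1# x) (sym (-‿+-comm 1# y)) ⟩
      (x + 1#) + (- 1# - y)    ≈⟨ +-assoc x 1# _ ⟩
      x + (1# + (- 1# - y))    ≈⟨ +-congˡ (sym (+-assoc 1# (- 1#) _)) ⟩
      x + ((1# + - 1#) - y)    ≈⟨ +-congˡ (+-congʳ (-‿inverseʳ 1#)) ⟩
      x + (0# - y)             ≈⟨ +-congˡ (+-identityˡ _) ⟩
      x - y                    ∎)
      where open ≈-Reasoning

  int-⊖ : ∀ m n → int (m ℤ.⊖ n) ≈ ⌜ m ⌝ - ⌜ n ⌝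
  int-⊖ m       zero    = sym (trans (+-congˡ -0#≈0#) (+-identityʳ _))
  int-⊖ zero    (suc n) = sym (+-identityˡ _)
  int-⊖ (suc m) (suc n) =
    trans (reflexive (≡.cong int (ℤ.[1+m]⊖[1+n]≡m⊖n m n))) (trans (int-⊖ m n) (cancel-1 ⌜ m ⌝ ⌜ n ⌝))

  int-+ : ∀ i j → int (i ℤ.+ j) ≈ int i + int j
  int-+ (+ m)    (+ n)    = ⌜⌝-+ m n
  int-+ (+ m)    -[1+ n ] = int-⊖ m (suc n)
  int-+ -[1+ m ] (+ n)    = trans (int-⊖ n (suc m)) (+-comm _ _)
  int-+ -[1+ m ] -[1+ n ] = trans
    (-‿cong (trans (⌜⌝-cong (≡.sym (≡.cong suc (ℕ.+-suc m n)))) (⌜⌝-+ (suc m) (suc n))))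
    (sym (-‿+-comm ⌜ suc m ⌝ ⌜ suc n ⌝))

  int-neg : ∀ i → int (ℤ.- i) ≈ - int i
  int-neg (+ zero)  = sym -0#≈0#
  int-neg (+ suc n) = refl
  int-neg -[1+ n ]  = sym (-‿involutive _)

  int-* : ∀ i j → int (i ℤ.* j) ≈ int i * int j
  int-* (+ m) (+ n) = trans (reflexive (≡.cong int (≡.sym (ℤ.pos-* m n)))) (⌜⌝-* m n)
  int-* (+ m) -[1+ n ] = begin
    int (+ m ℤ.* -[1+ n ])        ≈⟨ reflexive (≡.cong int (≡.sym (ℤ.neg-distribʳ-* (+ m) (+ suc n)))) ⟩
    int (ℤ.- (+ m ℤ.* + suc n))   ≈⟨ int-neg (+ m ℤ.* + suc n) ⟩
    - int (+ m ℤ.* + suc n)       ≈⟨ -‿cong (int-* (+ m) (+ suc n)) ⟩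
    - (⌜ m ⌝ * ⌜ suc n ⌝)         ≈⟨ -‿distribʳ-* _ _ ⟩
    ⌜ m ⌝ * - ⌜ suc n ⌝           ∎
    where open ≈-Reasoning
  int-* -[1+ m ] j = begin
    int (-[1+ m ] ℤ.* j)          ≈⟨ reflexive (≡.cong int (≡.sym (ℤ.neg-distribˡ-* (+ suc m) j))) ⟩
    int (ℤ.- (+ suc m ℤ.* j))     ≈⟨ int-neg (+ suc m ℤ.* j) ⟩
    - int (+ suc m ℤ.* j)         ≈⟨ -‿cong (pos* (suc m) j) ⟩
    - (⌜ suc m ⌝ * int j)         ≈⟨ -‿distribˡ-* _ _ ⟩
    - ⌜ suc m ⌝ * int j           ∎
    where
    open ≈-Reasoning
    pos* : ∀ m j → int (+ m ℤ.* j) ≈ ⌜ m ⌝ * int j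
    pos* m (+ n)    = trans (reflexive (≡.cong int (≡.sym (ℤ.pos-* m n)))) (⌜⌝-* m n)
    pos* m -[1+ n ] = begin
      int (+ m ℤ.* -[1+ n ])        ≈⟨ reflexive (≡.cong int (≡.sym (ℤ.neg-distribʳ-* (+ m) (+ suc n)))) ⟩
      int (ℤ.- (+ m ℤ.* + suc n))   ≈⟨ int-neg (+ m ℤ.* + suc n) ⟩
      - int (+ m ℤ.* + suc n)       ≈⟨ -‿cong (pos* m (+ suc n)) ⟩
      - (⌜ m ⌝ * ⌜ suc n ⌝)         ≈⟨ -‿distribʳ-* _ _ ⟩
      ⌜ m ⌝ * - ⌜ suc n ⌝           ∎

  -- The solver evaluates constants, so here 0 and 1 must be sent to 0# and
  -- 1# on the nose.
  private
    coeff : ℤ → Carrier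
    coeff (+ 0) = 0#
    coeff (+ 1) = 1#
    coeff i     = int i

    coeff≈int : ∀ i → coeff i ≈ int i
    coeff≈int (+ 0)           = refl
    coeff≈int (+ 1)           = sym ⌜1⌝
    coeff≈int (+ suc (suc n)) = refl
    coeff≈int -[1+ n ]        = refl

    almost : Almost.AlmostCommutativeRing _ _
    almost = Almost.fromCommutativeRing R

    coeff-homo : CommutativeRing.rawRing ℤ.+-*-commutativeRing Almost.-Raw-AlmostCommutative⟶ almost
    coeff-homo = record
      { ⟦_⟧    = coeff
      ; +-homo = λ i j → trans (coeff≈int (i ℤ.+ j)) (trans (int-+ i j) (+-cong (sym (coeff≈int i)) (sym (coeff≈int j))))
      ; *-homo = λ i j → trans (coeff≈int (i ℤ.* j)) (trans (int-* i j) (*-cong (sym (coeff≈int i)) (sym (coeff≈int j))))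
      ; -‿homo = λ i → trans (coeff≈int (ℤ.- i)) (trans (int-neg i) (-‿cong (sym (coeff≈int i))))
      ; 0-homo = refl
      ; 1-homo = refl
      }

  module Solver = RingSolver (CommutativeRing.rawRing ℤ.+-*-commutativeRing) almost coeff-homo
    (λ i j → Maybe.map (λ i≡j → reflexive (≡.cong coeff i≡j)) (dec⇒maybe (i ℤ.≟ j)))

module RingKit {a ℓ} (R : CommutativeRing a ℓ) where

  open CommutativeRing R public hiding (zero; Carrier)
  open CommutativeRing R public using (Carrier)
  open RingProperties ring public
    using (x∙y⁻¹≈ε⇒x≈y; x≈y⇒x∙y⁻¹≈ε; -‿+-comm; -0#≈0#; -‿involutive)
  open Exp commutativeSemiring public
    using (_^_; ^-congˡ; ^-congʳ; ^-homo-*; ^-assocʳ; ^-distrib-*)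
  open Sum semiring public
    using (sum; sum-cong-≋; ∑-distrib-+; ∑-comm; sum-permute; *-distribˡ-sum; *-distribʳ-sum; sum-replicate; sum-replicate-zero)
  open Mult semiring public
    using (×-assoc-*; ×-congʳ)
    renaming (_×_ to _·_)
  open MonoidSum *-commutativeMonoid public
    using ()
    renaming (sum to product; sum-cong-≋ to product-cong; ∑-distrib-+ to product-*; ∑-comm to product-comm; sum-replicate-zero to product-1)
  module ≈-Reasoning = SetoidReasoning setoid

  ⌜_⌝ : ℕ → Carrier
  ⌜ n ⌝ = n · 1#

  ⌜⌝-+ : ∀ m n → ⌜ m ℕ.+ n ⌝ ≈ ⌜ m ⌝ + ⌜ n ⌝
  ⌜⌝-+ = IntegerCoefficients.⌜⌝-+ R

  ⌜⌝-* : ∀ m n → ⌜ m ℕ.* n ⌝ ≈ ⌜ m ⌝ * ⌜ n ⌝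
  ⌜⌝-* = IntegerCoefficients.⌜⌝-* R

  ⌜1⌝ : ⌜ 1 ⌝ ≈ 1#
  ⌜1⌝ = IntegerCoefficients.⌜1⌝ R

  ⌜⌝-cong : ∀ {m n} → m ≡ n → ⌜ m ⌝ ≈ ⌜ n ⌝
  ⌜⌝-cong = IntegerCoefficients.⌜⌝-cong R

  int : ℤ → Carrier
  int = IntegerCoefficients.int R

  int-+ : ∀ i j → int (i ℤ.+ j) ≈ int i + int j
  int-+ = IntegerCoefficients.int-+ R

  int-* : ∀ i j → int (i ℤ.* j) ≈ int i * int j
  int-* = IntegerCoefficients.int-* R

  int-neg : ∀ i → int (ℤ.- i) ≈ - int i
  int-neg = IntegerCoefficients.int-neg R

  Polynomial : ℕ → Set
  Polynomial = IntegerCoefficients.Solver.Polynomial R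

  infix  9 :-_
  infixl 8 _:*_
  infixl 7 _:+_ _:-_

  con : ∀ {n} → ℤ → Polynomial n
  con = IntegerCoefficients.Solver.con {R = R}

  _:+_ _:*_ _:-_ : ∀ {n} → Polynomial n → Polynomial n → Polynomial n
  _:+_ = IntegerCoefficients.Solver._:+_ R
  _:*_ = IntegerCoefficients.Solver._:*_ R
  _:-_ = IntegerCoefficients.Solver._:-_ R

  :-_ : ∀ {n} → Polynomial n → Polynomial n
  :-_ = IntegerCoefficients.Solver.:-_ {R = R}

  infix 4 _:=_
  _:=_ : ∀ {n} → Polynomial n → Polynomial n → Polynomial n × Polynomial n
  _:=_ = IntegerCoefficients.Solver._:=_ R

  solve = IntegerCoefficients.Solver.solve R

  ⌜⌝-^ : ∀ m n → ⌜ m ℕ.^ n ⌝ ≈ ⌜ m ⌝ ^ n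
  ⌜⌝-^ m zero    = ⌜1⌝
  ⌜⌝-^ m (suc n) = trans (⌜⌝-* m (m ℕ.^ n)) (*-congˡ (⌜⌝-^ m n))

  ·≈⌜⌝* : ∀ n x → n · x ≈ ⌜ n ⌝ * x
  ·≈⌜⌝* n x = sym (trans (×-assoc-* n 1# x) (×-congʳ n (*-identityˡ x)))

  sum-const : ∀ n x → sum {n} (const x) ≈ ⌜ n ⌝ * x
  sum-const n x = trans (sum-replicate n) (·≈⌜⌝* n x)

  x-y≈0⇒x≈y : ∀ {x y} → x - y ≈ 0# → x ≈ y
  x-y≈0⇒x≈y = x∙y⁻¹≈ε⇒x≈y _ _

  x≈y⇒x-y≈0 : ∀ {x y} → x ≈ y → x - y ≈ 0#
  x≈y⇒x-y≈0 = x≈y⇒x∙y⁻¹≈ε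

  1^n : ∀ n → 1# ^ n ≈ 1#
  1^n zero    = refl
  1^n (suc n) = trans (*-identityˡ _) (1^n n)

  0^n : ∀ {n} → 0 < n → 0# ^ n ≈ 0#
  0^n (s≤s _) = zeroˡ _

  x^1 : ∀ x → x ^ 1 ≈ x
  x^1 = *-identityʳ

  sum-0 : ∀ {n} {f : Vector Carrier n} → (∀ i → f i ≈ 0#) → sum f ≈ 0#
  sum-0 {n} f≈0 = trans (sum-cong-≋ f≈0) (sum-replicate-zero n)

  sum-single : ∀ {n} (f : Vector Carrier n) i → (∀ j → j ≢ i → f j ≈ 0#) → sum f ≈ f i
  sum-single f Fin.zero    f≈0 = trans (+-congˡ (sum-0 (λ j → f≈0 (Fin.suc j) λ ()))) (+-identityʳ _)
  sum-single f (Fin.suc i) f≈0 = trans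
    (+-cong (f≈0 Fin.zero λ ()) (sum-single (f ∘ Fin.suc) i (λ j j≢i → f≈0 (Fin.suc j) (j≢i ∘ Fin.suc-injective))))
    (+-identityˡ _)

  sum-neg : ∀ {n} (f : Vector Carrier n) → sum (λ i → - f i) ≈ - sum f
  sum-neg {zero}  f = sym -0#≈0#
  sum-neg {suc n} f = trans (+-congˡ (sum-neg (f ∘ Fin.suc))) (-‿+-comm _ _)

  sum-snoc : ∀ n (f : ℕ → Carrier) → sum {suc n} (f ∘ toℕ) ≈ sum {n} (f ∘ toℕ) + f n
  sum-snoc zero    f = +-comm _ _
  sum-snoc (suc n) f = trans (+-congˡ (sum-snoc n (f ∘ suc))) (sym (+-assoc _ _ _))

  -- Shifting the index only trades `f 0` for `f n`. Serves the traces, where `f n` is x^Q = x, and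
  -- the windows of length p in the test functions for ζ.
  sum-rotate : ∀ n (f : ℕ → Carrier) → f n ≈ f 0 → sum {n} (λ i → f (suc (toℕ i))) ≈ sum {n} (f ∘ toℕ)
  sum-rotate n f fn≈f0 = begin
    sum {n} (λ i → f (suc (toℕ i)))               ≈⟨ solve 2 (λ s x → s := (x :+ s) :- x) refl _ (f 0) ⟩
    sum {suc n} (f ∘ toℕ) - f 0                   ≈⟨ +-cong (sum-snoc n f) (-‿cong (sym fn≈f0)) ⟩
    (sum {n} (f ∘ toℕ) + f n) - f n               ≈⟨ solve 2 (λ s x → (s :+ x) :- x := s) refl _ (f n) ⟩
    sum {n} (f ∘ toℕ)                             ∎
    where open ≈-Reasoning

  product-^ : ∀ {n} (f : Vector Carrier n) c → product f ^ c ≈ product (λ i → f i ^ c)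
  product-^ {zero}  f c = 1^n c
  product-^ {suc n} f c = trans (^-distrib-* _ _ c) (*-congˡ (product-^ (f ∘ Fin.suc) c))

  product-pow : ∀ {n} x (f : Vector ℕ n) → product (λ i → x ^ f i) ≈ x ^ Defs.sum f
  product-pow {zero}  x f = refl
  product-pow {suc n} x f = trans (*-congˡ (product-pow x (f ∘ Fin.suc))) (sym (^-homo-* x (f Fin.zero) _))

  product-const : ∀ n x → product {n} (const x) ≈ x ^ n
  product-const zero    x = refl
  product-const (suc n) x = *-congˡ (product-const n x)

  sum-*-sum : ∀ {m n} (f : Vector Carrier m) (g : Vector Carrier n) → sum f * sum g ≈ sum (λ i → sum (λ j → f i * g j))
  sum-*-sum f g = trans (*-distribʳ-sum (sum g) f) (sum-cong-≋ λ i → *-distribˡ-sum (f i) g)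

  geometric : ∀ x n → (1# - x) * sum {n} (λ i → x ^ toℕ i) ≈ 1# - x ^ n
  geometric x zero    = trans (zeroʳ _) (sym (-‿inverseʳ 1#))
  geometric x (suc n) = begin
    (1# - x) * (1# + sum {n} (λ i → x * x ^ toℕ i))    ≈⟨ *-congˡ (+-congˡ (sym (*-distribˡ-sum {n} x (λ i → x ^ toℕ i)))) ⟩
    (1# - x) * (1# + x * S)                            ≈⟨ solve 2 (λ x s → (con (+ 1) :- x) :* (con (+ 1) :+ x :* s) := (con (+ 1) :- x) :+ x :* ((con (+ 1) :- x) :* s)) refl x S ⟩
    (1# - x) + x * ((1# - x) * S)                      ≈⟨ +-congˡ (*-congˡ (geometric x n)) ⟩
    (1# - x) + x * (1# - x ^ n)                        ≈⟨ solve 2 (λ x y → (con (+ 1) :- x) :+ x :* (con (+ 1) :- y) := con (+ 1) :- x :* y) refl x (x ^ n) ⟩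
    1# - x * x ^ n                                     ∎
    where
    open ≈-Reasoning
    S = sum {n} (λ i → x ^ toℕ i)

  -- The inner binomial coefficients are multiples of p, and every inner term contains x. The factor
  -- x is kept because `δ-Pow` needs the remainder to lie in the same power of the kernel as x.
  freshman : ∀ {p} → Prime p → ∀ x y → ∃[ z ] (x + y) ^ p ≈ x ^ p + y ^ p + ⌜ p ⌝ * (x * z)
  freshman {p} pr x y with p in eq
  ... | zero   = contradiction (prime⇒1<p pr) λ ()
  ... | suc p' = Z , (begin
    (x + y) ^ suc p'                                          ≈⟨ B.theorem (suc p') x y ⟩
    1 · (1# * y ^ suc p') + sum t                             ≈⟨ +-cong (trans (+-identityʳ _) (*-identityˡ _)) (sum-snoc p' t') ⟩
    y ^ suc p' + (sum {p'} (t' ∘ toℕ) + t' p')                ≈⟨ +-congˡ (+-cong middle last) ⟩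
    y ^ suc p' + (⌜ suc p' ⌝ * (x * Z) + x ^ suc p')          ≈⟨ solve 3 (λ a b c → a :+ (b :+ c) := c :+ a :+ b) refl _ _ _ ⟩
    x ^ suc p' + y ^ suc p' + ⌜ suc p' ⌝ * (x * Z)            ∎)
    where
    open ≈-Reasoning
    module B = Binomial commutativeSemiring
    t' : ℕ → Carrier
    t' k = (suc p' choose suc k) · (x ^ suc k * y ^ (p' ∸ k))
    t : Vector Carrier (suc p')
    t = t' ∘ toℕ
    pC : ∀ (k : Fin p') → suc p' ∣ suc p' choose suc (toℕ k)
    pC k = p∣pCk pr (suc (toℕ k)) (s≤s z≤n) (s≤s (Fin.toℕ<n k))
    c : Fin p' → ℕ
    c k = _∣_.quotient (pC k)
    z : Fin p' → Carrier
    z k = ⌜ c k ⌝ * (x ^ toℕ k * y ^ (p' ∸ toℕ k))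
    Z = sum z
    middle : sum {p'} (t' ∘ toℕ) ≈ ⌜ suc p' ⌝ * (x * Z)
    middle = begin
      sum {p'} (t' ∘ toℕ)                      ≈⟨ sum-cong-≋ (λ k → begin
        t' (toℕ k)                                                                      ≈⟨ ·≈⌜⌝* (suc p' choose suc (toℕ k)) _ ⟩
        ⌜ suc p' choose suc (toℕ k) ⌝ * _                                                    ≈⟨ *-congʳ (trans (⌜⌝-cong (_∣_.equality (pC k))) (⌜⌝-* (c k) (suc p'))) ⟩
        (⌜ c k ⌝ * ⌜ suc p' ⌝) * (x * x ^ toℕ k * y ^ (p' ∸ toℕ k))                     ≈⟨ solve 5 (λ c p x u v → (c :* p) :* (x :* u :* v) := p :* (x :* (c :* (u :* v)))) refl _ _ _ _ _ ⟩
        ⌜ suc p' ⌝ * (x * z k)                                                          ∎) ⟩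
      sum {p'} (λ k → ⌜ suc p' ⌝ * (x * z k))  ≈⟨ sym (*-distribˡ-sum _ (λ k → x * z k)) ⟩
      ⌜ suc p' ⌝ * sum {p'} (λ k → x * z k)    ≈⟨ *-congˡ (sym (*-distribˡ-sum x z)) ⟩
      ⌜ suc p' ⌝ * (x * Z)                     ∎
    last : t' p' ≈ x ^ suc p'
    last = begin
      (suc p' choose suc p') · (x ^ suc p' * y ^ (p' ∸ p'))  ≈⟨ ·≈⌜⌝* (suc p' choose suc p') _ ⟩
      ⌜ suc p' choose suc p' ⌝ * (x ^ suc p' * y ^ (p' ∸ p')) ≈⟨ *-cong (⌜⌝-cong (nCn≡1 (suc p'))) (*-congˡ (^-congʳ y (ℕ.n∸n≡0 p'))) ⟩
      ⌜ 1 ⌝ * (x ^ suc p' * 1#)                         ≈⟨ *-cong ⌜1⌝ (*-identityʳ _) ⟩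
      1# * x ^ suc p'                                   ≈⟨ *-identityˡ _ ⟩
      x ^ suc p'                                        ∎

-- Monoid rings, as formal sums compared by test functions

module _ {m ℓm b ℓb} (B : CommutativeRing b ℓb) (M : CommutativeMonoid m ℓm) where

  private
    module B = CommutativeRing B
    module M = CommutativeMonoid M
    module B′ = RingKit B

  -- The monoid ring B[M], divided by the ideal of those Σ cᵢ[xᵢ] that are
  -- killed by every test function h : M → B, h being extended linearly.
  module MonoidRing
    {t} (Test : (M.Carrier → B.Carrier) → Set t)
    (Test-cong : ∀ {h} → Test h → ∀ {x y} → x M.≈ y → h x B.≈ h y)
    (Test-0 : Test (λ _ → B.0#))
    (Test-+ : ∀ {g h} → Test g → Test h → Test (λ x → g x B.+ h x))
    (Test-* : ∀ c {h} → Test h → Test (λ x → c B.* h x))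
    (Test-shift : ∀ x {h} → Test h → Test (λ y → h (y M.∙ x)))
    where

    open B′ using (solve; _:+_; _:*_; _:=_; :-_)

    FormalSum : Set (b ⊔ m)
    FormalSum = List (B.Carrier × M.Carrier)

    ⟨_,_⟩ : FormalSum → (M.Carrier → B.Carrier) → B.Carrier
    ⟨ []          , h ⟩ = B.0#
    ⟨ (c , x) ∷ f , h ⟩ = c B.* h x B.+ ⟨ f , h ⟩

    -- A record, so that the two sides can be inferred from a proof.
    infix 4 _≋_
    record _≋_ (f g : FormalSum) : Set (b ⊔ ℓb ⊔ m ⊔ t) where
      constructor tested
      field test : ∀ {h} → Test h → ⟨ f , h ⟩ B.≈ ⟨ g , h ⟩
    open _≋_ public

    infixl 7 _⊛_
    scale : B.Carrier → M.Carrier → FormalSum → FormalSum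
    scale c x []            = []
    scale c x ((d , y) ∷ g) = (c B.* d , x M.∙ y) ∷ scale c x g

    _⊛_ : FormalSum → FormalSum → FormalSum
    []            ⊛ g = []
    ((c , x) ∷ f) ⊛ g = scale c x g ++ f ⊛ g

    ⊖_ : FormalSum → FormalSum
    ⊖ []            = []
    ⊖ ((c , x) ∷ f) = (B.- c , x) ∷ ⊖ f

    one : FormalSum
    one = (B.1# , M.ε) ∷ []

    ⟨⟩-cong : ∀ f {g h} → (∀ x → g x B.≈ h x) → ⟨ f , g ⟩ B.≈ ⟨ f , h ⟩
    ⟨⟩-cong []            g≈h = B.refl
    ⟨⟩-cong ((c , x) ∷ f) g≈h = B.+-cong (B.*-congˡ (g≈h x)) (⟨⟩-cong f g≈h)

    ⟨⟩-0 : ∀ f {h} → (∀ x → h x B.≈ B.0#) → ⟨ f , h ⟩ B.≈ B.0#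
    ⟨⟩-0 []            h≈0 = B.refl
    ⟨⟩-0 ((c , x) ∷ f) h≈0 = B.trans (B.+-cong (B.trans (B.*-congˡ (h≈0 x)) (B.zeroʳ c)) (⟨⟩-0 f h≈0)) (B.+-identityˡ B.0#)

    ⟨⟩-+ : ∀ f g h → ⟨ f , (λ x → g x B.+ h x) ⟩ B.≈ ⟨ f , g ⟩ B.+ ⟨ f , h ⟩
    ⟨⟩-+ []            g h = B.sym (B.+-identityˡ B.0#)
    ⟨⟩-+ ((c , x) ∷ f) g h = B.trans (B.+-congˡ (⟨⟩-+ f g h))
      (solve 5 (λ c u v F G → c :* (u :+ v) :+ (F :+ G) := (c :* u :+ F) :+ (c :* v :+ G)) B.refl _ _ _ _ _)

    ⟨⟩-* : ∀ f c h → ⟨ f , (λ x → c B.* h x) ⟩ B.≈ c B.* ⟨ f , h ⟩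
    ⟨⟩-* []            c h = B.sym (B.zeroʳ c)
    ⟨⟩-* ((d , x) ∷ f) c h = B.trans (B.+-congˡ (⟨⟩-* f c h))
      (solve 4 (λ c d u F → d :* (c :* u) :+ c :* F := c :* (d :* u :+ F)) B.refl c d (h x) ⟨ f , h ⟩)

    ++-⟨⟩ : ∀ f g h → ⟨ f ++ g , h ⟩ B.≈ ⟨ f , h ⟩ B.+ ⟨ g , h ⟩
    ++-⟨⟩ []            g h = B.sym (B.+-identityˡ _)
    ++-⟨⟩ ((c , x) ∷ f) g h = B.trans (B.+-congˡ (++-⟨⟩ f g h)) (B.sym (B.+-assoc _ _ _))

    ⊖-⟨⟩ : ∀ f h → ⟨ ⊖ f , h ⟩ B.≈ B.- ⟨ f , h ⟩
    ⊖-⟨⟩ []            h = B.sym B′.-0#≈0#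
    ⊖-⟨⟩ ((c , x) ∷ f) h = B.trans (B.+-congˡ (⊖-⟨⟩ f h))
      (solve 3 (λ c u F → (:- c) :* u :+ (:- F) := :- (c :* u :+ F)) B.refl c (h x) ⟨ f , h ⟩)

    scale-⟨⟩ : ∀ c x g h → ⟨ scale c x g , h ⟩ B.≈ c B.* ⟨ g , (λ y → h (x M.∙ y)) ⟩
    scale-⟨⟩ c x []            h = B.sym (B.zeroʳ c)
    scale-⟨⟩ c x ((d , y) ∷ g) h = B.trans (B.+-congˡ (scale-⟨⟩ c x g h))
      (solve 4 (λ c d u F → c :* d :* u :+ c :* F := c :* (d :* u :+ F)) B.refl c d _ _)

    ⊛-⟨⟩ : ∀ f g h → ⟨ f ⊛ g , h ⟩ B.≈ ⟨ f , (λ x → ⟨ g , (λ y → h (x M.∙ y)) ⟩) ⟩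
    ⊛-⟨⟩ []            g h = B.refl
    ⊛-⟨⟩ ((c , x) ∷ f) g h = B.trans (++-⟨⟩ (scale c x g) (f ⊛ g) h) (B.+-cong (scale-⟨⟩ c x g h) (⊛-⟨⟩ f g h))

    -- Pairing `f ⊛ g` with `h` is a double sum, so commutativity of `⊛` amounts to exchanging the
    -- two summations.
    fubini : ∀ f g (h : M.Carrier → M.Carrier → B.Carrier) →
             ⟨ f , (λ x → ⟨ g , h x ⟩) ⟩ B.≈ ⟨ g , (λ y → ⟨ f , (λ x → h x y) ⟩) ⟩
    fubini []            g h = B.sym (⟨⟩-0 g λ _ → B.refl)
    fubini ((c , x) ∷ f) g h = B.trans
      (B.+-cong (B.sym (⟨⟩-* g c (h x))) (fubini f g h))
      (B.sym (⟨⟩-+ g (λ y → c B.* h x y) (λ y → ⟨ f , (λ x → h x y) ⟩)))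

    -- Makes `⊛` respect `≋`: the product pairs with `h` as its first factor pairs with a linear
    -- combination of translates of `h`, which must itself be a test function. `Test-shift` supplies
    -- the translates.
    Test-⟨⟩ : ∀ f {h : M.Carrier → M.Carrier → B.Carrier} → (∀ y → Test (λ x → h x y)) → Test (λ x → ⟨ f , h x ⟩)
    Test-⟨⟩ []            t = Test-0
    Test-⟨⟩ ((c , y) ∷ f) t = Test-+ (Test-* c (t y)) (Test-⟨⟩ f t)

    ≋-refl : ∀ {f} → f ≋ f
    ≋-refl = tested λ _ → B.refl

    ≋-sym : ∀ {f g} → f ≋ g → g ≋ f
    ≋-sym e = tested λ t → B.sym (test e t)

    ≋-trans : ∀ {f g k} → f ≋ g → g ≋ k → f ≋ k
    ≋-trans e e' = tested λ t → B.trans (test e t) (test e' t)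

    ++-cong : ∀ {f f' g g'} → f ≋ f' → g ≋ g' → f ++ g ≋ f' ++ g'
    ++-cong {f} {f'} {g} {g'} e e' = tested λ {h} t →
      B.trans (++-⟨⟩ f g h) (B.trans (B.+-cong (test e t) (test e' t)) (B.sym (++-⟨⟩ f' g' h)))

    ++-assoc : ∀ f g k → (f ++ g) ++ k ≋ f ++ (g ++ k)
    ++-assoc f g k = tested λ {h} _ → B.reflexive (≡.cong (λ f → ⟨ f , h ⟩) (List.++-assoc f g k))

    ++-comm : ∀ f g → f ++ g ≋ g ++ f
    ++-comm f g = tested λ {h} _ → B.trans (++-⟨⟩ f g h) (B.trans (B.+-comm _ _) (B.sym (++-⟨⟩ g f h)))

    ⊖-cong : ∀ {f g} → f ≋ g → ⊖ f ≋ ⊖ g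
    ⊖-cong {f} {g} e = tested λ {h} t → B.trans (⊖-⟨⟩ f h) (B.trans (B.-‿cong (test e t)) (B.sym (⊖-⟨⟩ g h)))

    ⊖-inverseʳ : ∀ f → f ++ ⊖ f ≋ []
    ⊖-inverseʳ f = tested λ {h} _ → B.trans (++-⟨⟩ f (⊖ f) h) (B.trans (B.+-congˡ (⊖-⟨⟩ f h)) (B.-‿inverseʳ _))

    ⊛-comm : ∀ f g → f ⊛ g ≋ g ⊛ f
    ⊛-comm f g = tested λ {h} t → B.trans (⊛-⟨⟩ f g h) (B.trans (fubini f g (λ x y → h (x M.∙ y)))
      (B.trans (⟨⟩-cong g λ y → ⟨⟩-cong f λ x → Test-cong t (M.comm x y)) (B.sym (⊛-⟨⟩ g f h))))

    ⊛-congʳ : ∀ {f f' g} → f ≋ f' → f ⊛ g ≋ f' ⊛ g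
    ⊛-congʳ {f} {f'} {g} e = tested λ {h} t → B.trans (⊛-⟨⟩ f g h)
      (B.trans (test e (Test-⟨⟩ g λ y → Test-shift y t)) (B.sym (⊛-⟨⟩ f' g h)))

    ⊛-cong : ∀ {f f' g g'} → f ≋ f' → g ≋ g' → f ⊛ g ≋ f' ⊛ g'
    ⊛-cong {f} {f'} {g} {g'} e e' =
      ≋-trans (⊛-congʳ {g = g} e) (≋-trans (⊛-comm f' g) (≋-trans (⊛-congʳ {g = f'} e') (⊛-comm g' f')))

    ⊛-assoc : ∀ f g k → (f ⊛ g) ⊛ k ≋ f ⊛ (g ⊛ k)
    ⊛-assoc f g k = tested λ {h} t → begin
      ⟨ (f ⊛ g) ⊛ k , h ⟩                                                        ≈⟨ ⊛-⟨⟩ (f ⊛ g) k h ⟩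
      ⟨ f ⊛ g , (λ z → ⟨ k , (λ w → h (z M.∙ w)) ⟩) ⟩                            ≈⟨ ⊛-⟨⟩ f g _ ⟩
      ⟨ f , (λ x → ⟨ g , (λ y → ⟨ k , (λ w → h ((x M.∙ y) M.∙ w)) ⟩) ⟩) ⟩        ≈⟨ ⟨⟩-cong f (λ x → ⟨⟩-cong g λ y → ⟨⟩-cong k λ w → Test-cong t (M.assoc x y w)) ⟩
      ⟨ f , (λ x → ⟨ g , (λ y → ⟨ k , (λ w → h (x M.∙ (y M.∙ w))) ⟩) ⟩) ⟩        ≈⟨ ⟨⟩-cong f (λ x → B.sym (⊛-⟨⟩ g k _)) ⟩
      ⟨ f , (λ x → ⟨ g ⊛ k , (λ z → h (x M.∙ z)) ⟩) ⟩                            ≈⟨ B.sym (⊛-⟨⟩ f (g ⊛ k) h) ⟩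
      ⟨ f ⊛ (g ⊛ k) , h ⟩                                                        ∎
      where open B′.≈-Reasoning

    ⊛-identityˡ : ∀ f → one ⊛ f ≋ f
    ⊛-identityˡ f = tested λ {h} t → B.trans (⊛-⟨⟩ one f h) (B.trans (B.+-identityʳ _) (B.trans (B.*-identityˡ _)
      (⟨⟩-cong f λ x → Test-cong t (M.identityˡ x))))

    ⊛-distribʳ : ∀ f g k → (g ++ k) ⊛ f ≋ g ⊛ f ++ k ⊛ f
    ⊛-distribʳ f g k = tested λ {h} _ → B.trans (⊛-⟨⟩ (g ++ k) f h) (B.trans (++-⟨⟩ g k _)
      (B.trans (B.+-cong (B.sym (⊛-⟨⟩ g f h)) (B.sym (⊛-⟨⟩ k f h))) (B.sym (++-⟨⟩ (g ⊛ f) (k ⊛ f) h))))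

    formalSums : CommutativeRing (b ⊔ m) (b ⊔ ℓb ⊔ m ⊔ t)
    formalSums = record
      { Carrier = FormalSum ; _≈_ = _≋_ ; _+_ = _++_ ; _*_ = _⊛_ ; -_ = ⊖_ ; 0# = [] ; 1# = one
      ; isCommutativeRing = record
        { isRing = record
          { +-isAbelianGroup = record
            { isGroup = record
              { isMonoid = record
                { isSemigroup = record
                  { isMagma = record
                    { isEquivalence = record { refl = ≋-refl ; sym = ≋-sym ; trans = ≋-trans }
                    ; ∙-cong = ++-cong
                    }
                  ; assoc = ++-assoc
                  }
                ; identity = (λ f → ≋-refl) , (λ f → ++-comm f [])
                }
              ; inverse = (λ f → ≋-trans (++-comm (⊖ f) f) (⊖-inverseʳ f)) , ⊖-inverseʳ
              ; ⁻¹-cong = ⊖-cong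
              }
            ; comm = ++-comm
            }
          ; *-cong = ⊛-cong
          ; *-assoc = ⊛-assoc
          ; *-identity = ⊛-identityˡ , (λ f → ≋-trans (⊛-comm f one) (⊛-identityˡ f))
          ; distrib = (λ f g k → ≋-trans (⊛-comm f (g ++ k)) (≋-trans (⊛-distribʳ f g k) (++-cong (⊛-comm g f) (⊛-comm k f))))
                    , ⊛-distribʳ
          }
        ; *-comm = ⊛-comm
        }
      }

    private module S = RingKit formalSums

    [_] : M.Carrier → FormalSum
    [ x ] = (B.1# , x) ∷ []

    []-* : ∀ x y → [ x M.∙ y ] ≋ [ x ] ⊛ [ y ]
    []-* x y = tested λ _ → B.+-congʳ (B.*-congʳ (B.sym (B.*-identityˡ B.1#)))

    []-cong : ∀ {x y} → x M.≈ y → [ x ] ≋ [ y ]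
    []-cong x≈y = tested λ t → B.+-congʳ (B.*-congˡ (Test-cong t x≈y))

    ⟨⟩-⌜⌝* : ∀ n f {h} → Test h → ⟨ S.⌜ n ⌝ ⊛ f , h ⟩ B.≈ B′.⌜ n ⌝ B.* ⟨ f , h ⟩
    ⟨⟩-⌜⌝* n f {h} t = B.trans (B.sym (test (S.·≈⌜⌝* n f) t)) (go n)
      where
      go : ∀ n → ⟨ n S.· f , h ⟩ B.≈ B′.⌜ n ⌝ B.* ⟨ f , h ⟩
      go zero    = B.sym (B.zeroˡ _)
      go (suc n) = B.trans (++-⟨⟩ f (n S.· f) h)
        (B.trans (B.+-cong (B.sym (B.*-identityˡ _)) (go n)) (B.sym (B.distribʳ _ _ _)))

    -- Equality is tested by values in `B`, so cancellation of an integer is inherited from `B`.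
    torsion-free : ∀ n → (∀ {x y} → B′.⌜ n ⌝ B.* x B.≈ B′.⌜ n ⌝ B.* y → x B.≈ y) →
                   ∀ {f g} → S.⌜ n ⌝ ⊛ f ≋ S.⌜ n ⌝ ⊛ g → f ≋ g
    torsion-free n cancel {f} {g} e = tested λ t →
      cancel (B.trans (B.sym (⟨⟩-⌜⌝* n f t)) (B.trans (test e t) (⟨⟩-⌜⌝* n g t)))

-- Finite fields

module FieldKit {a ℓ₁ ℓ₂} (K : HeytingField a ℓ₁ ℓ₂) {Q} (order : HasOrder K Q) (1<Q : 1 < Q) where

  open RingKit (Defs.ring K) public
  private module H = HeytingField K
  open Inverse order public using (to; from)

  infix 4 _≟_
  _≟_ : ∀ x y → Dec (x ≈ y)
  _≟_ = ≈-dec K order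

  to-cong : ∀ {x y} → x ≈ y → to x ≡ to y
  to-cong = Inverse.to-cong order

  to∘from : ∀ i → to (from i) ≡ i
  to∘from i = Inverse.inverseˡ order refl

  from∘to : ∀ x → from (to x) ≈ x
  from∘to x = Inverse.inverseʳ order ≡.refl

  from-injective : ∀ {i j} → from i ≈ from j → i ≡ j
  from-injective {i} {j} e = ≡.trans (≡.sym (to∘from i)) (≡.trans (to-cong e) (to∘from j))

  1≉0 : ¬ 1# ≈ 0#
  1≉0 1≈0 with ≡.trans (≡.sym (Fin.toℕ-fromℕ< (ℕ.<-trans (s≤s z≤n) 1<Q)))
                 (≡.trans (≡.cong toℕ (from-injective (trans (≈0 _) (sym (≈0 _))))) (Fin.toℕ-fromℕ< 1<Q))
    where
    ≈0 : ∀ x → x ≈ 0#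
    ≈0 x = trans (sym (*-identityʳ x)) (trans (*-congˡ 1≈0) (zeroʳ x))
  ... | ()

  -- A Heyting field only inverts elements apart from 0. Searching the finitely many candidates
  -- bridges the gap: if none is an inverse, `x` cannot be apart from 0, and tightness makes it
  -- equal to 0.
  inverse : ∀ {x} → ¬ x ≈ 0# → ∃[ y ] x * y ≈ 1#
  inverse {x} x≉0 with Fin.any? (λ i → x * from i ≟ 1#)
  ... | yes (i , xi≈1) = from i , xi≈1
  ... | no  ∄ = contradiction (proj₁ (H.tight x 0#) λ x#0 → ∄ (witness (H.#⇒invertible x#0))) x≉0
    where
    witness : (∃[ y ] (y * (x - 0#) ≈ 1# × (x - 0#) * y ≈ 1#)) → ∃[ i ] x * from i ≈ 1#
    witness (y , _ , e) = to y , trans (*-cong (sym (trans (+-congˡ -0#≈0#) (+-identityʳ x))) (from∘to y)) e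

  *-cancelˡ : ∀ {x y z} → ¬ x ≈ 0# → x * y ≈ x * z → y ≈ z
  *-cancelˡ {x} {y} {z} x≉0 e with x⁻¹ , xx⁻¹ ← inverse x≉0 = trans (step y) (trans (*-congˡ e) (sym (step z)))
    where
    step : ∀ y → y ≈ x⁻¹ * (x * y)
    step y = trans (sym (*-identityˡ y)) (trans (*-congʳ (trans (sym xx⁻¹) (*-comm _ _))) (*-assoc _ _ _))

  *-zero : ∀ {x y} → ¬ x ≈ 0# → x * y ≈ 0# → y ≈ 0#
  *-zero x≉0 e = *-cancelˡ x≉0 (trans e (sym (zeroʳ _)))

  *-≉0 : ∀ {x y} → ¬ x ≈ 0# → ¬ y ≈ 0# → ¬ x * y ≈ 0#
  *-≉0 x≉0 y≉0 e = y≉0 (*-zero x≉0 e)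

  ^-≉0 : ∀ {x} n → ¬ x ≈ 0# → ¬ x ^ n ≈ 0#
  ^-≉0 zero    x≉0 = 1≉0
  ^-≉0 (suc n) x≉0 = *-≉0 x≉0 (^-≉0 n x≉0)

  -‿≉0 : ∀ {x} → ¬ x ≈ 0# → ¬ - x ≈ 0#
  -‿≉0 x≉0 e = x≉0 (trans (sym (-‿involutive _)) (trans (-‿cong e) -0#≈0#))

  product-≉0 : ∀ {n} (f : Vector Carrier n) → (∀ i → ¬ f i ≈ 0#) → ¬ product f ≈ 0#
  product-≉0 {zero}  f f≉0 = 1≉0
  product-≉0 {suc n} f f≉0 = *-≉0 (f≉0 Fin.zero) (product-≉0 (f ∘ Fin.suc) (f≉0 ∘ Fin.suc))

  module _ (g g' : Carrier → Carrier) (g-cong : ∀ {x y} → x ≈ y → g x ≈ g y) (g'-cong : ∀ {x y} → x ≈ y → g' x ≈ g' y)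
           (gg' : ∀ x → g (g' x) ≈ x) (g'g : ∀ x → g' (g x) ≈ x) where
    permutation : Perm.Permutation Q Q
    permutation = Perm.permutation (to ∘ g ∘ from) (to ∘ g' ∘ from)
      ((λ i → ≡.trans (to-cong (trans (g-cong (from∘to _)) (gg' _))) (to∘from i)))
      ((λ i → ≡.trans (to-cong (trans (g'-cong (from∘to _)) (g'g _))) (to∘from i)))

  module _ {m ℓm} (A : CommutativeMonoid m ℓm) where
    private
      module AM = CommutativeMonoid A
      module ΣA = MonoidSum A

    reindexᴹ : (f : Carrier → AM.Carrier) → (∀ {x y} → x ≈ y → f x AM.≈ f y) →
               (g g' : Carrier → Carrier) → (∀ {x y} → x ≈ y → g x ≈ g y) → (∀ {x y} → x ≈ y → g' x ≈ g' y) →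
               (∀ x → g (g' x) ≈ x) → (∀ x → g' (g x) ≈ x) →
               ΣA.sum (f ∘ from) AM.≈ ΣA.sum (f ∘ g ∘ from)
    reindexᴹ f f-cong g g' g-cong g'-cong gg' g'g = AM.trans
      (ΣA.sum-permute (f ∘ from) (permutation g g' g-cong g'-cong gg' g'g))
      (ΣA.sum-cong-≋ (λ i → f-cong (from∘to (g (from i)))))

  -- Multiplication by x permutes the nonzero elements, so it does not change
  -- their product.
  private
    δ : Carrier → Carrier → Carrier
    δ c y with y ≟ 0#
    ... | yes _ = 1#
    ... | no  _ = c

    δ-0 : ∀ c {y} → y ≈ 0# → δ c y ≈ 1#
    δ-0 c {y} y≈0 with y ≟ 0#
    ... | yes _   = refl
    ... | no  y≉0 = contradiction y≈0 y≉0

    δ-≉0 : ∀ c {y} → ¬ y ≈ 0# → δ c y ≈ c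
    δ-≉0 c {y} y≉0 with y ≟ 0#
    ... | yes y≈0 = contradiction y≈0 y≉0
    ... | no  _   = refl

  x^[Q-1] : ∀ {x} → ¬ x ≈ 0# → x ^ (Q ∸ 1) ≈ 1#
  x^[Q-1] {x} x≉0 = *-cancelˡ P≉0 (begin
    P * x ^ (Q ∸ 1)                                         ≈⟨ *-comm _ _ ⟩
    x ^ (Q ∸ 1) * P                                         ≈⟨ *-congʳ (sym count) ⟩
    product (δ x ∘ from) * P                                ≈⟨ sym (product-* (δ x ∘ from) (h ∘ from)) ⟩
    product (λ i → δ x (from i) * h (from i))               ≈⟨ product-cong (λ i → sym (h-* (from i))) ⟩
    product (λ i → h (x * from i))                          ≈⟨ sym (reindexᴹ *-commutativeMonoid h h-cong (x *_) (x⁻¹ *_) *-congˡ *-congˡ xx⁻¹* x⁻¹x*) ⟩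
    P                                                       ≈⟨ sym (*-identityʳ P) ⟩
    P * 1#                                                  ∎)
    where
    open ≈-Reasoning
    h : Carrier → Carrier
    h y = δ y y
    h-cong : ∀ {y z} → y ≈ z → h y ≈ h z
    h-cong {y} {z} y≈z with y ≟ 0#
    ... | yes y≈0 = sym (δ-0 z (trans (sym y≈z) y≈0))
    ... | no  y≉0 = trans y≈z (sym (δ-≉0 z (y≉0 ∘ trans y≈z)))
    h-≉0 : ∀ y → ¬ h y ≈ 0#
    h-≉0 y with y ≟ 0#
    ... | yes _   = 1≉0
    ... | no  y≉0 = y≉0
    h-* : ∀ y → h (x * y) ≈ δ x y * h y
    h-* y with y ≟ 0#
    ... | yes y≈0 = trans (δ-0 _ (trans (*-congˡ y≈0) (zeroʳ x))) (sym (*-identityˡ 1#))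
    ... | no  y≉0 = δ-≉0 _ (*-≉0 x≉0 y≉0)
    P = product (h ∘ from)
    P≉0 : ¬ P ≈ 0#
    P≉0 = product-≉0 (h ∘ from) (h-≉0 ∘ from)
    x⁻¹ = proj₁ (inverse x≉0)
    xx⁻¹ : x * x⁻¹ ≈ 1#
    xx⁻¹ = proj₂ (inverse x≉0)
    xx⁻¹* : ∀ y → x * (x⁻¹ * y) ≈ y
    xx⁻¹* y = trans (sym (*-assoc _ _ _)) (trans (*-congʳ xx⁻¹) (*-identityˡ y))
    x⁻¹x* : ∀ y → x⁻¹ * (x * y) ≈ y
    x⁻¹x* y = trans (sym (*-assoc _ _ _)) (trans (*-congʳ (trans (*-comm _ _) xx⁻¹)) (*-identityˡ y))
    -- The one zero among the `Q` elements contributes 1, whence the exponent `Q ∸ 1`.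
    count : product (δ x ∘ from) ≈ x ^ (Q ∸ 1)
    count = count' Q from (to 0#) (from∘to 0#) (λ j j≢ e → j≢ (≡.trans (≡.sym (to∘from j)) (to-cong e)))
      where
      open MonoidSum *-commutativeMonoid using (sum-remove)
      count' : ∀ n (f : Fin n → Carrier) i → f i ≈ 0# → (∀ j → j ≢ i → ¬ f j ≈ 0#) → product (δ x ∘ f) ≈ x ^ (n ∸ 1)
      count' (suc n) f i fi≈0 f≉0 = trans (sum-remove {i = i} (δ x ∘ f)) (trans
        (*-cong (δ-0 x fi≈0) (product-cong {n} (λ j → δ-≉0 x (f≉0 (Fin.punchIn i j) (Fin.punchInᵢ≢i i j)))))
        (trans (*-identityˡ _) (product-const n x)))

  1≤Q : 1 ≤ Q
  1≤Q = ℕ.<⇒≤ 1<Q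

  x^Q : ∀ x → x ^ Q ≈ x
  x^Q x with x ≟ 0#
  ... | yes x≈0 = trans (^-congˡ Q x≈0) (trans (0^n 1≤Q) (sym x≈0))
  ... | no  x≉0 = trans (^-congʳ x (≡.sym (m∸1+1≡m 1≤Q))) (trans (*-congˡ (x^[Q-1] x≉0)) (*-identityʳ x))

  -- Positivity of `c` makes this hold at x = 0 as well.
  ^-periodic : ∀ x {c} → 0 < c → ∀ k → x ^ (c ℕ.+ k ℕ.* (Q ∸ 1)) ≈ x ^ c
  ^-periodic x {suc c} _ zero    = ^-congʳ x (ℕ.+-identityʳ (suc c))
  ^-periodic x {suc c} h (suc k) = begin
    x ^ (suc c ℕ.+ (Q ∸ 1 ℕ.+ k ℕ.* (Q ∸ 1)))      ≈⟨ ^-congʳ x (≡.trans (+-perm c (Q ∸ 1) (k ℕ.* (Q ∸ 1))) (≡.cong (ℕ._+ (c ℕ.+ k ℕ.* (Q ∸ 1))) (m∸1+1≡m 1≤Q))) ⟩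
    x ^ (Q ℕ.+ (c ℕ.+ k ℕ.* (Q ∸ 1)))              ≈⟨ ^-homo-* x Q _ ⟩
    x ^ Q * x ^ (c ℕ.+ k ℕ.* (Q ∸ 1))              ≈⟨ *-congʳ (x^Q x) ⟩
    x ^ (suc c ℕ.+ k ℕ.* (Q ∸ 1))                  ≈⟨ ^-periodic x h k ⟩
    x ^ suc c                                      ∎
    where
    open ≈-Reasoning
    open +-*-Solver using () renaming (solve to solveℕ; _:+_ to _⊞_; con to conℕ; _:=_ to _≗_)
    +-perm : ∀ c r s → suc c ℕ.+ (r ℕ.+ s) ≡ suc r ℕ.+ (c ℕ.+ s)
    +-perm = solveℕ 3 (λ c r s → (conℕ 1 ⊞ c) ⊞ (r ⊞ s) ≗ (conℕ 1 ⊞ r) ⊞ (c ⊞ s)) ≡.refl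

  -- Translation by 1 permutes the field, so the sum of all elements absorbs `Q` copies of 1.
  ⌜Q⌝≈0 : ⌜ Q ⌝ ≈ 0#
  ⌜Q⌝≈0 = begin
    ⌜ Q ⌝                                     ≈⟨ solve 2 (λ s q → q := (s :+ q) :- s) refl S ⌜ Q ⌝ ⟩
    (S + ⌜ Q ⌝) - S                           ≈⟨ +-congʳ (sym S+Q) ⟩
    S - S                                     ≈⟨ -‿inverseʳ S ⟩
    0#                                        ∎
    where
    open ≈-Reasoning
    S = sum from
    S+Q : S ≈ S + ⌜ Q ⌝
    S+Q = begin
      S                                ≈⟨ reindexᴹ +-commutativeMonoid id id (_+ 1#) (_- 1#) +-congʳ +-congʳ
                                           (solve 1 (λ x → x :- con (+ 1) :+ con (+ 1) := x) refl)
                                           (solve 1 (λ x → x :+ con (+ 1) :- con (+ 1) := x) refl) ⟩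
      sum (λ i → from i + 1#)          ≈⟨ ∑-distrib-+ from (const 1#) ⟩
      S + sum {Q} (const 1#)           ≈⟨ +-congˡ (trans (sum-const Q 1#) (*-identityʳ _)) ⟩
      S + ⌜ Q ⌝                        ∎

  -- Functions of monic polynomials of degree `d`, in Horner form. Coefficients are not stored as
  -- data of their own, since only roots are to be counted.
  Monic : ℕ → (Carrier → Carrier) → Set (a ⊔ ℓ₁)
  Monic zero    f = ∀ x → f x ≈ 1#
  Monic (suc d) f = ∃[ g ] (Monic d g × ∃[ c ] ∀ x → f x ≈ x * g x + c)

  -- Synthetic division along the Horner form: with f = x g + c and g(x) - g(r) = (x - r) h(x), the
  -- cofactor is x h(x) + g(r).
  factor : ∀ d f → Monic (suc d) f → ∀ r → ∃[ g ] (Monic d g × (∀ x → f x - f r ≈ (x - r) * g x))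
  factor zero f (g , g≈1 , c , f≈) r = const 1# , (λ _ → refl) , λ x → begin
    f x - f r                         ≈⟨ +-cong (f≈ x) (-‿cong (f≈ r)) ⟩
    (x * g x + c) - (r * g r + c)     ≈⟨ +-cong (+-congʳ (*-congˡ (g≈1 x))) (-‿cong (+-congʳ (*-congˡ (g≈1 r)))) ⟩
    (x * 1# + c) - (r * 1# + c)       ≈⟨ solve 3 (λ x r c → (x :* con (+ 1) :+ c) :- (r :* con (+ 1) :+ c) := (x :- r) :* con (+ 1)) refl x r c ⟩
    (x - r) * 1#                      ∎
    where open ≈-Reasoning
  factor (suc d) f (g , g-monic , c , f≈) r with h , h-monic , g-fact ← factor d g g-monic r =
    (λ x → x * h x + g r) , (h , h-monic , g r , λ _ → refl) , λ x → begin
    f x - f r                                 ≈⟨ +-cong (f≈ x) (-‿cong (f≈ r)) ⟩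
    (x * g x + c) - (r * g r + c)             ≈⟨ solve 5 (λ x r c u v → (x :* u :+ c) :- (r :* v :+ c) := (x :- r) :* v :+ x :* (u :- v)) refl x r c (g x) (g r) ⟩
    (x - r) * g r + x * (g x - g r)           ≈⟨ +-congˡ (*-congˡ (g-fact x)) ⟩
    (x - r) * g r + x * ((x - r) * h x)       ≈⟨ solve 4 (λ x r v h → (x :- r) :* v :+ x :* ((x :- r) :* h) := (x :- r) :* (x :* h :+ v)) refl x r (g r) (h x) ⟩
    (x - r) * (x * h x + g r)                 ∎
    where open ≈-Reasoning

  root-bound : ∀ d f → Monic d f → (r : Fin (suc d) → Carrier) → (∀ i j → r i ≈ r j → i ≡ j) → ¬ (∀ i → f (r i) ≈ 0#)
  root-bound zero    f f≈1 r r-inj f≈0 = 1≉0 (trans (sym (f≈1 _)) (f≈0 Fin.zero))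
  root-bound (suc d) f f-monic r r-inj f≈0 with g , g-monic , f-fact ← factor d f f-monic (r Fin.zero) =
    root-bound d g g-monic (r ∘ Fin.suc) (λ i j e → Fin.suc-injective (r-inj _ _ e)) λ i →
      *-zero (λ e → contradiction (r-inj _ _ (x-y≈0⇒x≈y e)) λ ())
        (trans (sym (f-fact (r (Fin.suc i)))) (trans (+-cong (f≈0 _) (-‿cong (f≈0 _))) (-‿inverseʳ 0#)))

  monic-^ : ∀ d → Monic d (_^ d)
  monic-^ zero    x = refl
  monic-^ (suc d) = (_^ d) , monic-^ d , 0# , λ x → sym (+-identityʳ _)

  monic-^-const : ∀ d → Monic (suc d) (λ x → x ^ suc d - 1#)
  monic-^-const d = (_^ d) , monic-^ d , - 1# , λ x → refl

  monic-x^n-x : ∀ d → Monic (suc (suc d)) (λ x → x ^ suc (suc d) - x)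
  monic-x^n-x d = (λ x → x ^ suc d - 1#) , monic-^-const d , 0# ,
    λ x → solve 2 (λ x y → x :* y :- x := x :* (y :- con (+ 1)) :+ con (+ 0)) refl x (x ^ suc d)

  -- The `n` values of `f` already exhaust the roots of x^n - x. Inside K this identifies the prime
  -- field (n = p) and the image of F (n = q).
  fixed-by-^ : ∀ {n} → 1 < n → (f : Fin n → Carrier) → (∀ i j → f i ≈ f j → i ≡ j) → (∀ i → f i ^ n ≈ f i) →
               ∀ y → y ^ n ≈ y → ∃[ i ] y ≈ f i
  fixed-by-^ {suc zero} (s≤s ())
  fixed-by-^ {suc (suc n)} 1<n f f-inj f-fixed y y-fixed with Fin.any? (λ i → y ≟ f i)
  ... | yes y∈f = y∈f
  ... | no  y∉f = ⊥-elim (root-bound (suc (suc n)) _ (monic-x^n-x n) r r-inj r-root)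
    where
    r : Fin (suc (suc (suc n))) → Carrier
    r Fin.zero    = y
    r (Fin.suc i) = f i
    r-inj : ∀ i j → r i ≈ r j → i ≡ j
    r-inj Fin.zero    Fin.zero    e = ≡.refl
    r-inj Fin.zero    (Fin.suc j) e = contradiction (j , e) y∉f
    r-inj (Fin.suc i) Fin.zero    e = contradiction (i , sym e) y∉f
    r-inj (Fin.suc i) (Fin.suc j) e = ≡.cong Fin.suc (f-inj i j e)
    r-root : ∀ i → r i ^ suc (suc n) - r i ≈ 0#
    r-root Fin.zero    = x≈y⇒x-y≈0 y-fixed
    r-root (Fin.suc i) = x≈y⇒x-y≈0 (f-fixed i)

  -- Stands in for a generator of the multiplicative group: if every nonzero element had c-th power
  -- 1, all `Q` elements would be roots of x^(c+1) - x, whose degree is below `Q`.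
  nontrivial-power-small : ∀ c → 0 < c → c < Q ∸ 1 → ∃[ g ] (¬ g ≈ 0# × ¬ g ^ c ≈ 1#)
  nontrivial-power-small (suc c) _ c<Q-1 = conclude (Fin.¬∀⟶∃¬ Q Fixed (λ i → from i ^ suc (suc c) ≟ from i) ¬all)
    where
    Fixed : Fin Q → Set ℓ₁
    Fixed i = from i ^ suc (suc c) ≈ from i
    2+c<Q : suc (suc (suc c)) ≤ Q
    2+c<Q = ≡.subst (suc (suc (suc c)) ≤_) (m∸1+1≡m 1≤Q) (s≤s c<Q-1)
    ¬all : ¬ (∀ i → Fixed i)
    ¬all all = root-bound (suc (suc c)) (λ x → x ^ suc (suc c) - x) (monic-x^n-x c) (λ i → from (inject≤ i 2+c<Q))
      (λ i j e → Fin.inject≤-injective 2+c<Q 2+c<Q i j (from-injective e)) (λ i → x≈y⇒x-y≈0 (all (inject≤ i 2+c<Q)))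
    conclude : ∃[ i ] ¬ Fixed i → ∃[ g ] (¬ g ≈ 0# × ¬ g ^ suc c ≈ 1#)
    conclude (i , ≉) = from i , (λ x≈0 → ≉ (trans (*-congʳ x≈0) (trans (zeroˡ _) (sym x≈0))))
                              , (λ x^c≈1 → ≉ (trans (*-congˡ x^c≈1) (*-identityʳ _)))

  nontrivial-power : ∀ c → ¬ (Q ∸ 1) ∣ c → ∃[ g ] (¬ g ≈ 0# × ¬ g ^ c ≈ 1#)
  nontrivial-power c ∤c = reduce (nontrivial-power-small r 0<r (ℕ.m%n<n c (Q ∸ 1)))
    where
    instance
      Q-1≢0 : NonZero (Q ∸ 1)
      Q-1≢0 = ℕ.>-nonZero (ℕ.m<n⇒0<n∸m 1<Q)
    r = c ℕ.% (Q ∸ 1)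
    0<r : 0 < r
    0<r = ℕ.n≢0⇒n>0 (λ r≡0 → ∤c (∣.m%n≡0⇒n∣m c (Q ∸ 1) r≡0))
    reduce : ∃[ g ] (¬ g ≈ 0# × ¬ g ^ r ≈ 1#) → ∃[ g ] (¬ g ≈ 0# × ¬ g ^ c ≈ 1#)
    reduce (g , g≉0 , g^r≉1) = g , g≉0 , λ g^c≈1 → g^r≉1
      (trans (sym (^-periodic g 0<r (c ℕ./ (Q ∸ 1)))) (trans (^-congʳ g (≡.sym (ℕ.m≡m%n+[m/n]*n c (Q ∸ 1)))) g^c≈1))

  1^Q-1∣ : ∀ {x c} → ¬ x ≈ 0# → (Q ∸ 1) ∣ c → x ^ c ≈ 1#
  1^Q-1∣ {x} {c} x≉0 (divides k c≡) = trans (^-congʳ x (≡.trans c≡ (ℕ.*-comm k (Q ∸ 1))))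
    (trans (sym (^-assocʳ x (Q ∸ 1) k)) (trans (^-congˡ k (x^[Q-1] x≉0)) (1^n k)))

  primitive-root-order : ∀ n .{{_ : NonZero n}} {x} → IsPrimitiveRootOfUnity K n x → ∀ c → x ^ c ≈ 1# → n ∣ c
  primitive-root-order n {x} (x^n≈1 , minimal) c x^c≈1 = ∣.m%n≡0⇒n∣m c n (zero? (c ℕ.% n) ≡.refl)
    where
    x^[c%n] : x ^ (c ℕ.% n) ≈ 1#
    x^[c%n] = begin
      x ^ (c ℕ.% n)                                ≈⟨ sym (*-identityʳ _) ⟩
      x ^ (c ℕ.% n) * 1#                           ≈⟨ *-congˡ (sym (trans (^-congˡ (c ℕ./ n) x^n≈1) (1^n (c ℕ./ n)))) ⟩
      x ^ (c ℕ.% n) * (x ^ n) ^ (c ℕ./ n)          ≈⟨ *-congˡ (trans (^-assocʳ x n (c ℕ./ n)) (^-congʳ x (ℕ.*-comm n (c ℕ./ n)))) ⟩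
      x ^ (c ℕ.% n) * x ^ (c ℕ./ n ℕ.* n)          ≈⟨ sym (^-homo-* x (c ℕ.% n) (c ℕ./ n ℕ.* n)) ⟩
      x ^ (c ℕ.% n ℕ.+ c ℕ./ n ℕ.* n)              ≈⟨ ^-congʳ x (≡.sym (ℕ.m≡m%n+[m/n]*n c n)) ⟩
      x ^ c                                        ≈⟨ x^c≈1 ⟩
      1#                                           ∎
      where open ≈-Reasoning
    zero? : ∀ d → c ℕ.% n ≡ d → d ≡ 0
    zero? zero    _  = ≡.refl
    zero? (suc d) eq = contradiction (trans (^-congʳ x (≡.sym eq)) x^[c%n])
      (minimal (suc d) (s≤s z≤n) (≡.subst (_< n) eq (ℕ.m%n<n c n)))

module Characteristic {a ℓ₁ ℓ₂} (K : HeytingField a ℓ₁ ℓ₂) {p} (pr : Prime p) M (0<M : 0 < M) (order : HasOrder K (p ℕ.^ M)) where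

  1<p : 1 < p
  1<p = prime⇒1<p pr

  1<p^ : ∀ {n} → 0 < n → 1 < p ℕ.^ n
  1<p^ {suc n} _ = ℕ.≤-trans 1<p (≡.subst (ℕ._≤ p ℕ.^ suc n) (ℕ.*-identityʳ p) (ℕ.*-monoʳ-≤ p (ℕ.m^n>0 p n)))
    where instance _ = prime⇒nonZero pr

  open FieldKit K order (1<p^ 0<M) public

  ^≈0 : ∀ {x} n → x ^ n ≈ 0# → x ≈ 0#
  ^≈0 {x} n x^n≈0 with x ≟ 0#
  ... | yes x≈0 = x≈0
  ... | no  x≉0 = contradiction x^n≈0 (^-≉0 n x≉0)

  ⌜p⌝≈0 : ⌜ p ⌝ ≈ 0#
  ⌜p⌝≈0 = ^≈0 M (trans (sym (⌜⌝-^ p M)) ⌜Q⌝≈0)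

  ⌜p*⌝≈0 : ∀ n → ⌜ n ℕ.* p ⌝ ≈ 0#
  ⌜p*⌝≈0 n = trans (⌜⌝-* n p) (trans (*-congˡ ⌜p⌝≈0) (zeroʳ _))

  ⌜m⌝≈0⇒p∣m : ∀ m → ⌜ m ⌝ ≈ 0# → p ∣ m
  ⌜m⌝≈0⇒p∣m m ⌜m⌝≈0 with p ∣.∣? m
  ... | yes p∣m = p∣m
  ... | no  p∤m = contradiction (bézout (coprime-Bézout (prime⇒coprime′ p∤m))) 1≉0
    where
    prime⇒coprime′ : ¬ p ∣ m → Coprime m p
    prime⇒coprime′ p∤m {d} (d∣m , d∣p) with prime⇒irreducible pr d∣p
    ... | inj₁ d≡1 = d≡1
    ... | inj₂ d≡p = contradiction (≡.subst (_∣ m) d≡p d∣m) p∤m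
    ⌜m*⌝≈0 : ∀ n → ⌜ n ℕ.* m ⌝ ≈ 0#
    ⌜m*⌝≈0 n = trans (⌜⌝-* n m) (trans (*-congˡ ⌜m⌝≈0) (zeroʳ _))
    bézout : Bézout.Identity 1 m p → 1# ≈ 0#
    bézout (Bézout.+- x y eq) = trans (sym (trans (+-congˡ (⌜p*⌝≈0 y)) (+-identityʳ 1#))) (trans (⌜⌝-cong eq) (⌜m*⌝≈0 x))
    bézout (Bézout.-+ x y eq) = trans (sym (trans (+-congˡ (⌜m*⌝≈0 x)) (+-identityʳ 1#))) (trans (⌜⌝-cong eq) (⌜p*⌝≈0 y))

  ⌜⌝-%p : ∀ n .{{_ : NonZero p}} → ⌜ n ⌝ ≈ ⌜ n ℕ.% p ⌝
  ⌜⌝-%p n = trans (⌜⌝-cong (ℕ.m≡m%n+[m/n]*n n p)) (trans (⌜⌝-+ (n ℕ.% p) _) (trans (+-congˡ (⌜p*⌝≈0 (n ℕ./ p))) (+-identityʳ _)))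

  private
    ⌜⌝-injective-≤ : ∀ {m n} → m ≤ n → n < p → ⌜ m ⌝ ≈ ⌜ n ⌝ → m ≡ n
    ⌜⌝-injective-≤ {m} {n} m≤n n<p e with ℕ.m≤n⇒m<n∨m≡n m≤n
    ... | inj₂ m≡n = m≡n
    ... | inj₁ m<n = contradiction (∣⇒≤ {{ℕ.>-nonZero (ℕ.m<n⇒0<n∸m m<n)}} (⌜m⌝≈0⇒p∣m (n ∸ m) diff))
                                   (ℕ.<⇒≱ (ℕ.≤-<-trans (ℕ.m∸n≤m n m) n<p))
      where
      diff : ⌜ n ∸ m ⌝ ≈ 0#
      diff = begin
        ⌜ n ∸ m ⌝                      ≈⟨ solve 2 (λ d m → d := (m :+ d) :- m) refl ⌜ n ∸ m ⌝ ⌜ m ⌝ ⟩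
        (⌜ m ⌝ + ⌜ n ∸ m ⌝) - ⌜ m ⌝    ≈⟨ +-congʳ (trans (sym (⌜⌝-+ m (n ∸ m))) (⌜⌝-cong (ℕ.m+[n∸m]≡n m≤n))) ⟩
        ⌜ n ⌝ - ⌜ m ⌝                  ≈⟨ x≈y⇒x-y≈0 (sym e) ⟩
        0#                             ∎
        where open ≈-Reasoning

  ⌜⌝-injective : ∀ {m n} → m < p → n < p → ⌜ m ⌝ ≈ ⌜ n ⌝ → m ≡ n
  ⌜⌝-injective {m} {n} m<p n<p e with ℕ.≤-total m n
  ... | inj₁ m≤n = ⌜⌝-injective-≤ m≤n n<p e
  ... | inj₂ n≤m = ≡.sym (⌜⌝-injective-≤ n≤m m<p (sym e))

  frobenius-+ : ∀ x y → (x + y) ^ p ≈ x ^ p + y ^ p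
  frobenius-+ x y with z , e ← freshman pr x y =
    trans e (trans (+-congˡ (trans (*-congʳ ⌜p⌝≈0) (zeroˡ _))) (+-identityʳ _))

  ^p^suc : ∀ x u → x ^ (p ℕ.^ suc u) ≈ (x ^ (p ℕ.^ u)) ^ p
  ^p^suc x u = trans (^-congʳ x (ℕ.*-comm p (p ℕ.^ u))) (sym (^-assocʳ x (p ℕ.^ u) p))

  ^p^-+ : ∀ u x y → (x + y) ^ (p ℕ.^ u) ≈ x ^ (p ℕ.^ u) + y ^ (p ℕ.^ u)
  ^p^-+ zero    x y = trans (x^1 _) (sym (+-cong (x^1 _) (x^1 _)))
  ^p^-+ (suc u) x y = trans (^p^suc _ u) (trans (^-congˡ p (^p^-+ u x y))
    (trans (frobenius-+ _ _) (sym (+-cong (^p^suc x u) (^p^suc y u)))))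

  ^p^-sum : ∀ u {n} (f : Vector Carrier n) → sum f ^ (p ℕ.^ u) ≈ sum (λ i → f i ^ (p ℕ.^ u))
  ^p^-sum u {zero}  f = 0^n (ℕ.m^n>0 p u) where instance _ = prime⇒nonZero pr
  ^p^-sum u {suc n} f = trans (^p^-+ u _ _) (+-congˡ (^p^-sum u (f ∘ Fin.suc)))

  fixed-^p^ : ∀ {x} u → x ^ p ≈ x → x ^ (p ℕ.^ u) ≈ x
  fixed-^p^ zero    x^p≈x = x^1 _
  fixed-^p^ (suc u) x^p≈x = trans (^p^suc _ u) (trans (^-congˡ p (fixed-^p^ u x^p≈x)) x^p≈x)

  ⌜⌝-fixed : ∀ n → ⌜ n ⌝ ^ p ≈ ⌜ n ⌝
  ⌜⌝-fixed zero    = 0^n (ℕ.<⇒≤ 1<p)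
  ⌜⌝-fixed (suc n) = trans (frobenius-+ 1# ⌜ n ⌝) (+-cong (1^n p) (⌜⌝-fixed n))

  prime-field : ∀ {y} → y ^ p ≈ y → ∃[ i ] y ≈ ⌜ toℕ {p} i ⌝
  prime-field {y} = fixed-by-^ 1<p (λ i → ⌜ toℕ i ⌝)
    (λ i j e → Fin.toℕ-injective (⌜⌝-injective (Fin.toℕ<n i) (Fin.toℕ<n j) e)) (λ i → ⌜⌝-fixed (toℕ i)) y

  Tr : ℕ → ℕ → Carrier → Carrier
  Tr = trace K

  Tr-cong : ∀ r m {x y} → x ≈ y → Tr r m x ≈ Tr r m y
  Tr-cong r m x≈y = sum-cong-≋ {m} λ i → ^-congˡ (r ℕ.^ toℕ i) x≈y

  ^^≡ : ∀ e i → (p ℕ.^ e) ℕ.^ i ≡ p ℕ.^ (e ℕ.* i)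
  ^^≡ e i = ℕ.^-*-assoc p e i

  Tr-+ : ∀ e m x y → Tr (p ℕ.^ e) m (x + y) ≈ Tr (p ℕ.^ e) m x + Tr (p ℕ.^ e) m y
  Tr-+ e m x y = trans (sum-cong-≋ {m} step) (∑-distrib-+ {m} (λ i → x ^ ((p ℕ.^ e) ℕ.^ toℕ i)) (λ i → y ^ ((p ℕ.^ e) ℕ.^ toℕ i)))
    where
    step : ∀ (i : Fin m) → (x + y) ^ ((p ℕ.^ e) ℕ.^ toℕ i) ≈ x ^ ((p ℕ.^ e) ℕ.^ toℕ i) + y ^ ((p ℕ.^ e) ℕ.^ toℕ i)
    step i rewrite ^^≡ e (toℕ i) = ^p^-+ (e ℕ.* toℕ i) x y

  Tr-* : ∀ e m {z} x → z ^ (p ℕ.^ e) ≈ z → Tr (p ℕ.^ e) m (z * x) ≈ z * Tr (p ℕ.^ e) m x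
  Tr-* e m {z} x z-fixed = trans (sum-cong-≋ {m} λ i → trans (^-distrib-* z x ((p ℕ.^ e) ℕ.^ toℕ i)) (*-congʳ (fixed (toℕ i))))
                           (sym (*-distribˡ-sum {m} z (λ i → x ^ ((p ℕ.^ e) ℕ.^ toℕ i))))
    where
    fixed : ∀ i → z ^ ((p ℕ.^ e) ℕ.^ i) ≈ z
    fixed zero    = x^1 z
    fixed (suc i) = trans (sym (^-assocʳ z (p ℕ.^ e) ((p ℕ.^ e) ℕ.^ i))) (trans (^-congˡ ((p ℕ.^ e) ℕ.^ i) z-fixed) (fixed i))

  Tr-^ : ∀ e m x → (p ℕ.^ e) ℕ.^ m ≡ p ℕ.^ M → Tr (p ℕ.^ e) m (x ^ (p ℕ.^ e)) ≈ Tr (p ℕ.^ e) m x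
  Tr-^ e m x eq = trans (sum-cong-≋ {m} λ i → ^-assocʳ x (p ℕ.^ e) _)
    (sum-rotate m (λ i → x ^ ((p ℕ.^ e) ℕ.^ i)) (trans (^-congʳ x eq) (trans (x^Q x) (sym (x^1 x)))))

  ^-Tr : ∀ e m x → Tr (p ℕ.^ e) m x ^ (p ℕ.^ e) ≈ Tr (p ℕ.^ e) m (x ^ (p ℕ.^ e))
  ^-Tr e m x = trans (^p^-sum e {m} _) (sum-cong-≋ {m} λ i →
    trans (^-assocʳ x ((p ℕ.^ e) ℕ.^ toℕ i) (p ℕ.^ e)) (trans (^-congʳ x (ℕ.*-comm ((p ℕ.^ e) ℕ.^ toℕ i) (p ℕ.^ e))) (sym (^-assocʳ x (p ℕ.^ e) ((p ℕ.^ e) ℕ.^ toℕ i)))))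

  Tr-fixed : ∀ e m x → (p ℕ.^ e) ℕ.^ m ≡ p ℕ.^ M → Tr (p ℕ.^ e) m x ^ (p ℕ.^ e) ≈ Tr (p ℕ.^ e) m x
  Tr-fixed e m x eq = trans (^-Tr e m x) (Tr-^ e m x eq)

  sum-split : ∀ e m (f : ℕ → Carrier) → sum {m ℕ.* e} (f ∘ toℕ) ≈ sum {m} (λ j → sum {e} (λ i → f (toℕ j ℕ.* e ℕ.+ toℕ i)))
  sum-split e zero    f = refl
  sum-split e (suc m) f = trans (head e f) (+-congˡ (trans (sum-split e m (λ i → f (e ℕ.+ i)))
    (sum-cong-≋ {m} λ j → sum-cong-≋ {e} λ i → reflexive (≡.cong f (≡.sym (ℕ.+-assoc e (toℕ j ℕ.* e) (toℕ i)))))))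
    where
    head : ∀ e (f : ℕ → Carrier) {n} → sum {e ℕ.+ n} (f ∘ toℕ) ≈ sum {e} (f ∘ toℕ) + sum {n} (λ i → f (e ℕ.+ toℕ i))
    head zero    f = sym (+-identityˡ _)
    head (suc e) f = trans (+-congˡ (head e (f ∘ suc))) (sym (+-assoc _ _ _))

  -- The exponents p^n with n < me are sorted by writing n = je + i with i < e; the inner sum over j
  -- is then the p^i-th power of the inner trace.
  Tr-tower : ∀ e m x → Tr p (m ℕ.* e) x ≈ Tr p e (Tr (p ℕ.^ e) m x)
  Tr-tower e m x = begin
    Tr p (m ℕ.* e) x                                                              ≈⟨ sum-split e m (λ i → x ^ (p ℕ.^ i)) ⟩
    sum {m} (λ j → sum {e} (λ i → x ^ (p ℕ.^ (toℕ j ℕ.* e ℕ.+ toℕ i))))           ≈⟨ ∑-comm {m} {e} (λ j i → x ^ (p ℕ.^ (toℕ j ℕ.* e ℕ.+ toℕ i))) ⟩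
    sum {e} (λ i → sum {m} (λ j → x ^ (p ℕ.^ (toℕ j ℕ.* e ℕ.+ toℕ i))))           ≈⟨ sum-cong-≋ {e} (λ i → sum-cong-≋ {m} (λ j → exponents (toℕ j) (toℕ i))) ⟩
    sum {e} (λ i → sum {m} (λ j → (x ^ ((p ℕ.^ e) ℕ.^ toℕ j)) ^ (p ℕ.^ toℕ i)))   ≈⟨ sum-cong-≋ {e} (λ i → sym (^p^-sum (toℕ i) {m} _)) ⟩
    Tr p e (Tr (p ℕ.^ e) m x)                                                     ∎
    where
    open ≈-Reasoning
    exponents : ∀ j i → x ^ (p ℕ.^ (j ℕ.* e ℕ.+ i)) ≈ (x ^ ((p ℕ.^ e) ℕ.^ j)) ^ (p ℕ.^ i)
    exponents j i = trans (^-congʳ x (≡.trans (ℕ.^-distribˡ-+-* p (j ℕ.* e) i)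
      (≡.cong (ℕ._* p ℕ.^ i) (≡.trans (≡.cong (p ℕ.^_) (ℕ.*-comm j e)) (≡.sym (^^≡ e j)))))) (sym (^-assocʳ x ((p ℕ.^ e) ℕ.^ j) (p ℕ.^ i)))

-- Power sums of a multiplicative map on a finite field

module _ {a ℓ₁ ℓ₂} (K : HeytingField a ℓ₁ ℓ₂) {Q} (order : HasOrder K Q) (1<Q : 1 < Q) {t ℓt} (T : CommutativeRing t ℓt) where

  private
    module K = FieldKit K order 1<Q
    module T = RingKit T

  -- `τ` will be the Teichmüller map on K, its restriction to F, or the identity of K. Invertibility
  -- of 1 - τ(x) replaces cancellation, because `T` need not be a domain.
  module MultiplicativeSums
    (τ : K.Carrier → T.Carrier)
    (τ-cong : ∀ {x y} → x K.≈ y → τ x T.≈ τ y)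
    (τ-0 : τ K.0# T.≈ T.0#) (τ-1 : τ K.1# T.≈ T.1#)
    (τ-* : ∀ x y → τ (x K.* y) T.≈ τ x T.* τ y)
    (1-τ-invertible : ∀ {x} → ¬ x K.≈ K.1# → ∃[ u ] (T.1# T.- τ x) T.* u T.≈ T.1#)
    where

    open T

    ΣK : (K.Carrier → Carrier) → Carrier
    ΣK f = sum (λ i → f (K.from i))

    ΣK-cong : ∀ {f g} → (∀ x → f x ≈ g x) → ΣK f ≈ ΣK g
    ΣK-cong f≈g = sum-cong-≋ {Q} λ i → f≈g (K.from i)

    ΣK-single : ∀ f x → (∀ {y z} → y K.≈ z → f y ≈ f z) → (∀ y → ¬ y K.≈ x → f y ≈ 0#) → ΣK f ≈ f x
    ΣK-single f x f-cong f≈0 = trans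
      (sum-single (λ i → f (K.from i)) (K.to x) λ j j≢ → f≈0 _ λ e → j≢ (≡.trans (≡.sym (K.to∘from j)) (K.to-cong e)))
      (f-cong (K.from∘to x))

    ΣK-* : ∀ c f → ΣK (λ x → c * f x) ≈ c * ΣK f
    ΣK-* c f = sym (*-distribˡ-sum {Q} c (λ i → f (K.from i)))

    ΣK-+ : ∀ f g → ΣK (λ x → f x + g x) ≈ ΣK f + ΣK g
    ΣK-+ f g = ∑-distrib-+ {Q} (λ i → f (K.from i)) (λ i → g (K.from i))

    τ-^ : ∀ x n → τ (x K.^ n) ≈ τ x ^ n
    τ-^ x zero    = τ-1
    τ-^ x (suc n) = trans (τ-* x (x K.^ n)) (*-congˡ (τ-^ x n))

    cancel-1-τ : ∀ {x y} → ¬ x K.≈ K.1# → (1# - τ x) * y ≈ 0# → y ≈ 0#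
    cancel-1-τ {x} {y} x≉1 e with u , eu ← 1-τ-invertible x≉1 = begin
      y                          ≈⟨ sym (*-identityˡ y) ⟩
      1# * y                     ≈⟨ *-congʳ (sym eu) ⟩
      ((1# - τ x) * u) * y       ≈⟨ solve 3 (λ v u y → v :* u :* y := u :* (v :* y)) refl (1# - τ x) u y ⟩
      u * ((1# - τ x) * y)       ≈⟨ *-congˡ e ⟩
      u * 0#                     ≈⟨ zeroʳ u ⟩
      0#                         ∎
      where open ≈-Reasoning

    module _ (f : K.Carrier → Carrier) (f-cong : ∀ {x y} → x K.≈ y → f x ≈ f y) where

      reindex : (g g' : K.Carrier → K.Carrier) →
                (∀ {x y} → x K.≈ y → g x K.≈ g y) → (∀ {x y} → x K.≈ y → g' x K.≈ g' y) →
                (∀ x → g (g' x) K.≈ x) → (∀ x → g' (g x) K.≈ x) → ΣK f ≈ ΣK (λ x → f (g x))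
      reindex = K.reindexᴹ +-commutativeMonoid f f-cong

      reindex-* : ∀ {z} → ¬ z K.≈ K.0# → ΣK f ≈ ΣK (λ x → f (z K.* x))
      reindex-* {z} z≉0 = reindex (z K.*_) (z⁻¹ K.*_) K.*-congˡ K.*-congˡ
        (λ y → K.trans (K.sym (K.*-assoc z z⁻¹ y)) (K.trans (K.*-congʳ zz⁻¹) (K.*-identityˡ y)))
        (λ y → K.trans (K.sym (K.*-assoc z⁻¹ z y)) (K.trans (K.*-congʳ (K.trans (K.*-comm z⁻¹ z) zz⁻¹)) (K.*-identityˡ y)))
        where
        z⁻¹ = proj₁ (K.inverse z≉0)
        zz⁻¹ = proj₂ (K.inverse z≉0)

      reindex-+ : ∀ z → ΣK f ≈ ΣK (λ x → f (x K.+ z))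
      reindex-+ z = reindex (K._+ z) (K._- z) K.+-congʳ K.+-congʳ
        (λ x → K.solve 2 (λ x z → x K.:- z K.:+ z K.:= x) K.refl x z)
        (λ x → K.solve 2 (λ x z → x K.:+ z K.:- z K.:= x) K.refl x z)

      reindex-- : ∀ z → ΣK f ≈ ΣK (λ x → f (z K.- x))
      reindex-- z = reindex (λ x → z K.- x) (λ x → z K.- x) (λ e → K.+-congˡ (K.-‿cong e)) (λ e → K.+-congˡ (K.-‿cong e)) inv inv
        where
        inv : ∀ x → z K.- (z K.- x) K.≈ x
        inv x = K.solve 2 (λ x z → z K.:- (z K.:- x) K.:= x) K.refl x z

    -- If g^c is not 1, the substitution x → gx multiplies the sum by τ(g^c), and the factor 1 -
    -- τ(g^c) can be cancelled.
    power-sum-∤ : ∀ c → ¬ (Q ∸ 1) ∣ c → ΣK (λ x → τ (x K.^ c)) ≈ 0#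
    power-sum-∤ c ∤c = go (K.nontrivial-power c ∤c)
      where
      open ≈-Reasoning
      S = ΣK (λ x → τ (x K.^ c))
      go : ∃[ g ] (¬ g K.≈ K.0# × ¬ g K.^ c K.≈ K.1#) → S ≈ 0#
      go (g , g≉0 , g^c≉1) = cancel-1-τ g^c≉1 (begin
        (1# - τ (g K.^ c)) * S                       ≈⟨ solve 2 (λ u s → (con (+ 1) :- u) :* s := s :- u :* s) refl (τ (g K.^ c)) S ⟩
        S - τ (g K.^ c) * S                          ≈⟨ +-congˡ (-‿cong (sym (ΣK-* (τ (g K.^ c)) (λ x → τ (x K.^ c))))) ⟩
        S - ΣK (λ x → τ (g K.^ c) * τ (x K.^ c))     ≈⟨ +-congˡ (-‿cong (ΣK-cong λ x → sym (trans (τ-cong (K.^-distrib-* g x c)) (τ-* _ _)))) ⟩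
        S - ΣK (λ x → τ ((g K.* x) K.^ c))           ≈⟨ +-congˡ (-‿cong (sym (reindex-* _ (λ e → τ-cong (K.^-congˡ c e)) g≉0))) ⟩
        S - S                                        ≈⟨ -‿inverseʳ S ⟩
        0#                                           ∎)

    power-sum-∣ : ∀ {c} → 0 < c → (Q ∸ 1) ∣ c → ΣK (λ x → τ (x K.^ c)) ≈ ⌜ Q ∸ 1 ⌝
    power-sum-∣ {c} 0<c ∣c = begin
      -- The correction 1 - τ(x^c) is supported at x = 0, where it equals 1 because c > 0. This
      -- lowers Q to Q - 1.
      ΣK (λ x → τ (x K.^ c))                  ≈⟨ ΣK-cong (λ x → solve 1 (λ u → u := con (+ 1) :- (con (+ 1) :- u)) refl (τ (x K.^ c))) ⟩
      ΣK (λ x → 1# - (1# - τ (x K.^ c)))      ≈⟨ ΣK-+ (λ _ → 1#) (λ x → - (1# - τ (x K.^ c))) ⟩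
      ΣK (λ x → 1#) + ΣK (λ x → - (1# - τ (x K.^ c)))
                                              ≈⟨ +-cong (trans (sum-const Q 1#) (*-identityʳ _))
                                                   (ΣK-single (λ x → - (1# - τ (x K.^ c))) K.0# (λ e → -‿cong (+-congˡ (-‿cong (τ-cong (K.^-congˡ c e)))))
                                                     λ x x≉0 → trans (-‿cong (trans (+-congˡ (-‿cong (trans (τ-cong (K.1^Q-1∣ x≉0 ∣c)) τ-1))) (-‿inverseʳ 1#))) -0#≈0#) ⟩
      ⌜ Q ⌝ - (1# - τ (K.0# K.^ c))           ≈⟨ +-cong (⌜⌝-cong (≡.sym (m∸1+1≡m K.1≤Q))) (-‿cong (+-congˡ (-‿cong (trans (τ-cong (K.0^n 0<c)) τ-0)))) ⟩
      (1# + ⌜ Q ∸ 1 ⌝) - (1# - 0#)            ≈⟨ solve 1 (λ q → (con (+ 1) :+ q) :- (con (+ 1) :- con (+ 0)) := q) refl ⌜ Q ∸ 1 ⌝ ⟩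
      ⌜ Q ∸ 1 ⌝                               ∎
      where open ≈-Reasoning

    root-of-unity-sum : ∀ n {γ} → γ K.^ n K.≈ K.1# → ¬ γ K.≈ K.1# → sum {n} (λ i → τ (γ K.^ toℕ i)) ≈ 0#
    root-of-unity-sum n {γ} γ^n≈1 γ≉1 = cancel-1-τ γ≉1 (trans (*-congˡ (sum-cong-≋ {n} λ i → τ-^ γ (toℕ i)))
      (trans (geometric (τ γ) n) (trans (+-congˡ (-‿cong (trans (sym (τ-^ γ n)) (trans (τ-cong γ^n≈1) τ-1)))) (-‿inverseʳ 1#))))

-- Ring homomorphisms and the powers of their kernels

module _ {a ℓ b ℓ'} (R : CommutativeRing a ℓ) (S : CommutativeRing b ℓ') where
  private
    module R = RingKit R
    module S = RingKit S

  IsHom : (R.Carrier → S.Carrier) → Set _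
  IsHom = RingMorphisms.IsRingHomomorphism R.rawRing S.rawRing

  mkHom : ∀ {f} → (∀ {x y} → x R.≈ y → f x S.≈ f y) → (∀ x y → f (x R.+ y) S.≈ f x S.+ f y) →
          (∀ x y → f (x R.* y) S.≈ f x S.* f y) → f R.1# S.≈ S.1# → IsHom f
  mkHom {f} f-cong f-+ f-* f-1 = record
    { isSemiringHomomorphism = record
      { isNearSemiringHomomorphism = record
        { +-isMonoidHomomorphism = record
          { isMagmaHomomorphism = record { isRelHomomorphism = record { cong = f-cong } ; homo = f-+ }
          ; ε-homo = f-0
          }
        ; *-homo = f-*
        }
      ; 1#-homo = f-1
      }
    ; -‿homo = λ x → S.x-y≈0⇒x≈y (S.trans (S.+-congˡ (S.-‿involutive (f x))) (S.trans (S.sym (f-+ (R.- x) x)) (S.trans (f-cong (R.-‿inverseˡ x)) f-0)))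
    }
    where
    f-0 : f R.0# S.≈ S.0#
    f-0 = S.trans (S.solve 1 (λ x → x S.:= (x S.:+ x) S.:- x) S.refl (f R.0#))
          (S.trans (S.+-congʳ (S.trans (S.sym (f-+ R.0# R.0#)) (f-cong (R.+-identityˡ R.0#)))) (S.-‿inverseʳ _))

  module HomKit {f : R.Carrier → S.Carrier} (f-hom : IsHom f) where

    open RingMorphisms.IsRingHomomorphism f-hom public
      using (0#-homo; 1#-homo; +-homo; *-homo; -‿homo) renaming (⟦⟧-cong to cong)

    ⌜⌝-homo : ∀ n → f R.⌜ n ⌝ S.≈ S.⌜ n ⌝
    ⌜⌝-homo zero    = 0#-homo
    ⌜⌝-homo (suc n) = S.trans (+-homo _ _) (S.+-cong 1#-homo (⌜⌝-homo n))

    ^-homo : ∀ x n → f (x R.^ n) S.≈ f x S.^ n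
    ^-homo x zero    = 1#-homo
    ^-homo x (suc n) = S.trans (*-homo _ _) (S.*-congˡ (^-homo x n))

    sum-homo : ∀ {n} (g : Vector R.Carrier n) → f (R.sum g) S.≈ S.sum (λ i → f (g i))
    sum-homo {zero}  g = 0#-homo
    sum-homo {suc n} g = S.trans (+-homo _ _) (S.+-congˡ (sum-homo (g ∘ Fin.suc)))

    product-homo : ∀ {n} (g : Vector R.Carrier n) → f (R.product g) S.≈ S.product (λ i → f (g i))
    product-homo {zero}  g = 1#-homo
    product-homo {suc n} g = S.trans (*-homo _ _) (S.*-congˡ (product-homo (g ∘ Fin.suc)))

module _ {a ℓ b ℓ'} (R : CommutativeRing a ℓ) (S : CommutativeRing b ℓ') where

  private
    module R = RingKit R
    module S = RingKit S

  module IdealPowers {π : R.Carrier → S.Carrier} (π-hom : IsHom R S π) where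

    private module π = HomKit R S π-hom
    open R

    -- The powers I^n of the kernel I of `π`, the power 0 being the whole ring. An inductive
    -- predicate lets `δ-Pow` recurse on a proof of membership.
    data Pow : ℕ → Carrier → Set (a ⊔ ℓ ⊔ ℓ') where
      any  : ∀ x → Pow 0 x
      resp : ∀ {n x y} → x ≈ y → Pow n x → Pow n y
      zero : ∀ {n} → Pow n 0#
      add  : ∀ {n x y} → Pow n x → Pow n y → Pow n (x + y)
      mul  : ∀ {n x y} → π x S.≈ S.0# → Pow n y → Pow (suc n) (x * y)

    π-*ˡ : ∀ r {x} → π x S.≈ S.0# → π (r * x) S.≈ S.0#
    π-*ˡ r πx≈0 = S.trans (π.*-homo r _) (S.trans (S.*-congˡ πx≈0) (S.zeroʳ _))

    Pow-* : ∀ {n} r {x} → Pow n x → Pow n (r * x)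
    Pow-* r (any x)      = any _
    Pow-* r (resp e i)   = resp (*-congˡ e) (Pow-* r i)
    Pow-* r zero         = resp (sym (zeroʳ r)) zero
    Pow-* r (add i j)    = resp (sym (distribˡ r _ _)) (add (Pow-* r i) (Pow-* r j))
    Pow-* r (mul πx≈0 i) = resp (*-assoc r _ _) (mul (π-*ˡ r πx≈0) i)

    Pow-neg : ∀ {n x} → Pow n x → Pow n (- x)
    Pow-neg i = resp (solve 1 (λ x → :- con (+ 1) :* x := :- x) refl _) (Pow-* (- 1#) i)

    Pow-pred : ∀ {n x} → Pow (suc n) x → Pow n x
    Pow-pred (resp e i) = resp e (Pow-pred i)
    Pow-pred zero       = zero
    Pow-pred (add i j)  = add (Pow-pred i) (Pow-pred j)
    Pow-pred (mul _ i)  = Pow-* _ i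

    Pow-≤ : ∀ {m n x} → m ≤ n → Pow n x → Pow m x
    Pow-≤ {m} {n} m≤n i with ℕ.m≤n⇒m<n∨m≡n m≤n
    ... | inj₂ ≡.refl = i
    Pow-≤ {m} {suc n} m≤n i | inj₁ (s≤s m≤n') = Pow-≤ m≤n' (Pow-pred i)

    Pow⇒π≈0 : ∀ {n x} → Pow (suc n) x → π x S.≈ S.0#
    Pow⇒π≈0 (resp e i)   = S.trans (π.cong (sym e)) (Pow⇒π≈0 i)
    Pow⇒π≈0 zero         = π.0#-homo
    Pow⇒π≈0 (add i j)    = S.trans (π.+-homo _ _) (S.trans (S.+-cong (Pow⇒π≈0 i) (Pow⇒π≈0 j)) (S.+-identityˡ _))
    Pow⇒π≈0 (mul {x = x} {y} πx≈0 i) = S.trans (π.cong (*-comm x y)) (π-*ˡ y πx≈0)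

    Pow-^ : ∀ {x} n → π x S.≈ S.0# → Pow n (x ^ n)
    Pow-^ zero    πx≈0 = any _
    Pow-^ (suc n) πx≈0 = mul πx≈0 (Pow-^ n πx≈0)

    -- With a lift φ of Frobenius, δ x = (φ x - x^p) / p sends the (n+1)-st power
    -- of the kernel to the n-th, and δ (p x) ≡ φ x.  So divisibility of p^v x by
    -- the (v+1)-st power descends to π (φ x) = (π x)^p = 0.
    module _ {p} (pr : Prime p) {φ : Carrier → Carrier} (φ-hom : IsHom R R φ)
             (πφ : ∀ x → π (φ x) S.≈ π x S.^ p)
             (δ : ∀ x → ∃[ y ] φ x ≈ x ^ p + ⌜ p ⌝ * y)
             (cancel-p : ∀ {x y} → ⌜ p ⌝ * x ≈ ⌜ p ⌝ * y → x ≈ y)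
             (⌜p⌝≈0 : S.⌜ p ⌝ S.≈ S.0#)
             (reduced : ∀ {x} → x S.^ p S.≈ S.0# → x S.≈ S.0#)
             where
      private module φ = HomKit R R φ-hom

      δ-Pow : ∀ {n x} → Pow (suc n) x → ∃[ y ] (Pow n y × φ x ≈ x ^ p + ⌜ p ⌝ * y)
      δ-Pow (resp {x = x} {x'} e i) with y , y∈ , eq ← δ-Pow i =
        y , y∈ , trans (φ.cong (sym e)) (trans eq (+-congʳ (^-congˡ p e)))
      δ-Pow zero = 0# , zero , trans φ.0#-homo (sym (trans (+-cong (0^n (ℕ.<⇒≤ (prime⇒1<p pr))) (zeroʳ _)) (+-identityˡ 0#)))
      δ-Pow (add {x = x₁} {x₂} i j) with y₁ , y₁∈ , eq₁ ← δ-Pow i | y₂ , y₂∈ , eq₂ ← δ-Pow j | z , eq ← freshman pr x₁ x₂ =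
        -- The p-th power of the sum exceeds the sum of p-th powers by p x₁ z, which has to be given
        -- back. Its factor x₁ keeps the correction in the required power of the kernel.
        (y₁ + y₂) + - (z * x₁) , add (add y₁∈ y₂∈) (Pow-neg (Pow-* z (Pow-pred i))) , (begin
        φ (x₁ + x₂)                                                        ≈⟨ φ.+-homo x₁ x₂ ⟩
        φ x₁ + φ x₂                                                        ≈⟨ +-cong eq₁ eq₂ ⟩
        (x₁ ^ p + ⌜ p ⌝ * y₁) + (x₂ ^ p + ⌜ p ⌝ * y₂)                      ≈⟨ solve 7 (λ u v p y₁ y₂ x z → (u :+ p :* y₁) :+ (v :+ p :* y₂) := (u :+ v :+ p :* (x :* z)) :+ p :* ((y₁ :+ y₂) :+ :- (z :* x))) refl (x₁ ^ p) (x₂ ^ p) ⌜ p ⌝ y₁ y₂ x₁ z ⟩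
        (x₁ ^ p + x₂ ^ p + ⌜ p ⌝ * (x₁ * z)) + ⌜ p ⌝ * ((y₁ + y₂) + - (z * x₁)) ≈⟨ +-congʳ (sym eq) ⟩
        (x₁ + x₂) ^ p + ⌜ p ⌝ * ((y₁ + y₂) + - (z * x₁))                   ∎)
        where open ≈-Reasoning
      δ-Pow {zero}  (mul πi≈0 j) = proj₁ (δ _) , any _ , proj₂ (δ _)
      -- Product rule: δ(i x) = φ(i) δ(x) + δ(i) x^p. Here φ(i) stays in the kernel, as π(φ i) = (π
      -- i)^p, and x^p lies in the same power as x.
      δ-Pow {suc n} (mul {x = i} {x} πi≈0 j) with y , y∈ , eq ← δ-Pow j | z , eq' ← δ i =
        φ i * y + z * x ^ p , add (mul (S.trans (πφ i) (S.trans (S.^-congˡ p πi≈0) (S.0^n (ℕ.<⇒≤ (prime⇒1<p pr))))) y∈) (Pow-* z x^p∈) , (begin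
        φ (i * x)                                            ≈⟨ φ.*-homo i x ⟩
        φ i * φ x                                            ≈⟨ *-congˡ eq ⟩
        φ i * (x ^ p + ⌜ p ⌝ * y)                            ≈⟨ solve 4 (λ i x p y → i :* (x :+ p :* y) := i :* x :+ p :* (i :* y)) refl (φ i) (x ^ p) ⌜ p ⌝ y ⟩
        φ i * x ^ p + ⌜ p ⌝ * (φ i * y)                      ≈⟨ +-congʳ (*-congʳ eq') ⟩
        (i ^ p + ⌜ p ⌝ * z) * x ^ p + ⌜ p ⌝ * (φ i * y)      ≈⟨ solve 5 (λ i p z x w → (i :+ p :* z) :* x :+ p :* w := i :* x :+ p :* (w :+ z :* x)) refl (i ^ p) ⌜ p ⌝ z (x ^ p) (φ i * y) ⟩
        i ^ p * x ^ p + ⌜ p ⌝ * (φ i * y + z * x ^ p)        ≈⟨ +-congʳ (sym (^-distrib-* i x p)) ⟩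
        (i * x) ^ p + ⌜ p ⌝ * (φ i * y + z * x ^ p)          ∎)
        where
        open ≈-Reasoning
        x^p∈ : Pow (suc n) (x ^ p)
        x^p∈ = ≡.subst (λ k → Pow (suc n) (x ^ k)) (m∸1+1≡m (ℕ.<⇒≤ (prime⇒1<p pr))) (resp (*-comm _ _) (Pow-* (x ^ (p ∸ 1)) j))

      p^v*x∈Pow⇒π≈0 : ∀ v {x} → Pow (suc v) (⌜ p ⌝ ^ v * x) → π x S.≈ S.0#
      p^v*x∈Pow⇒π≈0 zero {x} i = S.trans (π.cong (sym (*-identityˡ x))) (Pow⇒π≈0 i)
      p^v*x∈Pow⇒π≈0 (suc v) {x} i with y , y∈ , eq ← δ-Pow i =
        reduced (S.trans (S.sym (πφ x)) (p^v*x∈Pow⇒π≈0 v (resp (sym divided) (add rest∈ y∈))))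
        where
        open ≈-Reasoning
        X = ⌜ p ⌝ ^ suc v * x
        -- This is X^p / p. One factor X = p^(v+1) x is divided by p, and since p ≥ 2 another factor
        -- X remains, which puts the product in the power v + 1 of the kernel.
        rest = ⌜ p ⌝ ^ v * x * X ^ (p ∸ 1)
        divided : ⌜ p ⌝ ^ v * φ x ≈ rest + y
        divided = cancel-p (begin
          ⌜ p ⌝ * (⌜ p ⌝ ^ v * φ x)          ≈⟨ sym (*-assoc _ _ _) ⟩
          ⌜ p ⌝ ^ suc v * φ x                ≈⟨ sym (trans (φ.*-homo _ x) (*-congʳ (trans (φ.^-homo ⌜ p ⌝ (suc v)) (^-congˡ (suc v) (φ.⌜⌝-homo p))))) ⟩
          φ X                                ≈⟨ eq ⟩
          X ^ p + ⌜ p ⌝ * y                  ≈⟨ +-congʳ (^-congʳ X (≡.sym (m∸1+1≡m (ℕ.<⇒≤ (prime⇒1<p pr))))) ⟩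
          X * X ^ (p ∸ 1) + ⌜ p ⌝ * y        ≈⟨ solve 5 (λ p w x u y → p :* w :* x :* u :+ p :* y := p :* (w :* x :* u :+ y)) refl ⌜ p ⌝ (⌜ p ⌝ ^ v) x (X ^ (p ∸ 1)) y ⟩
          ⌜ p ⌝ * (rest + y)                 ∎)
        rest∈ : Pow (suc v) rest
        rest∈ = Pow-* _ (≡.subst (λ k → Pow (suc v) (X ^ k)) (m∸1+1≡m (ℕ.m<n⇒0<n∸m (prime⇒1<p pr)))
          (resp (*-comm _ _) (Pow-* _ (resp (*-comm _ _) (Pow-* x (Pow-^ (suc v) (S.trans (π.⌜⌝-homo p) ⌜p⌝≈0)))))))

-- A substitute for the Witt vectors of K: torsion freeness is only required
-- modulo the powers of the kernel of π.
record TeichmüllerLift {a ℓ₁ ℓ₂} (K : HeytingField a ℓ₁ ℓ₂) (p : ℕ) : Set (Level.suc (a ⊔ ℓ₁)) where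
  private module K = RingKit (Defs.ring K)
  field
    R : CommutativeRing a (a ⊔ ℓ₁)
  private module R = RingKit R
  field
    π      : R.Carrier → K.Carrier
    π-hom  : IsHom R (Defs.ring K) π
    τ      : K.Carrier → R.Carrier
    τ-cong : ∀ {x y} → x K.≈ y → τ x R.≈ τ y
    τ-1    : τ K.1# R.≈ R.1#
    τ-*    : ∀ x y → τ (x K.* y) R.≈ τ x R.* τ y
    π-τ    : ∀ x → π (τ x) K.≈ x
  open IdealPowers R (Defs.ring K) π-hom using (Pow)
  field
    p^v*x∈Pow⇒π≈0 : ∀ v {x} → Pow (suc v) (R.⌜ p ⌝ R.^ v R.* x) → π x K.≈ K.0#

-- The lift of K to the monoid ring ℤ[K]

module WittLift {a ℓ₁ ℓ₂} (K : HeytingField a ℓ₁ ℓ₂) {p} (pr : Prime p) M (0<M : 0 < M) (order : HasOrder K (p ℕ.^ M)) where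

  module K = Characteristic K pr M 0<M order
  private module Z = RingKit ℤ.+-*-commutativeRing

  -- The monoid ring ℤ[K, ·], in which x ↦ [ x ] plays the role of the
  -- Teichmüller lift.
  open MonoidRing ℤ.+-*-commutativeRing K.*-commutativeMonoid
    (λ h → ∀ x y → x K.≈ y → h x ≡ h y)
    (λ h-cong {x} {y} → h-cong x y)
    (λ _ _ _ → ≡.refl)
    (λ g-cong h-cong x y e → ≡.cong₂ ℤ._+_ (g-cong x y e) (h-cong x y e))
    (λ c h-cong x y e → ≡.cong (c ℤ.*_) (h-cong x y e))
    (λ z h-cong x y e → h-cong (x K.* z) (y K.* z) (K.*-congʳ e))
    public

  R : CommutativeRing a (a ⊔ ℓ₁)
  R = formalSums
  private module R = RingKit R

  π : R.Carrier → K.Carrier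
  π []            = K.0#
  π ((c , x) ∷ f) = K.int c K.* x K.+ π f

  private
    e′ : (i j : Fin (p ℕ.^ M)) → ℤ
    e′ i j with j Fin.≟ i
    ... | yes _ = ℤ.1ℤ
    ... | no  _ = ℤ.0ℤ

    e : Fin (p ℕ.^ M) → K.Carrier → ℤ
    e i x = e′ i (K.to x)

    e-cong : ∀ i x y → x K.≈ y → e i x ≡ e i y
    e-cong i x y x≈y = ≡.cong (e′ i) (K.to-cong x≈y)

    e-to : ∀ x → e (K.to x) x ≡ ℤ.1ℤ
    e-to x with K.to x Fin.≟ K.to x
    ... | yes _ = ≡.refl
    ... | no  ≢ = contradiction ≡.refl ≢

    e-≢ : ∀ x i → i ≢ K.to x → e i x ≡ ℤ.0ℤ
    e-≢ x i i≢ with K.to x Fin.≟ i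
    ... | yes ≡.refl = contradiction ≡.refl i≢
    ... | no  _      = ≡.refl

    -- `π` is defined on lists of terms. Written through the pairings with the indicator functions
    -- `e i`, it visibly depends only on the class of `f`.
    π-coefficients : ∀ f → π f K.≈ K.sum (λ i → K.int ⟨ f , e i ⟩ K.* K.from i)
    π-coefficients []            = K.sym (K.sum-0 {p ℕ.^ M} λ i → K.zeroˡ _)
    π-coefficients ((c , x) ∷ f) = begin
      K.int c K.* x K.+ π f                         ≈⟨ K.+-cong (K.sym single) (π-coefficients f) ⟩
      K.sum g K.+ K.sum (λ i → K.int ⟨ f , e i ⟩ K.* K.from i)
                                                    ≈⟨ K.sym (K.∑-distrib-+ {p ℕ.^ M} g (λ i → K.int ⟨ f , e i ⟩ K.* K.from i)) ⟩
      K.sum (λ i → g i K.+ K.int ⟨ f , e i ⟩ K.* K.from i)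
                                                    ≈⟨ K.sum-cong-≋ {p ℕ.^ M} (λ i → K.trans (K.sym (K.distribʳ (K.from i) _ _)) (K.*-congʳ (K.sym (K.int-+ (c ℤ.* e i x) ⟨ f , e i ⟩)))) ⟩
      K.sum (λ i → K.int ⟨ (c , x) ∷ f , e i ⟩ K.* K.from i) ∎
      where
      open K.≈-Reasoning
      g : Fin (p ℕ.^ M) → K.Carrier
      g i = K.int (c ℤ.* e i x) K.* K.from i
      single : K.sum g K.≈ K.int c K.* x
      single = K.trans (K.sum-single g (K.to x) λ i i≢ →
          K.trans (K.*-congʳ (K.reflexive (≡.cong K.int (≡.trans (≡.cong (c ℤ.*_) (e-≢ x i i≢)) (ℤ.*-zeroʳ c))))) (K.zeroˡ _))
        (K.*-cong (K.reflexive (≡.cong K.int (≡.trans (≡.cong (c ℤ.*_) (e-to x)) (ℤ.*-identityʳ c)))) (K.from∘to x))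

  π-hom : IsHom R (Defs.ring K) π
  π-hom = mkHom R (Defs.ring K)
    (λ {f} {g} f≋g → K.trans (π-coefficients f) (K.trans
      (K.sum-cong-≋ {p ℕ.^ M} λ i → K.*-congʳ (K.reflexive (≡.cong K.int (test f≋g (e-cong i))))) (K.sym (π-coefficients g))))
    π-+ π-*
    (K.trans (K.+-identityʳ _) (K.trans (K.*-congʳ K.⌜1⌝) (K.*-identityˡ _)))
    where
    open K.≈-Reasoning
    π-+ : ∀ f g → π (f ++ g) K.≈ π f K.+ π g
    π-+ []            g = K.sym (K.+-identityˡ _)
    π-+ ((c , x) ∷ f) g = K.trans (K.+-congˡ (π-+ f g)) (K.sym (K.+-assoc _ _ _))
    π-scale : ∀ c x g → π (scale c x g) K.≈ (K.int c K.* x) K.* π g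
    π-scale c x []            = K.sym (K.zeroʳ _)
    π-scale c x ((d , y) ∷ g) = K.trans (K.+-cong (K.*-congʳ (K.int-* c d)) (π-scale c x g))
      (K.solve 5 (λ c x d y g → (c K.:* d) K.:* (x K.:* y) K.:+ (c K.:* x) K.:* g K.:= (c K.:* x) K.:* (d K.:* y K.:+ g)) K.refl (K.int c) x (K.int d) y (π g))
    π-* : ∀ f g → π (f ⊛ g) K.≈ π f K.* π g
    π-* []            g = K.sym (K.zeroˡ _)
    π-* ((c , x) ∷ f) g = K.trans (π-+ (scale c x g) (f ⊛ g))
      (K.trans (K.+-cong (π-scale c x g) (π-* f g)) (K.sym (K.distribʳ _ _ _)))

  π-[] : ∀ x → π [ x ] K.≈ x
  π-[] x = K.trans (K.+-identityʳ _) (K.trans (K.*-congʳ K.⌜1⌝) (K.*-identityˡ _))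

  φ : R.Carrier → R.Carrier
  φ []            = []
  φ ((c , x) ∷ f) = (c , x K.^ p) ∷ φ f

  private
    ⟨φ⟩ : ∀ f h → ⟨ φ f , h ⟩ ≡ ⟨ f , (λ x → h (x K.^ p)) ⟩
    ⟨φ⟩ []            h = ≡.refl
    ⟨φ⟩ ((c , x) ∷ f) h = ≡.cong (λ i → c ℤ.* h (x K.^ p) ℤ.+ i) (⟨φ⟩ f h)

    ≋-φ : ∀ {f g} → (∀ {h} → (∀ x y → x K.≈ y → h x ≡ h y) → ⟨ f , (λ x → h (x K.^ p)) ⟩ ≡ ⟨ g , h ⟩) → φ f ≋ g
    ≋-φ {f} f≡ = tested λ {h} h-cong → ≡.trans (⟨φ⟩ f h) (f≡ h-cong)

  φ-hom : IsHom R R φ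
  φ-hom = mkHom R R
    (λ {f} {g} f≋g → ≋-φ λ {h} h-cong → ≡.trans (test f≋g (λ x y x≈y → h-cong _ _ (K.^-congˡ p x≈y))) (≡.sym (⟨φ⟩ g h)))
    (λ f g → ≋-φ λ {h} h-cong → ≡.trans (++-⟨⟩ f g _) (≡.sym (≡.trans (++-⟨⟩ (φ f) (φ g) h) (≡.cong₂ ℤ._+_ (⟨φ⟩ f h) (⟨φ⟩ g h)))))
    (λ f g → ≋-φ λ {h} h-cong → ≡.trans (⊛-⟨⟩ f g _) (≡.trans
      (⟨⟩-cong f λ x → ≡.trans (⟨⟩-cong g λ y → h-cong _ _ (K.^-distrib-* x y p)) (≡.sym (⟨φ⟩ g _)))
      (≡.sym (≡.trans (⊛-⟨⟩ (φ f) (φ g) h) (⟨φ⟩ f _)))))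
    (≋-φ λ {h} h-cong → ≡.cong (λ i → ℤ.1ℤ ℤ.* i ℤ.+ ℤ.0ℤ) (h-cong _ _ (K.1^n p)))

  private
    neg-^p : ∀ x → (K.- x) K.^ p K.≈ K.- (x K.^ p)
    neg-^p x = K.x-y≈0⇒x≈y (K.trans (K.+-congˡ (K.-‿involutive _)) (K.trans (K.sym (K.frobenius-+ _ _))
      (K.trans (K.^-congˡ p (K.-‿inverseˡ x)) (K.0^n (ℕ.<⇒≤ K.1<p)))))

    int-fixed : ∀ c → K.int c K.^ p K.≈ K.int c
    int-fixed (+ n)    = K.⌜⌝-fixed n
    int-fixed -[1+ n ] = K.trans (neg-^p _) (K.-‿cong (K.⌜⌝-fixed (suc n)))

  πφ : ∀ f → π (φ f) K.≈ π f K.^ p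
  πφ []            = K.sym (K.0^n (ℕ.<⇒≤ K.1<p))
  πφ ((c , x) ∷ f) = K.sym (K.trans (K.frobenius-+ _ _) (K.+-cong
    (K.trans (K.^-distrib-* _ x p) (K.*-congʳ (int-fixed c))) (K.sym (πφ f))))

  private
    fermat-+ : ∀ n → ∃[ d ] Z.⌜ n ⌝ Z.^ p ≡ Z.⌜ n ⌝ ℤ.+ Z.⌜ p ⌝ ℤ.* d
    fermat-+ zero    = ℤ.0ℤ , ≡.trans (Z.0^n (ℕ.<⇒≤ K.1<p)) (≡.sym (≡.trans (ℤ.+-identityˡ _) (ℤ.*-zeroʳ Z.⌜ p ⌝)))
    fermat-+ (suc n) with d , e ← fermat-+ n | z , e' ← Z.freshman pr ℤ.1ℤ Z.⌜ n ⌝ =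
      d ℤ.+ (ℤ.1ℤ ℤ.* z) , ≡.trans e' (≡.trans (≡.cong₂ (λ u v → u ℤ.+ v ℤ.+ Z.⌜ p ⌝ ℤ.* (ℤ.1ℤ ℤ.* z)) (Z.1^n p) e)
        (Z.solve 4 (λ n p d z → con1 Z.:+ (n Z.:+ p Z.:* d) Z.:+ p Z.:* z Z.:= (con1 Z.:+ n) Z.:+ p Z.:* (d Z.:+ z)) ≡.refl Z.⌜ n ⌝ Z.⌜ p ⌝ d (ℤ.1ℤ ℤ.* z)))
      where con1 = Z.con (+ 1)

    -- Applying the binomial identity to c + (-c) = 0 avoids a distinction by the parity of p.
    fermat-neg : ∀ c → (∃[ d ] c Z.^ p ≡ c ℤ.+ Z.⌜ p ⌝ ℤ.* d) → ∃[ d ] (ℤ.- c) Z.^ p ≡ ℤ.- c ℤ.+ Z.⌜ p ⌝ ℤ.* d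
    fermat-neg c (d , e) with z , e' ← Z.freshman pr c (ℤ.- c) = ℤ.- (d ℤ.+ c ℤ.* z) , (begin
      (ℤ.- c) Z.^ p                                                           ≡⟨ Z.solve 3 (λ u v w → v Z.:= (u Z.:+ v Z.:+ w) Z.:- (u Z.:+ w)) ≡.refl (c Z.^ p) ((ℤ.- c) Z.^ p) w ⟩
      (c Z.^ p ℤ.+ (ℤ.- c) Z.^ p ℤ.+ w) ℤ.- (c Z.^ p ℤ.+ w)                   ≡⟨ ≡.cong₂ (λ u v → u ℤ.- (v ℤ.+ w)) (≡.trans (≡.sym e') (≡.trans (Z.^-congˡ p (ℤ.+-inverseʳ c)) (Z.0^n (ℕ.<⇒≤ K.1<p)))) e ⟩
      ℤ.0ℤ ℤ.- ((c ℤ.+ Z.⌜ p ⌝ ℤ.* d) ℤ.+ w)                                  ≡⟨ Z.solve 4 (λ c p d z → Z.con (+ 0) Z.:- ((c Z.:+ p Z.:* d) Z.:+ p Z.:* (c Z.:* z)) Z.:= Z.:- c Z.:+ p Z.:* (Z.:- (d Z.:+ c Z.:* z))) ≡.refl c Z.⌜ p ⌝ d z ⟩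
      ℤ.- c ℤ.+ Z.⌜ p ⌝ ℤ.* (ℤ.- (d ℤ.+ c ℤ.* z))                             ∎)
      where
      open ≡.≡-Reasoning
      w = Z.⌜ p ⌝ ℤ.* (c ℤ.* z)

    ⌜⌝≡+ : ∀ n → Z.⌜ n ⌝ ≡ + n
    ⌜⌝≡+ zero    = ≡.refl
    ⌜⌝≡+ (suc n) = ≡.cong (ℤ._+_ ℤ.1ℤ) (⌜⌝≡+ n)

    -- Needed because `φ` leaves the integer coefficients alone, while a p-th power raises them to
    -- the p-th power.
    fermat : ∀ c → ∃[ d ] c Z.^ p ≡ c ℤ.+ Z.⌜ p ⌝ ℤ.* d
    fermat (+ n)    = ≡.subst (λ c → ∃[ d ] c Z.^ p ≡ c ℤ.+ Z.⌜ p ⌝ ℤ.* d) (⌜⌝≡+ n) (fermat-+ n)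
    fermat -[1+ n ] = fermat-neg (+ suc n) (fermat (+ suc n))

    singleton-^ : ∀ c x n → ((c , x) ∷ []) R.^ n ≋ (c Z.^ n , x K.^ n) ∷ []
    singleton-^ c x zero    = ≋-refl
    singleton-^ c x (suc n) = R.*-congˡ {(c , x) ∷ []} (singleton-^ c x n)

  -- By adding one term at a time: Fermat's congruence handles the single term c[x], and the
  -- remainder in `freshman` accounts for joining it to the rest.
  δ : ∀ f → ∃[ y ] φ f ≋ f R.^ p R.+ R.⌜ p ⌝ R.* y
  δ [] = R.0# , R.sym (R.trans (R.+-cong (R.0^n (ℕ.<⇒≤ K.1<p)) (R.zeroʳ R.⌜ p ⌝)) (R.+-identityˡ R.0#))
  δ ((c , x) ∷ f) with y , e ← δ f | z , e' ← R.freshman pr ((c , x) ∷ []) f | d , e'' ← fermat c =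
    (w R.+ y) R.- (s R.* z) , (begin
    s' R.+ φ f                                                             ≈⟨ R.+-cong s'≋ e ⟩
    (s R.^ p R.+ R.⌜ p ⌝ R.* w) R.+ (f R.^ p R.+ R.⌜ p ⌝ R.* y)            ≈⟨ R.solve 7 (λ u v p w y s z → (u R.:+ p R.:* w) R.:+ (v R.:+ p R.:* y) R.:= (u R.:+ v R.:+ p R.:* (s R.:* z)) R.:+ p R.:* ((w R.:+ y) R.:- (s R.:* z))) R.refl (s R.^ p) (f R.^ p) R.⌜ p ⌝ w y s z ⟩
    (s R.^ p R.+ f R.^ p R.+ R.⌜ p ⌝ R.* (s R.* z)) R.+ R.⌜ p ⌝ R.* ((w R.+ y) R.- (s R.* z))   ≈⟨ R.+-congʳ (R.sym e') ⟩
    (s R.+ f) R.^ p R.+ R.⌜ p ⌝ R.* ((w R.+ y) R.- (s R.* z))              ∎)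
    where
    open R.≈-Reasoning
    s = (c , x) ∷ []
    s' = (c , x K.^ p) ∷ []
    -- From c^p = c + p d, the coefficient c of φ(c[x]) is c^p - p d.
    w = (ℤ.- d , x K.^ p) ∷ []
    s'≋ : s' R.≈ s R.^ p R.+ R.⌜ p ⌝ R.* w
    s'≋ = tested λ {h} h-cong → ≡.trans
      (≡.trans (Z.solve 4 (λ c p d u → c Z.:* u Z.:+ Z.con (+ 0) Z.:= (c Z.:+ p Z.:* d) Z.:* u Z.:+ Z.con (+ 0) Z.:+ p Z.:* (Z.:- d Z.:* u Z.:+ Z.con (+ 0))) ≡.refl c Z.⌜ p ⌝ d (h (x K.^ p)))
        (≡.cong₂ ℤ._+_ (≡.trans (≡.cong (λ i → i ℤ.* h (x K.^ p) ℤ.+ ℤ.0ℤ) (≡.sym e'')) (≡.sym (test (singleton-^ c x p) h-cong)))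
                       (≡.sym (⟨⟩-⌜⌝* p w h-cong))))
      (≡.sym (++-⟨⟩ (s R.^ p) (R.⌜ p ⌝ R.* w) h))

  cancel-p : ∀ {f g} → R.⌜ p ⌝ R.* f R.≈ R.⌜ p ⌝ R.* g → f R.≈ g
  cancel-p = torsion-free p λ {i} {j} e → ℤ.*-cancelˡ-≡ (+ p) i j
    (≡.subst (λ c → c ℤ.* i ≡ c ℤ.* j) (⌜⌝≡+ p) e)
    where instance _ = prime⇒nonZero pr

  teichmüllerLift : TeichmüllerLift K p
  teichmüllerLift = record
    { R = R ; π = π ; π-hom = π-hom ; τ = [_]
    ; τ-cong = []-cong ; τ-1 = ≋-refl ; τ-* = []-* ; π-τ = π-[]
    ; p^v*x∈Pow⇒π≈0 = IdealPowers.p^v*x∈Pow⇒π≈0 R (Defs.ring K) π-hom pr φ-hom πφ δ cancel-p K.⌜p⌝≈0 (K.^≈0 p)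
    }

-- Quotients by an ideal

module _ {a ℓ} (R : CommutativeRing a ℓ) where

  private
    module R = CommutativeRing R
    module Q = RingKit R

  module QuotientRing
    {i} (I : R.Carrier → Set i)
    (I-resp : ∀ {x y} → x R.≈ y → I x → I y) (I-0 : I R.0#)
    (I-+ : ∀ {x y} → I x → I y → I (x R.+ y)) (I-* : ∀ r {x} → I x → I (r R.* x))
    where

    open Q using (solve; con; _:=_; _:+_; _:-_; _:*_; :-_)

    infix 4 _≡I_
    record _≡I_ (x y : R.Carrier) : Set i where
      constructor mod
      field difference : I (x R.- y)
    open _≡I_ public

    ≈⇒≡I : ∀ {x y} → x R.≈ y → x ≡I y
    ≈⇒≡I x≈y = mod (I-resp (R.sym (Q.x≈y⇒x-y≈0 x≈y)) I-0)

    ≡I-sym : ∀ {x y} → x ≡I y → y ≡I x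
    ≡I-sym {x} {y} (mod i) = mod (I-resp (solve 2 (λ x y → (:- con (+ 1)) :* (x :- y) := y :- x) R.refl x y) (I-* (R.- R.1#) i))

    ≡I-trans : ∀ {x y z} → x ≡I y → y ≡I z → x ≡I z
    ≡I-trans {x} {y} {z} (mod i) (mod j) = mod (I-resp (solve 3 (λ x y z → (x :- y) :+ (y :- z) := x :- z) R.refl x y z) (I-+ i j))

    +-≡I : ∀ {x x' y y'} → x ≡I x' → y ≡I y' → x R.+ y ≡I x' R.+ y'
    +-≡I {x} {x'} {y} {y'} (mod i) (mod j) =
      mod (I-resp (solve 4 (λ x x' y y' → (x :- x') :+ (y :- y') := (x :+ y) :- (x' :+ y')) R.refl x x' y y') (I-+ i j))

    *-≡I : ∀ {x x' y y'} → x ≡I x' → y ≡I y' → x R.* y ≡I x' R.* y'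
    *-≡I {x} {x'} {y} {y'} (mod i) (mod j) =
      mod (I-resp (solve 4 (λ x x' y y' → y :* (x :- x') :+ x' :* (y :- y') := x :* y :- x' :* y') R.refl x x' y y') (I-+ (I-* y i) (I-* x' j)))

    neg-≡I : ∀ {x y} → x ≡I y → R.- x ≡I R.- y
    neg-≡I {x} {y} (mod i) = mod (I-resp (solve 2 (λ x y → (:- con (+ 1)) :* (x :- y) := (:- x) :- (:- y)) R.refl x y) (I-* (R.- R.1#) i))

    quotient : CommutativeRing a i
    quotient = record
      { Carrier = R.Carrier ; _≈_ = _≡I_ ; _+_ = R._+_ ; _*_ = R._*_ ; -_ = R.-_ ; 0# = R.0# ; 1# = R.1#
      ; isCommutativeRing = record
        { isRing = record
          { +-isAbelianGroup = record
            { isGroup = record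
              { isMonoid = record
                { isSemigroup = record
                  { isMagma = record
                    { isEquivalence = record { refl = ≈⇒≡I R.refl ; sym = ≡I-sym ; trans = ≡I-trans }
                    ; ∙-cong = +-≡I
                    }
                  ; assoc = λ x y z → ≈⇒≡I (R.+-assoc x y z)
                  }
                ; identity = (λ x → ≈⇒≡I (R.+-identityˡ x)) , (λ x → ≈⇒≡I (R.+-identityʳ x))
                }
              ; inverse = (λ x → ≈⇒≡I (R.-‿inverseˡ x)) , (λ x → ≈⇒≡I (R.-‿inverseʳ x))
              ; ⁻¹-cong = neg-≡I
              }
            ; comm = λ x y → ≈⇒≡I (R.+-comm x y)
            }
          ; *-cong = *-≡I
          ; *-assoc = λ x y z → ≈⇒≡I (R.*-assoc x y z)
          ; *-identity = (λ x → ≈⇒≡I (R.*-identityˡ x)) , (λ x → ≈⇒≡I (R.*-identityʳ x))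
          ; distrib = (λ x y z → ≈⇒≡I (R.distribˡ x y z)) , (λ x y z → ≈⇒≡I (R.distribʳ x y z))
          }
        ; *-comm = λ x y → ≈⇒≡I (R.*-comm x y)
        }
      }

-- A substitute for W(K)[ζ] / p^(n+1).
record CyclotomicLift {a ℓ₁ ℓ₂} (K : HeytingField a ℓ₁ ℓ₂) (p n : ℕ) : Set (Level.suc (a ⊔ ℓ₁)) where
  private module K = RingKit (Defs.ring K)
  field
    T : CommutativeRing a (a ⊔ ℓ₁)
  private module T = RingKit T
  field
    π      : T.Carrier → K.Carrier
    π-hom  : IsHom T (Defs.ring K) π
    τ      : K.Carrier → T.Carrier
    τ-cong : ∀ {x y} → x K.≈ y → τ x T.≈ τ y
    τ-0    : τ K.0# T.≈ T.0#
    τ-1    : τ K.1# T.≈ T.1#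
    τ-*    : ∀ x y → τ (x K.* y) T.≈ τ x T.* τ y
    π-τ    : ∀ x → π (τ x) K.≈ x
    ζ      : T.Carrier
    ζ-sum  : T.sum {p} (λ i → ζ T.^ toℕ i) T.≈ T.0#
    π-ζ    : π ζ K.≈ K.1#
    p^v*x≈0⇒π≈0      : ∀ v {x} → v ≤ n → T.⌜ p ⌝ T.^ v T.* x T.≈ T.0# → π x K.≈ K.0#
    1-τ-invertible   : ∀ {x} → ¬ x K.≈ K.1# → ∃[ u ] (T.1# T.- τ x) T.* u T.≈ T.1#
    τ-sum-invertible : ∀ {m} (f : Vector K.Carrier m) → ¬ K.sum f K.≈ K.0# → ∃[ u ] T.sum (λ i → τ (f i)) T.* u T.≈ T.1#

-- Adjoining a p-th root of unity, modulo a power of the kernel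

module Ramify {a ℓ₁ ℓ₂} (K : HeytingField a ℓ₁ ℓ₂) {p} (pr : Prime p) M (0<M : 0 < M) (order : HasOrder K (p ℕ.^ M))
              (L : TeichmüllerLift K p) (n : ℕ) where

  private
    module W = TeichmüllerLift L
    open W using (R; π; π-hom)
    module K = Characteristic K pr M 0<M order
    module R = RingKit R
    module π = HomKit R (Defs.ring K) π-hom
    module P = IdealPowers R (Defs.ring K) π-hom
    open P using (Pow; Pow-*; Pow-neg; Pow-≤; resp; zero; add)

    -- R[X] / (1 + X + ⋯ + X^(p-1))
    window : (ℕ → R.Carrier) → ℕ → R.Carrier
    window h c = R.sum {p} (λ i → h (c ℕ.+ toℕ i))

    -- `h` encodes the R-linear functional sending X^i to h(i). The condition says that it kills
    -- every multiple X^c (1 + X + ⋯ + X^(p-1)).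
    Test : (ℕ → R.Carrier) → Set _
    Test h = ∀ c → window h c R.≈ R.0#

    Test-0 : Test (λ _ → R.0#)
    Test-0 c = R.sum-0 {p} λ _ → R.refl

    Test-+ : ∀ {g h} → Test g → Test h → Test (λ x → g x R.+ h x)
    Test-+ {g} {h} tg th c = R.trans (R.∑-distrib-+ {p} (λ i → g (c ℕ.+ toℕ i)) (λ i → h (c ℕ.+ toℕ i)))
      (R.trans (R.+-cong (tg c) (th c)) (R.+-identityˡ R.0#))

    Test-* : ∀ r {h} → Test h → Test (λ x → r R.* h x)
    Test-* r {h} t c = R.trans (R.sym (R.*-distribˡ-sum {p} r (λ i → h (c ℕ.+ toℕ i)))) (R.trans (R.*-congˡ (t c)) (R.zeroʳ r))

    Test-shift : ∀ x {h} → Test h → Test (λ y → h (y ℕ.+ x))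
    Test-shift x {h} t c = R.trans (R.sum-cong-≋ {p} λ i → R.reflexive (≡.cong h (≡.trans (ℕ.+-assoc c (toℕ i) x)
      (≡.trans (≡.cong (c ℕ.+_) (ℕ.+-comm (toℕ i) x)) (≡.sym (ℕ.+-assoc c x (toℕ i))))))) (t (c ℕ.+ x))

    Test-shiftˡ : ∀ x {h} → Test h → Test (λ y → h (x ℕ.+ y))
    Test-shiftˡ x {h} t c = R.trans (R.sum-cong-≋ {p} λ i → R.reflexive (≡.cong h (≡.sym (ℕ.+-assoc x c (toℕ i))))) (t (x ℕ.+ c))
    open MonoidRing R ℕ.+-0-commutativeMonoid Test
      (λ {h} _ x≡y → R.reflexive (≡.cong h x≡y)) Test-0 (λ {g} {h} → Test-+ {g} {h}) (λ r {h} → Test-* r {h}) (λ x {h} → Test-shift x {h})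
    -- The ideal to be divided out: every functional takes a value in the power n + 1 of the kernel.
    -- This truncation turns the lift of 0 into 0 and supplies inverses by finite geometric series.
    Small : FormalSum → Set _
    Small f = ∀ h → Test h → Pow (suc n) ⟨ f , h ⟩

    ⟨⟩-Pow : ∀ {m} f {h} → (∀ x → Pow m (h x)) → Pow m ⟨ f , h ⟩
    ⟨⟩-Pow []            hx∈ = zero
    ⟨⟩-Pow ((c , x) ∷ f) hx∈ = add (Pow-* c (hx∈ x)) (⟨⟩-Pow f hx∈)
    Small-resp : ∀ {f g} → f ≋ g → Small f → Small g
    Small-resp f≋g s h t = resp (test f≋g {h} t) (s h t)

    Small-+ : ∀ {f g} → Small f → Small g → Small (f ++ g)
    Small-+ {f} {g} s s' h t = resp (R.sym (++-⟨⟩ f g h)) (add (s h t) (s' h t))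

    Small-* : ∀ r {f} → Small f → Small (r ⊛ f)
    Small-* r {f} s h t = resp (R.sym (⊛-⟨⟩ r f h)) (⟨⟩-Pow r λ x → s (λ y → h (x ℕ.+ y)) (Test-shiftˡ x {h} t))
    open QuotientRing formalSums Small (λ {f} {g} → Small-resp {f} {g}) (λ _ _ → zero) (λ {f} {g} → Small-+ {f} {g}) (λ r {f} → Small-* r {f})

    module S = RingKit formalSums
    module T = RingKit quotient

    -- Iterated operations of the two rings are stuck on different raw
    -- structures, so they agree only up to this homomorphism.
    q-hom : IsHom formalSums quotient id
    q-hom = mkHom formalSums quotient ≈⇒≡I (λ f g → ≈⇒≡I ≋-refl) (λ f g → ≈⇒≡I ≋-refl) (≈⇒≡I ≋-refl)

    module q = HomKit formalSums quotient q-hom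

    j : R.Carrier → T.Carrier
    j r = (r , 0) ∷ []

    ⟨j⟩ : ∀ r h → ⟨ j r , h ⟩ R.≈ r R.* h 0
    ⟨j⟩ r h = R.+-identityʳ _

    j-≋-hom : IsHom R formalSums j
    j-≋-hom = mkHom R formalSums
      (λ {r} {s} r≈s → tested λ {h} t → R.+-congʳ {R.0#} (R.*-congʳ {h 0} {r} {s} r≈s))
      (λ r s → tested λ {h} t → R.trans (R.+-congʳ {R.0#} (R.distribʳ (h 0) r s)) (R.+-assoc (r R.* h 0) (s R.* h 0) R.0#))
      (λ r s → ≋-refl)
      ≋-refl

    module j≋ = HomKit R formalSums j-≋-hom

    j-hom : IsHom R quotient j
    j-hom = mkHom R quotient (λ e → ≈⇒≡I (j≋.cong e)) (λ r s → ≈⇒≡I (j≋.+-homo r s)) (λ r s → ≈⇒≡I (j≋.*-homo r s)) (≈⇒≡I ≋-refl)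

    module j = HomKit R quotient j-hom

    j-Small : ∀ {r} → Pow (suc n) r → Small (j r)
    j-Small {r} r∈ h t = resp (R.trans (R.*-comm (h 0) r) (R.sym (⟨j⟩ r h))) (Pow-* (h 0) r∈)

    -- Minus the trace of ζ^i over the rationals. Each window holds exactly one multiple of p, and
    -- (1 - p) + (p - 1) = 0. Since p has residue 0, all residues are 1, so that `h₀` followed by
    -- `π` is evaluation at X = 1.
    h₀ : ℕ → R.Carrier
    h₀ i with p ∣.∣? i
    ... | yes _ = R.1# R.- R.⌜ p ⌝
    ... | no  _ = R.1#

    h₀-∣ : ∀ i → p ∣ i → h₀ i ≡ R.1# R.- R.⌜ p ⌝
    h₀-∣ i p∣i with p ∣.∣? i
    ... | yes _   = ≡.refl
    ... | no  p∤i = contradiction p∣i p∤i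

    h₀-∤ : ∀ i → ¬ p ∣ i → h₀ i ≡ R.1#
    h₀-∤ i p∤i with p ∣.∣? i
    ... | yes p∣i = contradiction p∣i p∤i
    ... | no  _   = ≡.refl

    h₀-periodic : ∀ i → h₀ (i ℕ.+ p) ≡ h₀ i
    h₀-periodic i with p ∣.∣? i
    ... | yes p∣i = h₀-∣ (i ℕ.+ p) (∣.∣m∣n⇒∣m+n p∣i ∣.∣-refl)
    ... | no  p∤i = h₀-∤ (i ℕ.+ p) λ p∣i+p → p∤i (∣.∣m+n∣m⇒∣n (≡.subst (p ∣_) (ℕ.+-comm i p) p∣i+p) ∣.∣-refl)

    π-h₀ : ∀ i → π (h₀ i) K.≈ K.1#
    π-h₀ i with p ∣.∣? i
    ... | yes _ = K.trans (π.+-homo R.1# (R.- R.⌜ p ⌝)) (K.trans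
      (K.+-cong π.1#-homo (K.trans (π.-‿homo R.⌜ p ⌝) (K.-‿cong (K.trans (π.⌜⌝-homo p) K.⌜p⌝≈0))))
      (K.trans (K.+-congˡ K.-0#≈0#) (K.+-identityʳ K.1#)))
    ... | no  _ = π.1#-homo

    h₀-Test : Test h₀
    h₀-Test zero = ≡.subst (λ k → R.sum {k} (λ i → h₀ (toℕ i)) R.≈ R.0#) (m∸1+1≡m 1≤p)
      (R.trans (R.+-cong (R.reflexive (h₀-∣ 0 (p ∣.∣0)))
        (R.trans (R.sum-cong-≋ {p ∸ 1} λ i → R.reflexive (h₀-∤ (suc (toℕ i)) λ p∣ → ℕ.<⇒≱ (≡.subst (suc (toℕ i) <_) (m∸1+1≡m 1≤p) (s≤s (Fin.toℕ<n i))) (∣⇒≤ p∣)))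
          (R.trans (R.sum-const (p ∸ 1) R.1#) (R.*-identityʳ _))))
      (R.trans (R.+-congʳ {R.⌜ p ∸ 1 ⌝} (R.+-congˡ {R.1#} (R.-‿cong (R.⌜⌝-cong (≡.sym (m∸1+1≡m 1≤p))))))
        (R.solve 1 (λ q → R.con (+ 1) R.:- (R.con (+ 1) R.:+ q) R.:+ q R.:= R.con (+ 0)) R.refl R.⌜ p ∸ 1 ⌝)))
      where
      1≤p : 1 ≤ p
      1≤p = ℕ.<⇒≤ K.1<p
    h₀-Test (suc c) = R.trans (R.sum-cong-≋ {p} λ i → R.reflexive (≡.cong h₀ (≡.sym (ℕ.+-suc c (toℕ i)))))
      (R.trans (R.sum-rotate p (λ i → h₀ (c ℕ.+ i)) (R.reflexive (≡.trans (h₀-periodic c) (≡.cong h₀ (≡.sym (ℕ.+-identityʳ c)))))) (h₀-Test c))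

    aug : FormalSum → K.Carrier
    aug []            = K.0#
    aug ((c , x) ∷ f) = π c K.+ aug f

    π-⟨⟩ : ∀ f {h} κ → (∀ x → π (h x) K.≈ κ) → π ⟨ f , h ⟩ K.≈ aug f K.* κ
    π-⟨⟩ []            κ e = K.trans π.0#-homo (K.sym (K.zeroˡ κ))
    π-⟨⟩ ((c , x) ∷ f) {h} κ e = K.trans (π.+-homo (c R.* h x) ⟨ f , h ⟩)
      (K.trans (K.+-cong (K.trans (π.*-homo c (h x)) (K.*-congˡ (e x))) (π-⟨⟩ f κ e)) (K.sym (K.distribʳ κ (π c) (aug f))))

    -- The map ζ → 1. The augmentation has the same values, but the constant 1 is not a test
    -- function, as its windows sum to p; pairing with `h₀` makes the map well defined on the
    -- quotient.
    πT : T.Carrier → K.Carrier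
    πT f = π ⟨ f , h₀ ⟩

    πT≈aug : ∀ f → πT f K.≈ aug f
    πT≈aug f = K.trans (π-⟨⟩ f K.1# π-h₀) (K.*-identityʳ (aug f))

    πT-cong : ∀ {f g} → f T.≈ g → πT f K.≈ πT g
    πT-cong {f} {g} (mod d) = K.x-y≈0⇒x≈y (K.trans (K.sym (K.trans (π.cong {⟨ f S.- g , h₀ ⟩} (R.trans (++-⟨⟩ f (⊖ g) h₀) (R.+-congˡ {⟨ f , h₀ ⟩} (⊖-⟨⟩ g h₀))))
      (K.trans (π.+-homo ⟨ f , h₀ ⟩ (R.- ⟨ g , h₀ ⟩)) (K.+-congˡ (π.-‿homo ⟨ g , h₀ ⟩))))) (P.Pow⇒π≈0 (d h₀ h₀-Test)))

    πT-hom : IsHom quotient (Defs.ring K) πT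
    πT-hom = mkHom quotient (Defs.ring K) πT-cong
      (λ f g → K.trans (π.cong (++-⟨⟩ f g h₀)) (π.+-homo ⟨ f , h₀ ⟩ ⟨ g , h₀ ⟩))
      (λ f g → K.trans (π.cong (⊛-⟨⟩ f g h₀)) (K.trans
        (π-⟨⟩ f (aug g) (λ x → K.trans (π-⟨⟩ g K.1# (λ y → π-h₀ (x ℕ.+ y))) (K.*-identityʳ (aug g))))
        (K.sym (K.*-cong (πT≈aug f) (πT≈aug g)))))
      (K.trans (πT≈aug S.1#) (K.trans (K.+-identityʳ (π R.1#)) π.1#-homo))

    πT-j : ∀ r → πT (j r) K.≈ π r
    πT-j r = K.trans (πT≈aug (j r)) (K.+-identityʳ (π r))

    τ : K.Carrier → T.Carrier
    τ x = j (W.τ x)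

    ζ : T.Carrier
    ζ = [ 1 ]

    ζ^ : ∀ i → ζ S.^ i ≋ [ i ]
    ζ^ zero    = ≋-refl
    ζ^ (suc i) = S.trans (S.*-congˡ {ζ} (ζ^ i)) (S.sym ([]-* 1 i))

    ζ-sum : S.sum {p} (λ i → ζ S.^ toℕ i) ≋ S.0#
    ζ-sum = S.trans (S.sum-cong-≋ {p} λ i → ζ^ (toℕ i)) (tested λ {h} t → R.trans (go p (λ i → toℕ i) h) (t 0))
      where
      go : ∀ m (f : Fin m → ℕ) h → ⟨ S.sum {m} (λ i → [ f i ]) , h ⟩ R.≈ R.sum {m} (λ i → h (f i))
      go zero    f h = R.refl
      go (suc m) f h = R.+-cong (R.*-identityˡ (h (f Fin.zero))) (go m (f ∘ Fin.suc) h)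

    -- An idempotent in the kernel lies in all of its powers.
    [0]∈Pow : ∀ m → Pow m (W.τ K.0#)
    [0]∈Pow m = resp (idem m) (Pow-* (W.τ K.0#) (P.Pow-^ m (W.π-τ K.0#)))
      where
      idem : ∀ m → (W.τ K.0#) R.* (W.τ K.0#) R.^ m R.≈ (W.τ K.0#)
      idem zero    = R.*-identityʳ (W.τ K.0#)
      idem (suc m) = R.trans (R.*-congˡ {W.τ K.0#} (idem m)) (R.trans (R.sym (W.τ-* K.0# K.0#)) (W.τ-cong (K.zeroˡ K.0#)))

    -- Pairing with `h₀` turns the relation into one in `R`: p^v times the value of `f` lies in the
    -- power n + 1 of the kernel, hence in the power v + 1 because v ≤ n.
    p^v : ∀ v {f} → v ≤ n → T.⌜ p ⌝ T.^ v T.* f T.≈ T.0# → πT f K.≈ K.0#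
    p^v v {f} v≤n p^vf≈0 = W.p^v*x∈Pow⇒π≈0 v (Pow-≤ (s≤s v≤n) (resp eq (difference p^vf≈0′ h₀ h₀-Test)))
      where
      p^vf≈0′ : S.⌜ p ⌝ S.^ v S.* f T.≈ T.0#
      p^vf≈0′ = T.trans {S.⌜ p ⌝ S.^ v S.* f} {T.⌜ p ⌝ T.^ v T.* f} {T.0#}
        (T.*-congʳ {f} {S.⌜ p ⌝ S.^ v} {T.⌜ p ⌝ T.^ v} (T.trans {S.⌜ p ⌝ S.^ v} {S.⌜ p ⌝ T.^ v} {T.⌜ p ⌝ T.^ v}
          (q.^-homo S.⌜ p ⌝ v) (T.^-congˡ v {S.⌜ p ⌝} {T.⌜ p ⌝} (q.⌜⌝-homo p)))) p^vf≈0
      eq : ⟨ (S.⌜ p ⌝ S.^ v S.* f) S.- S.0# , h₀ ⟩ R.≈ R.⌜ p ⌝ R.^ v R.* ⟨ f , h₀ ⟩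
      eq = begin
        ⟨ (S.⌜ p ⌝ S.^ v S.* f) S.- S.0# , h₀ ⟩   ≈⟨ test (S.trans (S.+-congˡ S.-0#≈0#) (S.+-identityʳ (S.⌜ p ⌝ S.^ v S.* f))) h₀-Test ⟩
        ⟨ S.⌜ p ⌝ S.^ v S.* f , h₀ ⟩              ≈⟨ test (S.*-congʳ {f} (S.sym (S.⌜⌝-^ p v))) h₀-Test ⟩
        ⟨ S.⌜ p ℕ.^ v ⌝ S.* f , h₀ ⟩              ≈⟨ ⟨⟩-⌜⌝* (p ℕ.^ v) f h₀-Test ⟩
        R.⌜ p ℕ.^ v ⌝ R.* ⟨ f , h₀ ⟩              ≈⟨ R.*-congʳ {⟨ f , h₀ ⟩} (R.⌜⌝-^ p v) ⟩
        R.⌜ p ⌝ R.^ v R.* ⟨ f , h₀ ⟩              ∎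
        where open R.≈-Reasoning

    -- The lift of the inverse of π(x) is an inverse of x up to an error η in the kernel; the
    -- geometric series `G` improves the error to η^n.
    invertible-mod-Pow : ∀ n {x} → ¬ π x K.≈ K.0# → ∃[ y ] Pow n (x R.* y R.- R.1#)
    invertible-mod-Pow n {x} πx≉0 with y , xy≈1 ← K.inverse πx≉0 = W.τ y R.* G , resp eq (Pow-neg (P.Pow-^ n πη≈0))
      where
      η = R.1# R.- x R.* W.τ y
      G = R.sum {n} (λ i → η R.^ toℕ i)
      πη≈0 : π η K.≈ K.0#
      πη≈0 = K.trans (π.+-homo R.1# (R.- (x R.* W.τ y))) (K.trans (K.+-cong π.1#-homo (K.trans (π.-‿homo (x R.* W.τ y)) (K.-‿cong
        (K.trans (π.*-homo x (W.τ y)) (K.trans (K.*-congˡ (W.π-τ y)) xy≈1))))) (K.-‿inverseʳ K.1#))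
      eq : R.- (η R.^ n) R.≈ x R.* (W.τ y R.* G) R.- R.1#
      eq = begin
        R.- (η R.^ n)                              ≈⟨ R.solve 1 (λ u → R.:- u R.:= (R.con (+ 1) R.:- u) R.:- R.con (+ 1)) R.refl (η R.^ n) ⟩
        (R.1# R.- η R.^ n) R.- R.1#                ≈⟨ R.+-congʳ (R.sym (R.geometric η n)) ⟩
        (R.1# R.- η) R.* G R.- R.1#                ≈⟨ R.solve 3 (λ x y g → (R.con (+ 1) R.:- (R.con (+ 1) R.:- x R.:* y)) R.:* g R.:- R.con (+ 1) R.:= x R.:* (y R.:* g) R.:- R.con (+ 1)) R.refl x (W.τ y) G ⟩
        x R.* (W.τ y R.* G) R.- R.1#               ∎
        where open R.≈-Reasoning

    j-inverse : ∀ r y → Pow (suc n) (r R.* y R.- R.1#) → j r ⊛ j y ≡I one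
    j-inverse r y ∈Pow = mod (Small-resp {j (r R.* y R.- R.1#)} {(j r ⊛ j y) ++ ⊖ one} eq (j-Small ∈Pow))
      where
      eq : j (r R.* y R.- R.1#) ≋ (j r ⊛ j y) ++ ⊖ one
      eq = ≋-trans {j (r R.* y R.- R.1#)} {j (r R.* y) ++ j (R.- R.1#)} {(j r ⊛ j y) ++ ⊖ one}
        (j≋.+-homo (r R.* y) (R.- R.1#)) ≋-refl

    j-invertible : ∀ {r} → ¬ π r K.≈ K.0# → ∃[ u ] j r ⊛ u ≡I one
    j-invertible {r} πr≉0 = let y , ∈Pow = invertible-mod-Pow (suc n) πr≉0 in j y , j-inverse r y ∈Pow

    τ-0 : τ K.0# ≡I []
    τ-0 = mod (Small-resp {τ K.0#} {τ K.0# ++ []} ≋-refl (j-Small ([0]∈Pow (suc n))))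

    invertible-≡I : ∀ {f g} → f ≡I g → (∃[ u ] f ⊛ u ≡I one) → ∃[ u ] g ⊛ u ≡I one
    invertible-≡I {f} {g} f≡g (u , fu≡1) = u , ≡I-trans {g ⊛ u} {f ⊛ u} {one}
      (*-≡I {g} {f} {u} {u} (≡I-sym {f} {g} f≡g) (≈⇒≡I ≋-refl)) fu≡1

    1-τ-invertible : ∀ {x} → ¬ x K.≈ K.1# → ∃[ u ] (one ++ ⊖ τ x) ⊛ u ≡I one
    1-τ-invertible {x} x≉1 = invertible-≡I {j (R.1# R.- W.τ x)} {one ++ ⊖ τ x}
      (≈⇒≡I (j≋.+-homo R.1# (R.- W.τ x))) (j-invertible π≉0)
      where
      π≉0 : ¬ π (R.1# R.- W.τ x) K.≈ K.0#
      π≉0 e = x≉1 (K.sym (K.x-y≈0⇒x≈y (K.trans (K.sym (K.trans (π.+-homo R.1# (R.- W.τ x))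
        (K.+-cong π.1#-homo (K.trans (π.-‿homo (W.τ x)) (K.-‿cong (W.π-τ x)))))) e)))

    τ-sum-invertible : ∀ {m} (f : Vector K.Carrier m) → ¬ K.sum f K.≈ K.0# → ∃[ u ] T.sum (λ i → τ (f i)) ⊛ u ≡I one
    τ-sum-invertible {m} f Σf≉0 = invertible-≡I {j (R.sum (λ i → W.τ (f i)))} {T.sum (λ i → τ (f i))}
      (j.sum-homo {m} (λ i → W.τ (f i))) (j-invertible λ e →
        Σf≉0 (K.trans (K.sym (K.trans (π.sum-homo {m} (λ i → W.τ (f i))) (K.sum-cong-≋ {m} λ i → W.π-τ (f i)))) e))

  cyclotomicLift : CyclotomicLift K p n
  cyclotomicLift = record
    { T = quotient ; π = πT ; π-hom = πT-hom ; τ = τ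
    ; τ-cong = λ x≈y → ≈⇒≡I (j≋.cong (W.τ-cong x≈y))
    ; τ-0 = τ-0
    ; τ-1 = ≈⇒≡I (j≋.cong W.τ-1)
    ; τ-* = λ x y → ≈⇒≡I (j≋.cong (W.τ-* x y))
    ; π-τ = λ x → K.trans (πT-j (W.τ x)) (W.π-τ x)
    ; ζ = ζ
    ; ζ-sum = T.trans {T.sum {p} (λ i → ζ T.^ toℕ i)} {S.sum {p} (λ i → ζ S.^ toℕ i)} {T.0#}
        (T.sym {S.sum {p} (λ i → ζ S.^ toℕ i)} {T.sum {p} (λ i → ζ T.^ toℕ i)} (T.trans {S.sum {p} (λ i → ζ S.^ toℕ i)} {T.sum {p} (λ i → ζ S.^ toℕ i)} {T.sum {p} (λ i → ζ T.^ toℕ i)}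
          (q.sum-homo {p} (λ i → ζ S.^ toℕ i)) (T.sum-cong-≋ {p} λ i → q.^-homo ζ (toℕ i)))) (≈⇒≡I ζ-sum)
    ; π-ζ = K.trans (πT≈aug ζ) (K.trans (K.+-identityʳ (π R.1#)) π.1#-homo)
    ; p^v*x≈0⇒π≈0 = p^v
    ; 1-τ-invertible = 1-τ-invertible
    ; τ-sum-invertible = τ-sum-invertible
    }

-- The prime element 1 - ζ

sgn : ℕ → ℤ
sgn zero    = ℤ.1ℤ
sgn (suc k) = ℤ.- sgn k

private module ℤR = RingKit ℤ.+-*-commutativeRing

module _ {a ℓ} (R : CommutativeRing a ℓ) where
  open RingKit R

  next-binomial-mod-p : ∀ b b' s p d c → b * s ≈ 1# + p * d → b + b' ≈ c * p → b' * (- s) ≈ 1# + p * (d - c * s)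
  next-binomial-mod-p b b' s p d c bs b+b' = begin
    b' * (- s)                      ≈⟨ solve 3 (λ b b' s → b' :* (:- s) := b :* s :- (b :+ b') :* s) refl b b' s ⟩
    b * s - (b + b') * s            ≈⟨ +-cong bs (-‿cong (*-congʳ b+b')) ⟩
    (1# + p * d) - (c * p) * s      ≈⟨ solve 4 (λ p d c s → (con (+ 1) :+ p :* d) :- (c :* p) :* s := con (+ 1) :+ p :* (d :- c :* s)) refl p d c s ⟩
    1# + p * (d - c * s)            ∎
    where open ≈-Reasoning

-- Neighbours in row p - 1 of Pascal's triangle add up to an inner entry of row p, a multiple of p,
-- so modulo p they differ by a sign.
[-1]^k*[p-1]Ck : ∀ {p} → Prime p → ∀ k → k < p → ∃[ d ] + ((p ∸ 1) choose k) ℤ.* sgn k ≡ ℤ.1ℤ ℤ.+ + p ℤ.* d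
[-1]^k*[p-1]Ck {p} pr zero    k<p = ℤ.0ℤ , ≡.sym (≡.cong (λ i → ℤ.1ℤ ℤ.+ i) (ℤ.*-zeroʳ (+ p)))
[-1]^k*[p-1]Ck {p} pr (suc k) k<p = conclude ([-1]^k*[p-1]Ck pr k (ℕ.<-trans (ℕ.n<1+n k) k<p)) (p∣pCk pr (suc k) (s≤s z≤n) k<p)
  where
  b = (p ∸ 1) choose k
  b' = (p ∸ 1) choose suc k
  conclude : ∃[ d ] + b ℤ.* sgn k ≡ ℤ.1ℤ ℤ.+ + p ℤ.* d → p ∣ p choose suc k → ∃[ d ] + b' ℤ.* sgn (suc k) ≡ ℤ.1ℤ ℤ.+ + p ℤ.* d
  conclude (d , e) (divides c c*p) = d ℤ.- + c ℤ.* sgn k ,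
    next-binomial-mod-p ℤ.+-*-commutativeRing (+ b) (+ b') (sgn k) (+ p) d (+ c) e
      (≡.trans (≡.cong +_ (≡.trans (nCk+nC[k+1]≡[n+1]C[k+1] (p ∸ 1) k)
        (≡.trans (≡.cong (_choose suc k) (m∸1+1≡m (ℕ.<⇒≤ (prime⇒1<p pr)))) c*p))) (ℤ.pos-* c p))

module _ {p} (pr : Prime p) where

  -- (1 - X)^(p-1) = (1 + X + ⋯ + X^(p-1)) + p D(X), with D(1) = -1 on putting X = 1.
  abstract
    D-coefficient : Fin p → ℤ
    D-coefficient i = proj₁ ([-1]^k*[p-1]Ck pr (toℕ i) (Fin.toℕ<n i))

    D-coefficient-spec : ∀ i → + ((p ∸ 1) choose toℕ i) ℤ.* sgn (toℕ i) ≡ ℤ.1ℤ ℤ.+ + p ℤ.* D-coefficient i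
    D-coefficient-spec i = proj₂ ([-1]^k*[p-1]Ck pr (toℕ i) (Fin.toℕ<n i))

  module _ {a ℓ} (R : CommutativeRing a ℓ) where
    open RingKit R

    D : Carrier → Carrier
    D x = sum (λ i → int (D-coefficient i) * x ^ toℕ i)

    int-hom : IsHom ℤ.+-*-commutativeRing R int
    int-hom = mkHom ℤ.+-*-commutativeRing R (λ e → reflexive (≡.cong int e)) int-+ int-* ⌜1⌝

    [-x]^k : ∀ x k → (- x) ^ k ≈ int (sgn k) * x ^ k
    [-x]^k x zero    = sym (trans (*-identityʳ _) ⌜1⌝)
    [-x]^k x (suc k) = begin
      - x * (- x) ^ k                 ≈⟨ *-congˡ ([-x]^k x k) ⟩
      - x * (int (sgn k) * x ^ k)     ≈⟨ solve 3 (λ x s y → :- x :* (s :* y) := :- s :* (x :* y)) refl x _ _ ⟩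
      - int (sgn k) * (x * x ^ k)     ≈⟨ *-congʳ (sym (int-neg (sgn k))) ⟩
      int (sgn (suc k)) * x ^ suc k   ∎
      where open ≈-Reasoning

    [1-x]^[p-1] : ∀ x → (1# - x) ^ (p ∸ 1) ≈ sum {p} (λ i → x ^ toℕ i) + ⌜ p ⌝ * D x
    [1-x]^[p-1] x = begin
      (1# - x) ^ (p ∸ 1)                                             ≈⟨ ^-congˡ (p ∸ 1) (+-comm 1# (- x)) ⟩
      (- x + 1#) ^ (p ∸ 1)                                           ≈⟨ BT.theorem (p ∸ 1) (- x) 1# ⟩
      sum {suc (p ∸ 1)} (t ∘ toℕ)                                    ≈⟨ ≡.subst (λ k → sum {suc (p ∸ 1)} (t ∘ toℕ) ≈ sum {k} (t ∘ toℕ)) (m∸1+1≡m (ℕ.<⇒≤ (prime⇒1<p pr))) refl ⟩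
      sum {p} (t ∘ toℕ)                                              ≈⟨ sum-cong-≋ {p} term ⟩
      sum {p} (λ i → x ^ toℕ i + ⌜ p ⌝ * (int (D-coefficient i) * x ^ toℕ i))
                                                                     ≈⟨ ∑-distrib-+ {p} (λ i → x ^ toℕ i) (λ i → ⌜ p ⌝ * (int (D-coefficient i) * x ^ toℕ i)) ⟩
      sum {p} (λ i → x ^ toℕ i) + sum {p} (λ i → ⌜ p ⌝ * (int (D-coefficient i) * x ^ toℕ i))
                                                                     ≈⟨ +-congˡ (sym (*-distribˡ-sum {p} ⌜ p ⌝ (λ i → int (D-coefficient i) * x ^ toℕ i))) ⟩
      sum {p} (λ i → x ^ toℕ i) + ⌜ p ⌝ * D x                        ∎
      where
      open ≈-Reasoning
      module BT = Binomial commutativeSemiring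
      t : ℕ → Carrier
      t k = ((p ∸ 1) choose k) · ((- x) ^ k * 1# ^ (p ∸ 1 ∸ k))
      term : ∀ (i : Fin p) → t (toℕ i) ≈ x ^ toℕ i + ⌜ p ⌝ * (int (D-coefficient i) * x ^ toℕ i)
      term i = begin
        t k                                                ≈⟨ ·≈⌜⌝* ((p ∸ 1) choose k) ((- x) ^ k * 1# ^ (p ∸ 1 ∸ k)) ⟩
        ⌜ (p ∸ 1) choose k ⌝ * ((- x) ^ k * 1# ^ (p ∸ 1 ∸ k))   ≈⟨ *-congˡ (trans (*-congˡ (1^n (p ∸ 1 ∸ k))) (trans (*-identityʳ _) ([-x]^k x k))) ⟩
        ⌜ (p ∸ 1) choose k ⌝ * (int (sgn k) * x ^ k)            ≈⟨ sym (*-assoc _ _ _) ⟩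
        (int (+ ((p ∸ 1) choose k)) * int (sgn k)) * x ^ k      ≈⟨ *-congʳ (sym (int-* (+ ((p ∸ 1) choose k)) (sgn k))) ⟩
        int (+ ((p ∸ 1) choose k) ℤ.* sgn k) * x ^ k            ≈⟨ *-congʳ (reflexive (≡.cong int (D-coefficient-spec i))) ⟩
        int (ℤ.1ℤ ℤ.+ + p ℤ.* d) * x ^ k                   ≈⟨ *-congʳ (trans (int-+ ℤ.1ℤ (+ p ℤ.* d)) (+-cong ⌜1⌝ (int-* (+ p) d))) ⟩
        (1# + ⌜ p ⌝ * int d) * x ^ k                       ≈⟨ solve 3 (λ p d x → (con (+ 1) :+ p :* d) :* x := x :+ p :* (d :* x)) refl ⌜ p ⌝ (int d) (x ^ k) ⟩
        x ^ k + ⌜ p ⌝ * (int d * x ^ k)                    ∎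
        where
        k = toℕ i
        d = D-coefficient i

  private
    ⌜⌝≡+ : ∀ n → ℤR.⌜ n ⌝ ≡ + n
    ⌜⌝≡+ zero    = ≡.refl
    ⌜⌝≡+ (suc n) = ≡.cong (λ i → ℤ.1ℤ ℤ.+ i) (⌜⌝≡+ n)

    int≡id : ∀ i → ℤR.int i ≡ i
    int≡id (+ n)    = ⌜⌝≡+ n
    int≡id -[1+ n ] = ≡.cong ℤ.-_ (⌜⌝≡+ (suc n))

  Σd≡-1 : ℤR.sum D-coefficient ≡ ℤ.- ℤ.1ℤ
  Σd≡-1 = ℤ.*-cancelˡ-≡ (+ p) _ _ (begin
    + p ℤ.* ℤR.sum D-coefficient                        ≡⟨ ≡.cong (λ i → i ℤ.* ℤR.sum D-coefficient) (≡.sym (⌜⌝≡+ p)) ⟩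
    ℤR.⌜ p ⌝ ℤ.* ℤR.sum D-coefficient                   ≡⟨ ℤR.solve 2 (λ p d → p ℤR.:* d ℤR.:= (p ℤR.:+ p ℤR.:* d) ℤR.:- p) ≡.refl ℤR.⌜ p ⌝ (ℤR.sum D-coefficient) ⟩
    (ℤR.⌜ p ⌝ ℤ.+ ℤR.⌜ p ⌝ ℤ.* ℤR.sum D-coefficient) ℤ.- ℤR.⌜ p ⌝
                                                        ≡⟨ ≡.cong (λ i → i ℤ.- ℤR.⌜ p ⌝) (≡.sym 0≡) ⟩
    ℤ.0ℤ ℤ.- ℤR.⌜ p ⌝                                   ≡⟨ ≡.cong (λ i → ℤ.0ℤ ℤ.- i) (⌜⌝≡+ p) ⟩
    ℤ.0ℤ ℤ.- + p                                        ≡⟨ ℤR.solve 1 (λ p → ℤR.con (+ 0) ℤR.:- p ℤR.:= p ℤR.:* (ℤR.:- ℤR.con (+ 1))) ≡.refl (+ p) ⟩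
    + p ℤ.* (ℤ.- ℤ.1ℤ)                                  ∎)
    where
    open ≡.≡-Reasoning
    instance _ = prime⇒nonZero pr
    0≡ : ℤ.0ℤ ≡ ℤR.⌜ p ⌝ ℤ.+ ℤR.⌜ p ⌝ ℤ.* ℤR.sum D-coefficient
    0≡ = ≡.trans (≡.sym (ℤR.0^n (ℕ.m<n⇒0<n∸m (prime⇒1<p pr)))) (≡.trans ([1-x]^[p-1] ℤ.+-*-commutativeRing ℤ.1ℤ)
      (≡.cong₂ (λ u v → u ℤ.+ ℤR.⌜ p ⌝ ℤ.* v)
        (≡.trans (ℤR.sum-cong-≋ {p} λ i → ℤR.1^n (toℕ i)) (≡.trans (ℤR.sum-const p ℤ.1ℤ) (ℤ.*-identityʳ ℤR.⌜ p ⌝)))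
        (ℤR.sum-cong-≋ {p} λ i → ≡.trans (≡.cong₂ ℤ._*_ (int≡id (D-coefficient i)) (ℤR.1^n (toℕ i))) (ℤ.*-identityʳ (D-coefficient i)))))

  module _ {a ℓ} (R : CommutativeRing a ℓ) where
    open RingKit R

    private module intH = HomKit ℤ.+-*-commutativeRing R (int-hom R)

    D-1 : D R 1# ≈ - 1#
    D-1 = begin
      D R 1#                               ≈⟨ sum-cong-≋ {p} (λ i → trans (*-congˡ (1^n (toℕ i))) (*-identityʳ _)) ⟩
      sum (λ i → int (D-coefficient i))    ≈⟨ sym (intH.sum-homo {p} D-coefficient) ⟩
      int (ℤR.sum D-coefficient)           ≈⟨ reflexive (≡.cong int Σd≡-1) ⟩
      - ⌜ 1 ⌝                              ≈⟨ -‿cong ⌜1⌝ ⟩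
      - 1#                                 ∎
      where open ≈-Reasoning

-- Digit sums and exponent vectors

Σℕ-0 : ∀ {n} (f : Vector ℕ n) → (∀ i → f i ≡ 0) → Defs.sum f ≡ 0
Σℕ-0 {zero}  f f≡0 = ≡.refl
Σℕ-0 {suc n} f f≡0 = ≡.cong₂ ℕ._+_ (f≡0 Fin.zero) (Σℕ-0 (f ∘ Fin.suc) (f≡0 ∘ Fin.suc))

Σℕ≡0⇒≡0 : ∀ {n} (f : Vector ℕ n) → Defs.sum f ≡ 0 → ∀ i → f i ≡ 0
Σℕ≡0⇒≡0 f Σ≡0 Fin.zero    = ℕ.m+n≡0⇒m≡0 (f Fin.zero) Σ≡0
Σℕ≡0⇒≡0 f Σ≡0 (Fin.suc i) = Σℕ≡0⇒≡0 (f ∘ Fin.suc) (ℕ.m+n≡0⇒n≡0 (f Fin.zero) Σ≡0) i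

Σℕ-cong : ∀ {n} {f g : Vector ℕ n} → (∀ i → f i ≡ g i) → Defs.sum f ≡ Defs.sum g
Σℕ-cong {zero}  f≡g = ≡.refl
Σℕ-cong {suc n} f≡g = ≡.cong₂ ℕ._+_ (f≡g Fin.zero) (Σℕ-cong (f≡g ∘ Fin.suc))

lookup-ext : ∀ {a} {A : Set a} {n} (v w : Vec A n) → (∀ i → lookup v i ≡ lookup w i) → v ≡ w
lookup-ext Vec.[]      Vec.[]      e = ≡.refl
lookup-ext (x Vec.∷ v) (y Vec.∷ w) e = ≡.cong₂ Vec._∷_ (e Fin.zero) (lookup-ext v w (e ∘ Fin.suc))

-- `S` enters only through rules that mirror those of the Gauss sums: adding 1 without a carry
-- corresponds to a Jacobi sum, multiplication by p to Frobenius.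
module DigitSumArithmetic
  {p} (pr : Prime p)
  (S : ℕ → ℕ) (S-0 : S 0 ≡ 0) (S-suc : ∀ r → ¬ p ∣ suc r → S (suc r) ≡ suc (S r)) (S-*p : ∀ r → S (r ℕ.* p) ≡ S r)
  where

  private
    instance
      p≢0 : NonZero p
      p≢0 = prime⇒nonZero pr

    1<p : 1 < p
    1<p = prime⇒1<p pr

  S-digit : ∀ c r → c < p → S (c ℕ.+ r ℕ.* p) ≡ c ℕ.+ S r
  S-digit zero    r _     = S-*p r
  S-digit (suc c) r 1+c<p = ≡.trans (S-suc (c ℕ.+ r ℕ.* p) λ p∣ → ℕ.<⇒≱ 1+c<p (∣⇒≤ (∣.∣m+n∣m⇒∣n (≡.subst (p ∣_) (ℕ.+-comm (suc c) (r ℕ.* p)) p∣) (∣.n∣m*n r))))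
    (≡.cong suc (S-digit c r (ℕ.<-trans (ℕ.n<1+n c) 1+c<p)))

  S-p^m∸1 : ∀ m → S (p ℕ.^ m ∸ 1) ≡ (p ∸ 1) ℕ.* m
  S-p^m∸1 zero    = ≡.trans S-0 (≡.sym (ℕ.*-zeroʳ (p ∸ 1)))
  S-p^m∸1 (suc m) = ≡.trans (≡.cong S split) (≡.trans (S-digit (p ∸ 1) (p ℕ.^ m ∸ 1) (≡.subst (p ∸ 1 <_) (m∸1+1≡m (ℕ.<⇒≤ 1<p)) (ℕ.n<1+n (p ∸ 1))))
    (≡.trans (≡.cong (p ∸ 1 ℕ.+_) (S-p^m∸1 m)) (≡.sym (ℕ.*-suc (p ∸ 1) m))))
    where
    split : p ℕ.^ suc m ∸ 1 ≡ (p ∸ 1) ℕ.+ (p ℕ.^ m ∸ 1) ℕ.* p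
    split = ≡.cong (_∸ 1) {p ℕ.^ suc m} {suc (p ∸ 1) ℕ.+ (p ℕ.^ m ∸ 1) ℕ.* p} (≡.trans (ℕ.*-comm p (p ℕ.^ m)) (≡.trans (≡.cong (ℕ._* p) (≡.sym (m∸1+1≡m (ℕ.m^n>0 p m))))
      (≡.cong (ℕ._+ (p ℕ.^ m ∸ 1) ℕ.* p) (≡.sym (m∸1+1≡m (ℕ.<⇒≤ 1<p))))))

  S-congruence : ∀ i → ∃[ c ] i ≡ S i ℕ.+ c ℕ.* (p ∸ 1)
  S-congruence = <-rec (λ i → ∃[ c ] i ≡ S i ℕ.+ c ℕ.* (p ∸ 1)) step
    where
    step : ∀ i → (∀ {j} → j < i → ∃[ c ] j ≡ S j ℕ.+ c ℕ.* (p ∸ 1)) → ∃[ c ] i ≡ S i ℕ.+ c ℕ.* (p ∸ 1)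
    step zero    rec = 0 , ≡.sym (≡.trans (ℕ.+-identityʳ (S 0)) S-0)
    step (suc i) rec with p ∣.∣? suc i
    ... | no p∤ = let (c , e) = rec (ℕ.n<1+n i) in c , ≡.trans (≡.cong suc e) (≡.cong (ℕ._+ c ℕ.* (p ∸ 1)) (≡.sym (S-suc i p∤)))
    ... | yes (divides j 1+i≡j*p) = let (c , e) = rec (j<1+i j 1+i≡j*p) in c ℕ.+ j , (begin
      suc i                                            ≡⟨ 1+i≡j*p ⟩
      j ℕ.* p                                          ≡⟨ ≡.cong (j ℕ.*_) (≡.sym (m∸1+1≡m (ℕ.<⇒≤ 1<p))) ⟩
      j ℕ.* suc (p ∸ 1)                                ≡⟨ ℕ.*-suc j (p ∸ 1) ⟩
      j ℕ.+ j ℕ.* (p ∸ 1)                              ≡⟨ ≡.cong (ℕ._+ j ℕ.* (p ∸ 1)) e ⟩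
      S j ℕ.+ c ℕ.* (p ∸ 1) ℕ.+ j ℕ.* (p ∸ 1)          ≡⟨ ℕ.+-assoc (S j) _ _ ⟩
      S j ℕ.+ (c ℕ.* (p ∸ 1) ℕ.+ j ℕ.* (p ∸ 1))        ≡⟨ ≡.cong₂ ℕ._+_ (≡.trans (≡.sym (S-*p j)) (≡.cong S (≡.sym 1+i≡j*p))) (≡.sym (ℕ.*-distribʳ-+ (p ∸ 1) c j)) ⟩
      S (suc i) ℕ.+ (c ℕ.+ j) ℕ.* (p ∸ 1)              ∎)
      where
      open ≡.≡-Reasoning
      j<1+i : ∀ j → suc i ≡ j ℕ.* p → j < suc i
      j<1+i zero    ()
      j<1+i (suc j) e = ≡.subst (suc j <_) (≡.sym e) (ℕ.m<m*n (suc j) p 1<p)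

  p∸1∣p^e∸1 : ∀ e → (p ∸ 1) ∣ p ℕ.^ e ∸ 1
  p∸1∣p^e∸1 e = let (c , e≡) = S-congruence (p ℕ.^ e ∸ 1) in
    ≡.subst ((p ∸ 1) ∣_) (≡.sym e≡) (∣.∣m∣n⇒∣m+n (≡.subst ((p ∸ 1) ∣_) (≡.sym (S-p^m∸1 e)) (∣.m∣m*n e)) (∣.n∣m*n c))

  -- Every number is congruent to its digit sum modulo p - 1. For admissible exponents this makes
  -- the total digit sum a multiple of p - 1, so that powers of 1 - ζ turn into powers of p.
  Σ-congruence : ∀ {i} (f : Vector ℕ i) → (p ∸ 1) ∣ Defs.sum f → (p ∸ 1) ∣ Defs.sum (λ j → S (f j))
  Σ-congruence f ∣Σf = let (c , e) = go f in ∣.∣m+n∣m⇒∣n (≡.subst ((p ∸ 1) ∣_) (≡.trans e (ℕ.+-comm _ (c ℕ.* (p ∸ 1)))) ∣Σf) (∣.n∣m*n c)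
    where
    open +-*-Solver using () renaming (solve to solveℕ; _:+_ to _⊞_; _:*_ to _⊠_; _:=_ to _≗_)
    go : ∀ {i} (f : Vector ℕ i) → ∃[ c ] Defs.sum f ≡ Defs.sum (λ j → S (f j)) ℕ.+ c ℕ.* (p ∸ 1)
    go {zero}  f = 0 , ≡.refl
    go {suc i} f = let (c , e) = S-congruence (f Fin.zero) ; (c′ , e′) = go (f ∘ Fin.suc) in c ℕ.+ c′ ,
      ≡.trans (≡.cong₂ ℕ._+_ e e′) (solveℕ 5 (λ s c s′ c′ P → (s ⊞ c ⊠ P) ⊞ (s′ ⊞ c′ ⊠ P) ≗ (s ⊞ s′) ⊞ (c ⊞ c′) ⊠ P) ≡.refl
        (S (f Fin.zero)) c (Defs.sum (λ j → S (f (Fin.suc j)))) c′ (p ∸ 1))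

module ExponentVectors {h} (ns : Vec ℕ h) {k} (s : Vector (ProductGroup ns) k) (Q q : ℕ) (S : ℕ → ℕ) where

  -- Vectors over `Fin Q` have the bound on the entries built in. With propositional equality they
  -- can be searched exhaustively and singled out in sums.
  Exponents : Set
  Exponents = Vec (Fin Q) k

  r : Exponents → Vector ℕ k
  r v i = toℕ (lookup v i)

  ∣_∣ᵛ : Exponents → ℕ
  ∣ v ∣ᵛ = Defs.sum (r v)

  E : Exponents → Fin h → ℕ
  E v l = Defs.sum λ i → r v i ℕ.* coord (s i) l

  ΣS : Exponents → ℕ
  ΣS v = Defs.sum (λ i → S (r v i))

  Adm : Exponents → Set
  Adm v = 0 < ∣ v ∣ᵛ × (q ∸ 1) ∣ ∣ v ∣ᵛ × (∀ l → lookup ns l ∣ E v l)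

  adm? : ∀ v → Dec (Adm v)
  adm? v = (0 ℕ.<? ∣ v ∣ᵛ) ×-dec (((q ∸ 1) ∣.∣? ∣ v ∣ᵛ) ×-dec Fin.all? (λ l → lookup ns l ∣.∣? E v l))

-- Sums over lists, over the group and over exponent vectors

module _ {a ℓ} (R : CommutativeRing a ℓ) where

  private module RK = RingKit R

  module IndexedSums where
    open RK

    ΣL : ∀ {b} {B : Set b} → List B → (B → Carrier) → Carrier
    ΣL []       f = 0#
    ΣL (x ∷ xs) f = f x + ΣL xs f

    ΣL-cong : ∀ {b} {B : Set b} (xs : List B) {f g} → (∀ x → f x ≈ g x) → ΣL xs f ≈ ΣL xs g
    ΣL-cong []       f≈g = refl
    ΣL-cong (x ∷ xs) f≈g = +-cong (f≈g x) (ΣL-cong xs f≈g)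

    ΣL-const : ∀ {b} {B : Set b} (xs : List B) {f} → (∀ x → f x ≈ 1#) → ΣL xs f ≈ ⌜ List.length xs ⌝
    ΣL-const []       f≈1 = refl
    ΣL-const (x ∷ xs) f≈1 = +-cong (f≈1 x) (ΣL-const xs f≈1)

    ΣL-filter : ∀ {b c} {B : Set b} {P : B → Set c} (P? : ∀ x → Dec (P x)) (xs : List B) {f} →
                (∀ x → P x → f x ≈ 0#) → (∀ x → ¬ P x → f x ≈ 1#) → ΣL xs f + ⌜ List.length (List.filter P? xs) ⌝ ≈ ⌜ List.length xs ⌝
    ΣL-filter P? []       f≈0 f≈1 = +-identityˡ 0#
    ΣL-filter P? (x ∷ xs) {f} f≈0 f≈1 with P? x
    ... | yes Px = trans (+-cong (trans (+-congʳ (f≈0 x Px)) (+-identityˡ _)) refl)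
                     (trans (solve 3 (λ s u w → s :+ (u :+ w) := u :+ (s :+ w)) refl (ΣL xs f) 1# _) (+-congˡ (ΣL-filter P? xs f≈0 f≈1)))
    ... | no ¬Px = trans (+-assoc _ _ _) (+-cong (f≈1 x ¬Px) (ΣL-filter P? xs f≈0 f≈1))

    ΣL-* : ∀ {b} {B : Set b} (xs : List B) c f → ΣL xs (λ x → c * f x) ≈ c * ΣL xs f
    ΣL-* []       c f = sym (zeroʳ c)
    ΣL-* (x ∷ xs) c f = trans (+-congˡ (ΣL-* xs c f)) (sym (distribˡ c _ _))

    ΣL-++ : ∀ {b} {B : Set b} (xs ys : List B) f → ΣL (xs ++ ys) f ≈ ΣL xs f + ΣL ys f
    ΣL-++ []       ys f = sym (+-identityˡ _)
    ΣL-++ (x ∷ xs) ys f = trans (+-congˡ (ΣL-++ xs ys f)) (sym (+-assoc _ _ _))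

    ΣL-map : ∀ {b c} {B : Set b} {C : Set c} (h : B → C) xs f → ΣL (List.map h xs) f ≈ ΣL xs (f ∘ h)
    ΣL-map h []       f = refl
    ΣL-map h (x ∷ xs) f = +-congˡ (ΣL-map h xs f)

    ΣL-tabulate : ∀ {b} {B : Set b} {n} (h : Fin n → B) f → ΣL (List.tabulate h) f ≈ sum (f ∘ h)
    ΣL-tabulate {n = zero}  h f = refl
    ΣL-tabulate {n = suc n} h f = +-congˡ (ΣL-tabulate (h ∘ Fin.suc) f)

    ΣL-cartesianProductWith : ∀ {b c d} {B : Set b} {C : Set c} {D : Set d} (h : B → C → D) xs ys f →
                              ΣL (List.cartesianProductWith h xs ys) f ≈ ΣL xs (λ x → ΣL ys (f ∘ h x))
    ΣL-cartesianProductWith h []       ys f = refl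
    ΣL-cartesianProductWith h (x ∷ xs) ys f = trans (ΣL-++ (List.map (h x) ys) _ f)
      (+-cong (ΣL-map (h x) ys f) (ΣL-cartesianProductWith h xs ys f))

    -- Distributivity, one coordinate at a time. Applied to the characters of the group, and to the
    -- constant 1 for its order.
    Σ-elements : ∀ {h} (ns : Vec ℕ h) (g : Fin h → ℕ → Carrier) →
                 ΣL (elements ns) (λ j → product (λ l → g l (coord j l))) ≈ product (λ l → sum {lookup ns l} (λ x → g l (toℕ x)))
    Σ-elements Vec.[]       g = +-identityʳ 1#
    Σ-elements (n Vec.∷ ns) g = begin
      ΣL (elements (n Vec.∷ ns)) (λ j → product (λ l → g l (coord j l)))
        ≈⟨ ΣL-cartesianProductWith All._∷_ (List.allFin n) (elements ns) _ ⟩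
      ΣL (List.allFin n) (λ x → ΣL (elements ns) (λ j → g Fin.zero (toℕ x) * P j))
        ≈⟨ ΣL-cong (List.allFin n) (λ x → trans (ΣL-* (elements ns) (g Fin.zero (toℕ x)) P) (*-congˡ (Σ-elements ns (g ∘ Fin.suc)))) ⟩
      ΣL (List.allFin n) (λ x → g Fin.zero (toℕ x) * P′)
        ≈⟨ ΣL-tabulate {n = n} id (λ x → g Fin.zero (toℕ x) * P′) ⟩
      sum {n} (λ x → g Fin.zero (toℕ x) * P′)
        ≈⟨ sym (*-distribʳ-sum {n} P′ (λ x → g Fin.zero (toℕ x))) ⟩
      sum {n} (λ x → g Fin.zero (toℕ x)) * P′ ∎
      where
      open ≈-Reasoning
      P : ProductGroup ns → Carrier
      P j = product (λ l → g (Fin.suc l) (coord j l))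
      P′ = product (λ l → sum {lookup ns l} (λ x → g (Fin.suc l) (toℕ x)))

    product-0 : ∀ {n} (f : Vector Carrier n) i → f i ≈ 0# → product f ≈ 0#
    product-0 f Fin.zero    fi≈0 = trans (*-congʳ fi≈0) (zeroˡ _)
    product-0 f (Fin.suc i) fi≈0 = trans (*-congˡ (product-0 (f ∘ Fin.suc) i fi≈0)) (zeroʳ _)

    ΣV : ∀ {Q} k → (Vec (Fin Q) k → Carrier) → Carrier
    ΣV     zero    f = f Vec.[]
    ΣV {Q} (suc k) f = sum {Q} (λ r → ΣV k (λ v → f (r Vec.∷ v)))

    module _ {Q : ℕ} where

      ΣV-cong : ∀ k {f g : Vec (Fin Q) k → Carrier} → (∀ v → f v ≈ g v) → ΣV k f ≈ ΣV k g
      ΣV-cong zero    f≈g = f≈g Vec.[]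
      ΣV-cong (suc k) f≈g = sum-cong-≋ {Q} λ r → ΣV-cong k λ v → f≈g (r Vec.∷ v)

      ΣV-0 : ∀ k {f : Vec (Fin Q) k → Carrier} → (∀ v → f v ≈ 0#) → ΣV k f ≈ 0#
      ΣV-0 zero    f≈0 = f≈0 Vec.[]
      ΣV-0 (suc k) f≈0 = sum-0 {Q} λ r → ΣV-0 k λ v → f≈0 (r Vec.∷ v)

      ΣV-+ : ∀ k (f g : Vec (Fin Q) k → Carrier) → ΣV k (λ v → f v + g v) ≈ ΣV k f + ΣV k g
      ΣV-+ zero    f g = refl
      ΣV-+ (suc k) f g = trans (sum-cong-≋ {Q} λ r → ΣV-+ k (λ v → f (r Vec.∷ v)) (λ v → g (r Vec.∷ v)))
        (∑-distrib-+ {Q} (λ r → ΣV k (λ v → f (r Vec.∷ v))) (λ r → ΣV k (λ v → g (r Vec.∷ v))))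

      ΣV-* : ∀ k c (f : Vec (Fin Q) k → Carrier) → ΣV k (λ v → c * f v) ≈ c * ΣV k f
      ΣV-* zero    c f = refl
      ΣV-* (suc k) c f = trans (sum-cong-≋ {Q} λ r → ΣV-* k c (λ v → f (r Vec.∷ v)))
        (sym (*-distribˡ-sum {Q} c (λ r → ΣV k (λ v → f (r Vec.∷ v)))))

      ΣV-single : ∀ k (f : Vec (Fin Q) k → Carrier) v → (∀ w → w ≢ v → f w ≈ 0#) → ΣV k f ≈ f v
      ΣV-single zero    f Vec.[]      f≈0 = refl
      ΣV-single (suc k) f (r Vec.∷ v) f≈0 = trans
        (sum-single {Q} (λ r → ΣV k (λ v → f (r Vec.∷ v))) r λ r′ r′≢r → ΣV-0 k λ w → f≈0 _ λ e → r′≢r (≡.cong Vec.head e))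
        (ΣV-single k (λ w → f (r Vec.∷ w)) v λ w w≢v → f≈0 _ λ e → w≢v (≡.cong Vec.tail e))

      ∑-ΣV : ∀ {m} k (f : Fin m → Vec (Fin Q) k → Carrier) → sum (λ i → ΣV k (f i)) ≈ ΣV k (λ v → sum (λ i → f i v))
      ∑-ΣV {zero}  k f = sym (ΣV-0 k λ v → refl)
      ∑-ΣV {suc m} k f = trans (+-congˡ (∑-ΣV k (f ∘ Fin.suc))) (sym (ΣV-+ k (f Fin.zero) (λ v → sum (λ i → f (Fin.suc i) v))))

      ΣL-ΣV : ∀ {b} {B : Set b} (xs : List B) k (f : B → Vec (Fin Q) k → Carrier) → ΣL xs (λ x → ΣV k (f x)) ≈ ΣV k (λ v → ΣL xs (λ x → f x v))
      ΣL-ΣV []       k f = sym (ΣV-0 k λ v → refl)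
      ΣL-ΣV (x ∷ xs) k f = trans (+-congˡ (ΣL-ΣV xs k f)) (sym (ΣV-+ k (f x) (λ v → ΣL xs (λ x → f x v))))

      product-∑ : ∀ k (f : Fin k → Fin Q → Carrier) → product (λ i → sum (f i)) ≈ ΣV k (λ v → product (λ i → f i (lookup v i)))
      product-∑ zero    f = refl
      product-∑ (suc k) f = trans (*-distribʳ-sum {Q} (product (λ i → sum (f (Fin.suc i)))) (f Fin.zero))
        (sum-cong-≋ {Q} λ r → trans (*-congˡ (product-∑ k (f ∘ Fin.suc))) (sym (ΣV-* k (f Fin.zero r) (λ v → product (λ i → f (Fin.suc i) (lookup v i))))))

-- Polynomial functions with exponents below Q

module _ {a ℓ₁ ℓ₂} (K : HeytingField a ℓ₁ ℓ₂) {Q} (order : HasOrder K Q) (1<Q : 1 < Q) where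

  private
    module K = FieldKit K order 1<Q
    module ΣKK = MultiplicativeSums K order 1<Q (Defs.ring K) id id K.refl K.refl (λ _ _ → K.refl)
                   (λ x≉1 → K.inverse (λ e → x≉1 (K.sym (K.x-y≈0⇒x≈y e))))
  open IndexedSums (Defs.ring K)

  module ReducedPolynomials where

    -- The exponent is positive and below 2 (Q - 1), so it could only equal Q - 1, and this would
    -- force r = s.
    exponent-∤ : ∀ r s → 0 < s → r ≤ Q ∸ 1 → s ≤ Q ∸ 1 → r ≢ s → 0 < Q ∸ 1 ∸ s ℕ.+ r → ¬ (Q ∸ 1) ∣ Q ∸ 1 ∸ s ℕ.+ r
    exponent-∤ r s 0<s r≤ s≤ r≢s 0<c (divides zero e) = ℕ.<⇒≢ 0<c (≡.sym e)
    exponent-∤ r s 0<s r≤ s≤ r≢s 0<c (divides (suc zero) e) = r≢s (ℕ.+-cancelˡ-≡ (Q ∸ 1 ∸ s) r s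
      (≡.trans e (≡.trans (ℕ.+-identityʳ (Q ∸ 1)) (≡.sym (ℕ.m∸n+n≡m s≤)))))
    exponent-∤ r s 0<s r≤ s≤ r≢s 0<c (divides (suc (suc k)) e) = ℕ.<⇒≱
      (ℕ.<-≤-trans (ℕ.+-mono-<-≤ (ℕ.∸-monoʳ-< {Q ∸ 1} {s} {0} 0<s s≤) r≤) (ℕ.≤-trans (ℕ.m≤m+n _ (k ℕ.* (Q ∸ 1))) (ℕ.≤-reflexive (ℕ.+-assoc (Q ∸ 1) (Q ∸ 1) _))))
      (ℕ.≤-reflexive (≡.sym e))

    r≤Q∸1 : ∀ (r : Fin Q) → toℕ r ≤ Q ∸ 1
    r≤Q∸1 r = ℕ.≤-pred (≡.subst (toℕ r <_) (≡.sym (m∸1+1≡m K.1≤Q)) (Fin.toℕ<n r))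

    -- Power sums extract coefficients: for s > 0, summing x^(Q-1-s) P(x) over K leaves (Q - 1) b_s,
    -- because no other exponent Q - 1 - s + r is a positive multiple of Q - 1.
    coefficients-vanish : (b : Fin Q → K.Carrier) → (∀ x → K.sum (λ r → b r K.* x K.^ toℕ r) K.≈ K.0#) → ∀ s → b s K.≈ K.0#
    coefficients-vanish b P≈0 s with toℕ s in eq
    -- For s = 0 both r = 0 and r = Q - 1 would survive the power sum; evaluation at 0 isolates the
    -- coefficient instead.
    ... | zero   = K.trans (K.sym (K.trans (K.*-congˡ (K.^-congʳ K.0# eq)) (K.*-identityʳ _)))
        (K.trans (K.sym (K.sum-single {Q} (λ r → b r K.* K.0# K.^ toℕ r) s λ r r≢s → K.trans (K.*-congˡ (K.0^n (ℕ.n≢0⇒n>0 λ e → r≢s (Fin.toℕ-injective (≡.trans e (≡.sym eq)))))) (K.zeroʳ _))) (P≈0 K.0#))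
    ... | suc s′ = K.*-zero ⌜Q-1⌝≉0 (begin
      K.⌜ Q ∸ 1 ⌝ K.* b s
        ≈⟨ K.*-congʳ (K.sym (ΣKK.power-sum-∣ 0<e (∣.∣-reflexive (≡.sym (ℕ.m∸n+n≡m (r≤Q∸1 s)))))) ⟩
      ΣKK.ΣK (λ x → x K.^ (c ℕ.+ toℕ s)) K.* b s
        ≈⟨ K.*-comm _ _ ⟩
      b s K.* ΣKK.ΣK (λ x → x K.^ (c ℕ.+ toℕ s))
        ≈⟨ K.sym (K.sum-single {Q} (λ r → b r K.* ΣKK.ΣK (λ x → x K.^ (c ℕ.+ toℕ r))) s λ r r≢s → K.trans (K.*-congˡ (other r r≢s)) (K.zeroʳ _)) ⟩
      K.sum (λ r → b r K.* ΣKK.ΣK (λ x → x K.^ (c ℕ.+ toℕ r)))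
        ≈⟨ K.sum-cong-≋ {Q} (λ r → K.trans (K.sym (ΣKK.ΣK-* (b r) (λ x → x K.^ (c ℕ.+ toℕ r)))) (ΣKK.ΣK-cong λ x →
             K.trans (K.*-congˡ (K.^-homo-* x c (toℕ r))) (K.solve 3 (λ b u v → b K.:* (u K.:* v) K.:= u K.:* (b K.:* v)) K.refl (b r) (x K.^ c) (x K.^ toℕ r)))) ⟩
      K.sum (λ r → ΣKK.ΣK (λ x → x K.^ c K.* (b r K.* x K.^ toℕ r)))
        ≈⟨ K.∑-comm {Q} {Q} (λ r i → K.from i K.^ c K.* (b r K.* K.from i K.^ toℕ r)) ⟩
      ΣKK.ΣK (λ x → K.sum (λ r → x K.^ c K.* (b r K.* x K.^ toℕ r)))
        ≈⟨ ΣKK.ΣK-cong (λ x → K.trans (K.sym (K.*-distribˡ-sum {Q} (x K.^ c) (λ r → b r K.* x K.^ toℕ r))) (K.trans (K.*-congˡ (P≈0 x)) (K.zeroʳ _))) ⟩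
      ΣKK.ΣK (λ x → K.0#)
        ≈⟨ K.sum-0 {Q} (λ _ → K.refl) ⟩
      K.0# ∎)
      where
      open K.≈-Reasoning
      c = Q ∸ 1 ∸ toℕ s
      0<s : 0 < toℕ s
      0<s = ≡.subst (0 <_) (≡.sym eq) (s≤s z≤n)
      0<e : 0 < c ℕ.+ toℕ s
      0<e = ℕ.<-≤-trans 0<s (ℕ.m≤n+m (toℕ s) c)
      ⌜Q-1⌝≉0 : ¬ K.⌜ Q ∸ 1 ⌝ K.≈ K.0#
      ⌜Q-1⌝≉0 e = K.1≉0 (K.trans (K.sym (K.+-identityʳ K.1#)) (K.trans (K.+-congˡ (K.sym e)) (K.trans (K.⌜⌝-cong (m∸1+1≡m K.1≤Q)) K.⌜Q⌝≈0)))
      other : ∀ r → r ≢ s → ΣKK.ΣK (λ x → x K.^ (c ℕ.+ toℕ r)) K.≈ K.0#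
      other r r≢s with c ℕ.+ toℕ r ℕ.≟ 0
      -- This occurs for s = Q - 1 and r = 0, where the summand is 1 and the sum is Q, which is 0 in
      -- K.
      ... | yes e≡0 = K.trans (ΣKK.ΣK-cong λ x → K.^-congʳ x e≡0) (K.trans (K.sum-const Q K.1#) (K.trans (K.*-identityʳ _) K.⌜Q⌝≈0))
      ... | no  e≢0 = ΣKK.power-sum-∤ (c ℕ.+ toℕ r) (exponent-∤ (toℕ r) (toℕ s) 0<s (r≤Q∸1 r) (r≤Q∸1 s) (r≢s ∘ Fin.toℕ-injective) (ℕ.n≢0⇒n>0 e≢0))

    monomial : ∀ {k} → Vector K.Carrier k → Vec (Fin Q) k → K.Carrier
    monomial α v = K.product (λ i → α i K.^ toℕ (lookup v i))

    -- One variable at a time: with the others fixed, the polynomial in the first variable has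
    -- vanishing coefficients, and these are polynomial functions of the others.
    coefficients-vanishᵛ : ∀ k (b : Vec (Fin Q) k → K.Carrier) →
                           (∀ α → ΣV k (λ v → b v K.* monomial α v) K.≈ K.0#) → ∀ v → b v K.≈ K.0#
    coefficients-vanishᵛ zero    b P≈0 Vec.[]      = K.trans (K.sym (K.*-identityʳ _)) (P≈0 λ ())
    coefficients-vanishᵛ (suc k) b P≈0 (r Vec.∷ v) = coefficients-vanishᵛ k (λ v → b (r Vec.∷ v)) (λ α →
      coefficients-vanish (λ r → ΣV k (λ v → b (r Vec.∷ v) K.* monomial α v)) (λ x → K.trans
        (K.sum-cong-≋ {Q} λ r → K.trans (K.*-comm _ _) (K.trans (K.sym (ΣV-* k (x K.^ toℕ r) (λ v → b (r Vec.∷ v) K.* monomial α v)))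
          (ΣV-cong k λ v → K.solve 3 (λ x b m → x K.:* (b K.:* m) K.:= b K.:* (x K.:* m)) K.refl (x K.^ toℕ r) (b (r Vec.∷ v)) (monomial α v))))
        (P≈0 (cons x α))) r) v
      where
      cons : K.Carrier → Vector K.Carrier k → Vector K.Carrier (suc k)
      cons x α Fin.zero    = x
      cons x α (Fin.suc i) = α i

-- Gauss sums

record CharacterData a ℓ₁ ℓ₂ : Set (Level.suc (a ⊔ ℓ₁ ⊔ ℓ₂)) where
  field
    K     : HeytingField a ℓ₁ ℓ₂
    p     : ℕ
    pr    : Prime p
    M     : ℕ
    0<M   : 0 < M
    order : HasOrder K (p ℕ.^ M)
    n     : ℕ
    X     : CyclotomicLift K p n
    S     : ℕ → ℕ
    S-0   : S 0 ≡ 0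
    S-suc : ∀ r → ¬ p ∣ suc r → S (suc r) ≡ suc (S r)
    S-*p  : ∀ r → S (r ℕ.* p) ≡ S r

record CodeData {a ℓ₁ ℓ₂} (K : HeytingField a ℓ₁ ℓ₂) (p M : ℕ) b ℓ₃ ℓ₄ : Set (Level.suc (a ⊔ ℓ₁ ⊔ ℓ₂ ⊔ b ⊔ ℓ₃ ⊔ ℓ₄)) where
  field
    e           : ℕ
    0<e         : 0 < e
    m           : ℕ
    M≡m*e       : M ≡ m ℕ.* e
    F           : HeytingField b ℓ₃ ℓ₄
    F-order     : HasOrder F (p ℕ.^ e)
    ι           : HeytingField.Carrier F → HeytingField.Carrier K
    ι-embedding : IsFieldEmbedding F K ι
    {h}         : ℕ
    ns          : Vec ℕ h
    ns≢0        : All NonZero ns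
    γ           : Vector (HeytingField.Carrier K) h
    γ-primitive : ∀ l → IsPrimitiveRootOfUnity K (lookup ns l) (γ l)
    {k}         : ℕ
    s           : Vector (ProductGroup ns) k

module CharacterSums {a ℓ₁ ℓ₂} (CD : CharacterData a ℓ₁ ℓ₂) where

  open CharacterData CD
  open CyclotomicLift X hiding (T)
  module K = Characteristic K pr M 0<M order
  open K using (1<p)
  private
    T = CyclotomicLift.T X
    instance p≢0 : NonZero p
             p≢0 = prime⇒nonZero pr
  open RingKit T
  open DigitSumArithmetic pr S S-0 S-suc S-*p
  module π = HomKit T (Defs.ring K) π-hom

  Q : ℕ
  Q = p ℕ.^ M

  1<Q : 1 < Q
  1<Q = K.1<p^ 0<M

  module ΣT = MultiplicativeSums K order 1<Q T τ τ-cong τ-0 τ-1 τ-* 1-τ-invertible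
  open ΣT using (ΣK; ΣK-cong)

  1-x-invertible : ∀ {x} → ¬ x K.≈ K.1# → ∃[ u ] (K.1# K.- x) K.* u K.≈ K.1#
  1-x-invertible x≉1 = K.inverse (λ e → x≉1 (K.sym (K.x-y≈0⇒x≈y e)))

  module ΣKK = MultiplicativeSums K order 1<Q (Defs.ring K) id id K.refl K.refl (λ _ _ → K.refl) 1-x-invertible

  ζ^p≈1 : ζ ^ p ≈ 1#
  ζ^p≈1 = sym (x-y≈0⇒x≈y (trans (sym (geometric ζ p)) (trans (*-congˡ ζ-sum) (zeroʳ _))))

  ζ^-% : ∀ m → ζ ^ m ≈ ζ ^ (m ℕ.% p)
  ζ^-% m = begin
    ζ ^ m                                            ≈⟨ ^-congʳ ζ (ℕ.m≡m%n+[m/n]*n m p) ⟩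
    ζ ^ (m ℕ.% p ℕ.+ m ℕ./ p ℕ.* p)                  ≈⟨ ^-homo-* ζ (m ℕ.% p) _ ⟩
    ζ ^ (m ℕ.% p) * ζ ^ (m ℕ./ p ℕ.* p)              ≈⟨ *-congˡ (trans (^-congʳ ζ (ℕ.*-comm (m ℕ./ p) p)) (sym (^-assocʳ ζ p (m ℕ./ p)))) ⟩
    ζ ^ (m ℕ.% p) * (ζ ^ p) ^ (m ℕ./ p)              ≈⟨ *-congˡ (trans (^-congˡ (m ℕ./ p) ζ^p≈1) (1^n (m ℕ./ p))) ⟩
    ζ ^ (m ℕ.% p) * 1#                               ≈⟨ *-identityʳ _ ⟩
    ζ ^ (m ℕ.% p)                                    ∎
    where open ≈-Reasoning

  ζ^-cong : ∀ {i j} → K.⌜ i ⌝ K.≈ K.⌜ j ⌝ → ζ ^ i ≈ ζ ^ j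
  ζ^-cong {i} {j} e = trans (ζ^-% i) (trans (^-congʳ ζ (K.⌜⌝-injective (ℕ.m%n<n i p) (ℕ.m%n<n j p)
    (K.trans (K.sym (K.⌜⌝-%p i)) (K.trans e (K.⌜⌝-%p j))))) (sym (ζ^-% j)))

  tr : K.Carrier → K.Carrier
  tr = K.Tr p M

  tr-+ : ∀ x y → tr (x K.+ y) K.≈ tr x K.+ tr y
  tr-+ x y = ≡.subst (λ r → K.Tr r M (x K.+ y) K.≈ K.Tr r M x K.+ K.Tr r M y) (ℕ.^-identityʳ p) (K.Tr-+ 1 M x y)

  tr-* : ∀ {z} x → z K.^ p K.≈ z → tr (z K.* x) K.≈ z K.* tr x
  tr-* {z} x z^p≈z = ≡.subst (λ r → K.Tr r M (z K.* x) K.≈ z K.* K.Tr r M x) (ℕ.^-identityʳ p) (K.Tr-* 1 M x (K.fixed-^p^ 1 z^p≈z))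

  tr-^p : ∀ x → tr (x K.^ p) K.≈ tr x
  tr-^p x = ≡.subst (λ r → K.Tr r M (x K.^ r) K.≈ K.Tr r M x) (ℕ.^-identityʳ p)
    (K.Tr-^ 1 M x (≡.cong (ℕ._^ M) (ℕ.^-identityʳ p)))

  tr-fixed : ∀ x → tr x K.^ p K.≈ tr x
  tr-fixed x = ≡.subst (λ r → K.Tr r M x K.^ r K.≈ K.Tr r M x) (ℕ.^-identityʳ p)
    (K.Tr-fixed 1 M x (≡.cong (ℕ._^ M) (ℕ.^-identityʳ p)))

  tr-cong : ∀ {x y} → x K.≈ y → tr x K.≈ tr y
  tr-cong = K.Tr-cong p M

  abstract
    trℕ : K.Carrier → ℕ
    trℕ x = toℕ (proj₁ (K.prime-field (tr-fixed x)))

    trℕ<p : ∀ x → trℕ x < p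
    trℕ<p x = Fin.toℕ<n (proj₁ (K.prime-field (tr-fixed x)))

    tr≈⌜trℕ⌝ : ∀ x → tr x K.≈ K.⌜ trℕ x ⌝
    tr≈⌜trℕ⌝ x = proj₂ (K.prime-field (tr-fixed x))

  ψ : K.Carrier → Carrier
  ψ x = ζ ^ trℕ x

  ψ-tr : ∀ {x} i → tr x K.≈ K.⌜ i ⌝ → ψ x ≈ ζ ^ i
  ψ-tr {x} i e = ζ^-cong {trℕ x} {i} (K.trans (K.sym (tr≈⌜trℕ⌝ x)) e)

  ψ-cong-tr : ∀ {x y} → tr x K.≈ tr y → ψ x ≈ ψ y
  ψ-cong-tr {x} {y} e = ψ-tr (trℕ y) (K.trans e (tr≈⌜trℕ⌝ y))

  ψ-cong : ∀ {x y} → x K.≈ y → ψ x ≈ ψ y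
  ψ-cong x≈y = ψ-cong-tr (tr-cong x≈y)

  ψ-tr-0 : ∀ {x} → tr x K.≈ K.0# → ψ x ≈ 1#
  ψ-tr-0 = ψ-tr 0

  tr-0 : tr K.0# K.≈ K.0#
  tr-0 = K.trans (tr-cong (K.sym (K.zeroˡ K.0#))) (K.trans (tr-* K.0# (K.0^n (ℕ.<⇒≤ 1<p))) (K.zeroˡ (tr K.0#)))

  ψ-0 : ψ K.0# ≈ 1#
  ψ-0 = ψ-tr-0 tr-0

  ψ-+ : ∀ x y → ψ (x K.+ y) ≈ ψ x * ψ y
  ψ-+ x y = trans (ψ-tr (trℕ x ℕ.+ trℕ y) (K.trans (tr-+ x y)
    (K.trans (K.+-cong (tr≈⌜trℕ⌝ x) (tr≈⌜trℕ⌝ y)) (K.sym (K.⌜⌝-+ (trℕ x) (trℕ y)))))) (^-homo-* ζ (trℕ x) (trℕ y))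

  ψ-^p : ∀ x → ψ (x K.^ p) ≈ ψ x
  ψ-^p x = ψ-cong-tr (tr-^p x)

  ψ-sum : ∀ {m} (f : Vector K.Carrier m) → ψ (K.sum f) ≈ product (λ i → ψ (f i))
  ψ-sum {zero}  f = ψ-0
  ψ-sum {suc m} f = trans (ψ-+ _ _) (*-congˡ (ψ-sum (f ∘ Fin.suc)))

  δ : ℕ → ℕ → Carrier
  δ i j with i ℕ.≟ j
  ... | yes _ = 1#
  ... | no  _ = 0#

  δ-≡ : ∀ {i j} → i ≡ j → δ i j ≈ 1#
  δ-≡ {i} {j} i≡j with i ℕ.≟ j
  ... | yes _   = refl
  ... | no  i≢j = contradiction i≡j i≢j

  δ-≢ : ∀ {i j} → i ≢ j → δ i j ≈ 0#
  δ-≢ {i} {j} i≢j with i ℕ.≟ j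
  ... | yes i≡j = contradiction i≡j i≢j
  ... | no  _   = refl

  δ-cong : ∀ {i j k l} → (i ≡ j → k ≡ l) → (k ≡ l → i ≡ j) → δ i j ≈ δ k l
  δ-cong {i} {j} f g with i ℕ.≟ j
  ... | yes i≡j = sym (δ-≡ (f i≡j))
  ... | no  i≢j = sym (δ-≢ (i≢j ∘ g))

  -- The fibres of tr ∘ g all have the same number of elements.
  equidistributed : ∀ {m} (g : Fin m → K.Carrier) (σ : Perm.Permutation m m) →
                    (∀ i → tr (g (σ Perm.⟨$⟩ʳ i)) K.≈ tr (g i) K.+ K.1#) → sum (λ i → ψ (g i)) ≈ 0#
  equidistributed {m} g σ tr-σ = begin
    sum (λ i → ψ (g i))                                      ≈⟨ sum-cong-≋ {m} (λ i → sym (spread i)) ⟩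
    sum (λ i → sum {p} (λ c → δ (f i) (toℕ c) * ζ ^ toℕ c))  ≈⟨ ∑-comm {m} {p} (λ i c → δ (f i) (toℕ c) * ζ ^ toℕ c) ⟩
    sum {p} (λ c → sum (λ i → δ (f i) (toℕ c) * ζ ^ toℕ c))  ≈⟨ sum-cong-≋ {p} (λ c → sym (*-distribʳ-sum {m} (ζ ^ toℕ c) (λ i → δ (f i) (toℕ c)))) ⟩
    sum {p} (λ c → N (toℕ c) * ζ ^ toℕ c)                    ≈⟨ sum-cong-≋ {p} (λ c → *-congʳ (N-const (toℕ c) (Fin.toℕ<n c))) ⟩
    sum {p} (λ c → N 0 * ζ ^ toℕ c)                          ≈⟨ sym (*-distribˡ-sum {p} (N 0) (λ c → ζ ^ toℕ c)) ⟩
    N 0 * sum {p} (λ c → ζ ^ toℕ c)                          ≈⟨ trans (*-congˡ ζ-sum) (zeroʳ (N 0)) ⟩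
    0#                                                       ∎
    where
    open ≈-Reasoning
    f : Fin m → ℕ
    f i = trℕ (g i)
    N : ℕ → Carrier
    N c = sum (λ i → δ (f i) c)
    spread : ∀ i → sum {p} (λ c → δ (f i) (toℕ c) * ζ ^ toℕ c) ≈ ψ (g i)
    spread i = trans (sum-single {p} (λ c → δ (f i) (toℕ c) * ζ ^ toℕ c) c₀
        (λ c c≢ → trans (*-congʳ (δ-≢ (λ e → c≢ (Fin.toℕ-injective (≡.trans (≡.sym e) (≡.sym (Fin.toℕ-fromℕ< (trℕ<p (g i)))))))) ) (zeroˡ _)))
      (trans (*-cong (δ-≡ (≡.sym (Fin.toℕ-fromℕ< (trℕ<p (g i))))) (^-congʳ ζ (Fin.toℕ-fromℕ< (trℕ<p (g i))))) (*-identityˡ _))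
      where
      c₀ : Fin p
      c₀ = fromℕ< (trℕ<p (g i))
    step : ∀ c → suc c < p → ∀ i → δ (f i) c ≈ δ (f (σ Perm.⟨$⟩ʳ i)) (suc c)
    step c 1+c<p i = δ-cong
      (λ fi≡c → K.⌜⌝-injective (trℕ<p _) 1+c<p (K.trans (K.sym (tr≈⌜trℕ⌝ _)) (K.trans (tr-σ i)
        (K.trans (K.+-comm _ K.1#) (K.+-congˡ (K.trans (tr≈⌜trℕ⌝ (g i)) (K.⌜⌝-cong fi≡c)))))))
      (λ fσi≡1+c → K.⌜⌝-injective (trℕ<p (g i)) (ℕ.<-trans (ℕ.n<1+n c) 1+c<p) (K.trans (K.sym (tr≈⌜trℕ⌝ (g i)))
        (K.trans (K.solve 1 (λ x → x K.:= (x K.:+ K.con (+ 1)) K.:- K.con (+ 1)) K.refl (tr (g i)))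
          (K.trans (K.+-congʳ (K.trans (K.sym (tr-σ i)) (K.trans (tr≈⌜trℕ⌝ _) (K.⌜⌝-cong fσi≡1+c))))
            (K.solve 1 (λ x → (K.con (+ 1) K.:+ x) K.:- K.con (+ 1) K.:= x) K.refl K.⌜ c ⌝)))))
    N-const : ∀ c → c < p → N c ≈ N 0
    N-const zero    _     = refl
    N-const (suc c) 1+c<p = trans (sum-permute (λ i → δ (f i) (suc c)) σ)
      (trans (sum-cong-≋ {m} (λ i → sym (step c 1+c<p i))) (N-const c (ℕ.<-trans (ℕ.n<1+n c) 1+c<p)))

  Q∸1∤ : ∀ c → 0 < c → c < Q ∸ 1 → ¬ (Q ∸ 1) ∣ c
  Q∸1∤ (suc c) _ c<Q-1 ∣c = ℕ.<⇒≱ c<Q-1 (∣⇒≤ ∣c)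

  2+[Q∸2]≡Q : suc (suc (Q ∸ 2)) ≡ Q
  2+[Q∸2]≡Q = ℕ.m+[n∸m]≡n 1<Q

  1+[Q∸2]≡Q∸1 : suc (Q ∸ 2) ≡ Q ∸ 1
  1+[Q∸2]≡Q∸1 = ≡.cong (_∸ 1) 2+[Q∸2]≡Q

  -- Only the first term of tr x = x + x^p + ⋯ contributes.
  sum-x^[Q-2]*tr : ΣKK.ΣK (λ x → x K.^ (Q ∸ 2) K.* tr x) K.≈ K.- K.1#
  sum-x^[Q-2]*tr = begin
    ΣKK.ΣK (λ x → x K.^ (Q ∸ 2) K.* tr x)
      ≈⟨ ΣKK.ΣK-cong (λ x → K.trans (K.*-distribˡ-sum {M} (x K.^ (Q ∸ 2)) (λ u → x K.^ (p ℕ.^ toℕ u)))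
           (K.sum-cong-≋ {M} λ u → K.sym (K.^-homo-* x (Q ∸ 2) (p ℕ.^ toℕ u)))) ⟩
    ΣKK.ΣK (λ x → K.sum {M} (λ u → x K.^ (Q ∸ 2 ℕ.+ p ℕ.^ toℕ u)))
      ≈⟨ K.∑-comm {Q} {M} (λ i u → K.from i K.^ (Q ∸ 2 ℕ.+ p ℕ.^ toℕ u)) ⟩
    K.sum {M} (λ u → P (toℕ u))
      ≈⟨ single M 0<M ℕ.≤-refl ⟩
    P 0
      ≈⟨ ΣKK.power-sum-∣ (ℕ.<-≤-trans (s≤s z≤n) (ℕ.m≤n+m 1 (Q ∸ 2))) (∣.∣-reflexive (≡.trans (≡.sym 1+[Q∸2]≡Q∸1) (ℕ.+-comm 1 (Q ∸ 2)))) ⟩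
    K.⌜ Q ∸ 1 ⌝
      ≈⟨ K.solve 1 (λ q → q K.:= (K.con (+ 1) K.:+ q) K.:- K.con (+ 1)) K.refl K.⌜ Q ∸ 1 ⌝ ⟩
    (K.1# K.+ K.⌜ Q ∸ 1 ⌝) K.- K.1#
      ≈⟨ K.+-congʳ (K.trans (K.⌜⌝-cong (m∸1+1≡m K.1≤Q)) K.⌜Q⌝≈0) ⟩
    K.0# K.- K.1#
      ≈⟨ K.+-identityˡ _ ⟩
    K.- K.1# ∎
    where
    open K.≈-Reasoning
    P : ℕ → K.Carrier
    P u = ΣKK.ΣK (λ x → x K.^ (Q ∸ 2 ℕ.+ p ℕ.^ u))
    P≈0 : ∀ u → 0 < u → u < M → P u K.≈ K.0#
    -- The exponent is (Q - 1) + (p^u - 1), where 0 < p^u - 1 < Q - 1.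
    P≈0 u 0<u u<M = ΣKK.power-sum-∤ (Q ∸ 2 ℕ.+ p ℕ.^ u) λ ∣s →
      Q∸1∤ (p ℕ.^ u ∸ 1) (ℕ.m<n⇒0<n∸m (K.1<p^ 0<u)) (ℕ.∸-monoˡ-< (ℕ.^-monoʳ-< p 1<p u<M) (ℕ.<⇒≤ (K.1<p^ 0<u)))
        (∣.∣m+n∣m⇒∣n (≡.subst ((Q ∸ 1) ∣_) (split u) ∣s) ∣.∣-refl)
      where
      split : ∀ u → Q ∸ 2 ℕ.+ p ℕ.^ u ≡ (Q ∸ 1) ℕ.+ (p ℕ.^ u ∸ 1)
      split u = ≡.trans (≡.cong (Q ∸ 2 ℕ.+_) (≡.sym (m∸1+1≡m (ℕ.m^n>0 p u))))
        (≡.trans (ℕ.+-suc (Q ∸ 2) (p ℕ.^ u ∸ 1)) (≡.cong (ℕ._+ (p ℕ.^ u ∸ 1)) 1+[Q∸2]≡Q∸1))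
    single : ∀ m → 0 < m → m ≤ M → K.sum {m} (λ u → P (toℕ u)) K.≈ P 0
    single (suc m) _ m<M = K.trans (K.+-congˡ (K.sum-0 {m} λ u → P≈0 (suc (toℕ u)) (s≤s z≤n) (ℕ.<-≤-trans (s≤s (Fin.toℕ<n u)) m<M))) (K.+-identityʳ _)

  private
    -- If the trace vanished identically, the sum just computed would be 0 rather than -1.
    tr≉0 : ∃[ i ] ¬ tr (K.from i) K.≈ K.0#
    tr≉0 = Fin.¬∀⟶∃¬ Q (λ i → tr (K.from i) K.≈ K.0#) (λ i → tr (K.from i) K.≟ K.0#) λ tr≈0 →
      K.-‿≉0 K.1≉0 (K.trans (K.sym sum-x^[Q-2]*tr) (K.sum-0 {Q} λ i → K.trans (K.*-congˡ (tr≈0 i)) (K.zeroʳ _)))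

  -- A nonzero trace is scaled to 1 by its inverse z. Being fixed by Frobenius along with the trace,
  -- z passes through `tr`.
  ∃-tr≈1 : ∃[ x ] tr x K.≈ K.1#
  ∃-tr≈1 = conclude tr≉0
    where
    conclude : ∃[ i ] ¬ tr (K.from i) K.≈ K.0# → ∃[ x ] tr x K.≈ K.1#
    conclude (i , y≉0) = z K.* x , K.trans (tr-* x z-fixed) (K.trans (K.*-comm z _) yz≈1)
      where
      x = K.from i
      z = proj₁ (K.inverse y≉0)
      yz≈1 : tr x K.* z K.≈ K.1#
      yz≈1 = proj₂ (K.inverse y≉0)
      z-fixed : z K.^ p K.≈ z
      z-fixed = K.*-cancelˡ y≉0 (K.trans (K.*-congʳ (K.sym (tr-fixed x))) (K.trans (K.sym (K.^-distrib-* (tr x) z p))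
        (K.trans (K.^-congˡ p yz≈1) (K.trans (K.1^n p) (K.sym yz≈1)))))

  translation : K.Carrier → Perm.Permutation Q Q
  translation z = K.permutation (K._+ z) (K._- z) K.+-congʳ K.+-congʳ
    (λ x → K.solve 2 (λ x z → x K.:- z K.:+ z K.:= x) K.refl x z)
    (λ x → K.solve 2 (λ x z → x K.:+ z K.:- z K.:= x) K.refl x z)

  Σψ≈0 : ΣK ψ ≈ 0#
  Σψ≈0 = go ∃-tr≈1
    where
    go : ∃[ x ] tr x K.≈ K.1# → ΣK ψ ≈ 0#
    go (x₁ , tr≈1) = equidistributed K.from (translation x₁) λ i →
      K.trans (tr-cong (K.from∘to _)) (K.trans (tr-+ _ x₁) (K.+-congˡ tr≈1))

  ϖ : Carrier
  ϖ = 1# - ζ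

  ε : Carrier
  ε = D pr T ζ

  ϖ^[p-1] : ϖ ^ (p ∸ 1) ≈ ⌜ p ⌝ * ε
  ϖ^[p-1] = trans ([1-x]^[p-1] pr T ζ) (trans (+-congʳ ζ-sum) (+-identityˡ _))

  -- Since `π` sends ζ to 1, the residue of ε is D(1) = -1.
  πε≉0 : ¬ π ε K.≈ K.0#
  πε≉0 e = K.-‿≉0 K.1≉0 (K.trans (K.sym (D-1 pr (Defs.ring K))) (K.trans (K.sym πε) e))
    where
    πint : ∀ i → π (int i) K.≈ K.int i
    πint (+ n)    = π.⌜⌝-homo n
    πint -[1+ n ] = K.trans (π.-‿homo _) (K.-‿cong (π.⌜⌝-homo (suc n)))
    πε : π ε K.≈ D pr (Defs.ring K) K.1#
    πε = K.trans (π.sum-homo {p} (λ i → int (D-coefficient pr i) * ζ ^ toℕ i)) (K.sum-cong-≋ {p} λ i →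
      K.trans (π.*-homo _ _) (K.*-cong (πint (D-coefficient pr i)) (K.trans (π.^-homo ζ (toℕ i)) (K.^-congˡ (toℕ i) π-ζ))))

  πΣK : ∀ f → π (ΣK f) K.≈ ΣKK.ΣK (λ x → π (f x))
  πΣK f = π.sum-homo {Q} (λ i → f (K.from i))

  πτ* : ∀ x y → π (τ x * y) K.≈ x K.* π y
  πτ* x y = K.trans (π.*-homo (τ x) y) (K.*-congʳ (π-τ x))

  -- The Gauss sum of τ^(-r), with the exponent moved to Q - 1 - r to be a natural number; it
  -- matters for 0 < r < Q - 1.
  G : ℕ → Carrier
  G r = ΣK (λ x → τ (x K.^ (Q ∸ 1 ∸ r)) * ψ x)

  summand-cong : ∀ c {x y} → x K.≈ y → τ (x K.^ c) * ψ x ≈ τ (y K.^ c) * ψ y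
  summand-cong c x≈y = *-cong (τ-cong (K.^-congˡ c x≈y)) (ψ-cong x≈y)

  -- Reindexing by x → x^p leaves `ψ` alone and multiplies the exponent by p. Modulo Q - 1 the new
  -- exponent p (Q - 1 - r) is Q - 1 - rp.
  G-*p : ∀ r → r ℕ.* p < Q ∸ 1 → G (r ℕ.* p) ≈ G r
  G-*p r rp<Q-1 = sym (trans
    (ΣT.reindex (λ x → τ (x K.^ (Q ∸ 1 ∸ r)) * ψ x) (summand-cong (Q ∸ 1 ∸ r)) (K._^ p) (K._^ (p ℕ.^ (M ∸ 1))) (K.^-congˡ p) (K.^-congˡ (p ℕ.^ (M ∸ 1)))
      (λ x → K.trans (K.^-assocʳ x (p ℕ.^ (M ∸ 1)) p) (K.trans (K.^-congʳ x (≡.trans (ℕ.*-comm (p ℕ.^ (M ∸ 1)) p) p*p^[M-1])) (K.x^Q x)))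
      (λ x → K.trans (K.^-assocʳ x p (p ℕ.^ (M ∸ 1))) (K.trans (K.^-congʳ x p*p^[M-1]) (K.x^Q x))))
    (ΣK-cong λ x → *-cong (τ-cong (K.trans (K.^-assocʳ x p (Q ∸ 1 ∸ r))
      (K.trans (K.^-congʳ x exponents) (K.^-periodic x (ℕ.m<n⇒0<n∸m rp<Q-1) (p ∸ 1))))) (ψ-^p x)))
    where
    p*p^[M-1] : p ℕ.* p ℕ.^ (M ∸ 1) ≡ Q
    p*p^[M-1] = ≡.cong (p ℕ.^_) (m∸1+1≡m 0<M)
    exponents : p ℕ.* (Q ∸ 1 ∸ r) ≡ (Q ∸ 1 ∸ r ℕ.* p) ℕ.+ (p ∸ 1) ℕ.* (Q ∸ 1)
    exponents = ℕ.+-cancelʳ-≡ (r ℕ.* p) _ _ (begin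
      p ℕ.* (Q ∸ 1 ∸ r) ℕ.+ r ℕ.* p                                  ≡⟨ ≡.cong (p ℕ.* (Q ∸ 1 ∸ r) ℕ.+_) (ℕ.*-comm r p) ⟩
      p ℕ.* (Q ∸ 1 ∸ r) ℕ.+ p ℕ.* r                                  ≡⟨ ≡.sym (ℕ.*-distribˡ-+ p (Q ∸ 1 ∸ r) r) ⟩
      p ℕ.* (Q ∸ 1 ∸ r ℕ.+ r)                                        ≡⟨ ≡.cong (p ℕ.*_) (ℕ.m∸n+n≡m (ℕ.≤-trans (ℕ.m≤m*n r p) (ℕ.<⇒≤ rp<Q-1))) ⟩
      p ℕ.* (Q ∸ 1)                                                  ≡⟨ ≡.cong (ℕ._* (Q ∸ 1)) (≡.sym (m∸1+1≡m (ℕ.<⇒≤ 1<p))) ⟩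
      (Q ∸ 1) ℕ.+ (p ∸ 1) ℕ.* (Q ∸ 1)                                ≡⟨ ≡.cong (ℕ._+ (p ∸ 1) ℕ.* (Q ∸ 1)) (≡.sym (ℕ.m∸n+n≡m (ℕ.<⇒≤ rp<Q-1))) ⟩
      (Q ∸ 1 ∸ r ℕ.* p) ℕ.+ r ℕ.* p ℕ.+ (p ∸ 1) ℕ.* (Q ∸ 1)          ≡⟨ solveℕ 3 (λ u v w → (u ⊞ v) ⊞ w ≗ (u ⊞ w) ⊞ v) ≡.refl (Q ∸ 1 ∸ r ℕ.* p) (r ℕ.* p) ((p ∸ 1) ℕ.* (Q ∸ 1)) ⟩
      (Q ∸ 1 ∸ r ℕ.* p) ℕ.+ (p ∸ 1) ℕ.* (Q ∸ 1) ℕ.+ r ℕ.* p          ∎)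
      where
      open ≡.≡-Reasoning
      open +-*-Solver using () renaming (solve to solveℕ; _:+_ to _⊞_; _:=_ to _≗_)

  -- Q - 2 is the exponent -1 modulo Q - 1. For c = Q - 1 - r the lifted values add up to the Jacobi
  -- sum of τ^(-r) and τ^(-1).
  jacobi : ℕ → K.Carrier → K.Carrier
  jacobi c x = x K.^ c K.* (K.1# K.- x) K.^ (Q ∸ 2)

  J : ℕ → Carrier
  J r = ΣK (λ x → τ (jacobi (Q ∸ 1 ∸ r) x))

  -- Put y = z - x and collect the terms with the same z, on which ψ(x) ψ(y) = ψ(z). For z ≠ 0 the
  -- inner sum scales to z^(-r-1) times the Jacobi sum.
  G*G : ∀ r → suc r < Q ∸ 1 → G r * G 1 ≈ G (suc r) * J r
  G*G r 1+r<Q-1 = begin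
    G r * G 1
      ≈⟨ sum-*-sum {Q} {Q} (λ i → τ (K.from i K.^ c) * ψ (K.from i)) (λ j → τ (K.from j K.^ (Q ∸ 1 ∸ 1)) * ψ (K.from j)) ⟩
    ΣK (λ x → ΣK (λ y → (τ (x K.^ c) * ψ x) * (τ (y K.^ (Q ∸ 1 ∸ 1)) * ψ y)))
      ≈⟨ ΣK-cong (λ x → ΣK-cong (λ y → *-congˡ {τ (x K.^ c) * ψ x} (*-congʳ {ψ y} (τ-cong (K.^-congʳ y (ℕ.∸-+-assoc Q 1 1)))))) ⟩
    ΣK (λ x → ΣK (λ y → (τ (x K.^ c) * ψ x) * (τ (y K.^ c₁) * ψ y)))
      ≈⟨ ΣK-cong (λ x → ΣT.reindex-+ (λ y → (τ (x K.^ c) * ψ x) * (τ (y K.^ c₁) * ψ y)) (λ e → *-congˡ (summand-cong c₁ e)) (K.- x)) ⟩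
    ΣK (λ x → ΣK (λ z → (τ (x K.^ c) * ψ x) * (τ ((z K.- x) K.^ c₁) * ψ (z K.- x))))
      ≈⟨ ΣK-cong (λ x → ΣK-cong (λ z → combine x z)) ⟩
    ΣK (λ x → ΣK (λ z → ψ z * τ (x K.^ c K.* (z K.- x) K.^ c₁)))
      ≈⟨ ∑-comm {Q} {Q} (λ i j → ψ (K.from j) * τ (K.from i K.^ c K.* (K.from j K.- K.from i) K.^ c₁)) ⟩
    ΣK (λ z → ΣK (λ x → ψ z * τ (x K.^ c K.* (z K.- x) K.^ c₁)))
      ≈⟨ ΣK-cong (λ z → ΣT.ΣK-* (ψ z) (λ x → τ (x K.^ c K.* (z K.- x) K.^ c₁))) ⟩
    ΣK (λ z → ψ z * I z)
      ≈⟨ ΣK-cong (λ z → trans (*-congˡ (I≈ z)) (solve 3 (λ u v w → u :* (v :* w) := v :* u :* w) refl (ψ z) (τ (z K.^ c')) (J r))) ⟩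
    ΣK (λ z → (τ (z K.^ c') * ψ z) * J r)
      ≈⟨ sym (*-distribʳ-sum {Q} (J r) (λ i → τ (K.from i K.^ c') * ψ (K.from i))) ⟩
    G (suc r) * J r ∎
    where
    open ≈-Reasoning
    c = Q ∸ 1 ∸ r
    c₁ = Q ∸ 2
    c' = Q ∸ 1 ∸ suc r
    I : K.Carrier → Carrier
    I z = ΣK (λ x → τ (x K.^ c K.* (z K.- x) K.^ c₁))
    combine : ∀ x z → (τ (x K.^ c) * ψ x) * (τ ((z K.- x) K.^ c₁) * ψ (z K.- x)) ≈ ψ z * τ (x K.^ c K.* (z K.- x) K.^ c₁)
    combine x z = trans (solve 4 (λ u v w y → (u :* v) :* (w :* y) := (v :* y) :* (u :* w)) refl _ _ _ _)
      (*-cong (trans (sym (ψ-+ x (z K.- x))) (ψ-cong (K.solve 2 (λ x z → x K.:+ (z K.:- x) K.:= z) K.refl x z))) (sym (τ-* _ _)))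
    c+c₁ : c ℕ.+ c₁ ≡ c' ℕ.+ 1 ℕ.* (Q ∸ 1)
    c+c₁ = ≡.trans (≡.cong (ℕ._+ c₁) c≡) (≡.trans (≡.sym (ℕ.+-suc c' c₁)) (≡.cong (c' ℕ.+_) (≡.trans 1+[Q∸2]≡Q∸1 (≡.sym (ℕ.*-identityˡ (Q ∸ 1))))))
      where
      c≡ : c ≡ suc c'
      c≡ = ℕ.+-∸-assoc 1 {Q ∸ 1} {suc r} (ℕ.<⇒≤ 1+r<Q-1)
    0<c' : 0 < c'
    0<c' = ℕ.m<n⇒0<n∸m 1+r<Q-1
    scaled : ∀ z x → (z K.* x) K.^ c K.* (z K.- z K.* x) K.^ c₁ K.≈ z K.^ c' K.* jacobi c x
    scaled z x = K.trans (K.*-cong (K.^-distrib-* z x c) (K.trans (K.^-congˡ c₁ (K.solve 2 (λ z x → z K.:- z K.:* x K.:= z K.:* (K.con (+ 1) K.:- x)) K.refl z x)) (K.^-distrib-* z _ c₁)))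
      (K.trans (K.solve 4 (λ u v w y → (u K.:* v) K.:* (w K.:* y) K.:= (u K.:* w) K.:* (v K.:* y)) K.refl (z K.^ c) (x K.^ c) (z K.^ c₁) ((K.1# K.- x) K.^ c₁))
        (K.*-congʳ (K.trans (K.sym (K.^-homo-* z c c₁)) (K.trans (K.^-congʳ z c+c₁) (K.^-periodic z 0<c' 1)))))
    at-0 : ∀ x → x K.^ c K.* (K.0# K.- x) K.^ c₁ K.≈ (K.- K.1#) K.^ c₁ K.* x K.^ (c ℕ.+ c₁)
    at-0 x = K.trans (K.*-congˡ (K.trans (K.^-congˡ c₁ (K.solve 1 (λ x → K.con (+ 0) K.:- x K.:= (K.:- K.con (+ 1)) K.:* x) K.refl x)) (K.^-distrib-* _ x c₁)))
      (K.trans (K.solve 3 (λ u v w → u K.:* (v K.:* w) K.:= v K.:* (u K.:* w)) K.refl (x K.^ c) _ (x K.^ c₁)) (K.*-congˡ (K.sym (K.^-homo-* x c c₁))))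
    I-cong : ∀ z {x y} → x K.≈ y → τ (x K.^ c K.* (z K.- x) K.^ c₁) ≈ τ (y K.^ c K.* (z K.- y) K.^ c₁)
    I-cong z e = τ-cong (K.*-cong (K.^-congˡ c e) (K.^-congˡ c₁ (K.+-congˡ (K.-‿cong e))))
    I≈ : ∀ z → I z ≈ τ (z K.^ c') * J r
    I≈ z with z K.≟ K.0#
    ... | no z≉0 = trans (ΣT.reindex-* (λ x → τ (x K.^ c K.* (z K.- x) K.^ c₁)) (I-cong z) z≉0)
      (trans (ΣK-cong λ x → trans (τ-cong (scaled z x)) (τ-* _ _)) (ΣT.ΣK-* (τ (z K.^ c')) (λ x → τ (jacobi c x))))
    -- At z = 0 the inner sum is, up to a factor, a power sum of exponent congruent to -r-1 and not
    -- to 0, so it vanishes. The other side vanishes because c' > 0.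
    ... | yes z≈0 = begin
      I z                                                                     ≈⟨ ΣK-cong (λ x → trans (τ-cong (K.trans (K.*-congˡ (K.^-congˡ c₁ (K.+-congʳ z≈0))) (at-0 x))) (τ-* _ _)) ⟩
      ΣK (λ x → τ ((K.- K.1#) K.^ c₁) * τ (x K.^ (c ℕ.+ c₁)))                 ≈⟨ ΣT.ΣK-* (τ ((K.- K.1#) K.^ c₁)) (λ x → τ (x K.^ (c ℕ.+ c₁))) ⟩
      τ ((K.- K.1#) K.^ c₁) * ΣK (λ x → τ (x K.^ (c ℕ.+ c₁)))                 ≈⟨ *-congˡ (ΣT.power-sum-∤ (c ℕ.+ c₁) ∤) ⟩
      τ ((K.- K.1#) K.^ c₁) * 0#                                              ≈⟨ zeroʳ _ ⟩
      0#                                                                      ≈⟨ sym (zeroˡ (J r)) ⟩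
      0# * J r                                                                ≈⟨ *-congʳ (sym (trans (τ-cong (K.trans (K.^-congˡ c' z≈0) (K.0^n 0<c'))) τ-0)) ⟩
      τ (z K.^ c') * J r                                                      ∎
      where
      ∤ : ¬ (Q ∸ 1) ∣ c ℕ.+ c₁
      ∤ ∣c+c₁ = Q∸1∤ c' 0<c' (ℕ.∸-monoʳ-< {Q ∸ 1} {suc r} {0} (s≤s z≤n) (ℕ.<⇒≤ 1+r<Q-1))
        (∣.∣m+n∣m⇒∣n (≡.subst ((Q ∸ 1) ∣_) (≡.trans c+c₁ (≡.trans (ℕ.+-comm c' (1 ℕ.* (Q ∸ 1))) (≡.cong (ℕ._+ c') (ℕ.*-identityˡ (Q ∸ 1))))) ∣c+c₁) ∣.∣-refl)

  -- A substitute for having valuation s at 1 - ζ. The ring is not a domain, so s is not claimed to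
  -- be determined by x; what gets used is the nonzero residue of the cofactor.
  HasValue : ℕ → Carrier → Set _
  HasValue s x = ∃[ u ] (x ≈ ϖ ^ s * u × ¬ π u K.≈ K.0#)

  -- This excludes the field of two elements, where no r satisfies 0 < r < Q - 1.
  module _ (2<Q : 0 < Q ∸ 2) where

    private
      Σjacobi : ℕ → K.Carrier
      Σjacobi c = ΣKK.ΣK (jacobi c)

      Q∸2<Q∸1 : Q ∸ 2 < Q ∸ 1
      Q∸2<Q∸1 = ≡.subst (Q ∸ 2 <_) 1+[Q∸2]≡Q∸1 (ℕ.n<1+n (Q ∸ 2))

      0<Q∸1 : 0 < Q ∸ 1
      0<Q∸1 = ℕ.<-trans 2<Q Q∸2<Q∸1

      power-sum-K : ∀ c → 0 < c → c < Q ∸ 1 → ΣKK.ΣK (λ x → x K.^ c) K.≈ K.0#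
      power-sum-K c 0<c c<Q-1 = ΣKK.power-sum-∤ c (Q∸1∤ c 0<c c<Q-1)

      x^[Q-1]-indicator : ∀ {x} → ¬ x K.≈ K.0# → K.1# K.- x K.^ (Q ∸ 1) K.≈ K.0#
      x^[Q-1]-indicator x≉0 = K.x≈y⇒x-y≈0 (K.sym (K.x^[Q-1] x≉0))

      1-0^ : ∀ {c} → 0 < c → K.1# K.- K.0# K.^ c K.≈ K.1#
      1-0^ 0<c = K.trans (K.+-congˡ (K.trans (K.-‿cong (K.0^n 0<c)) K.-0#≈0#)) (K.+-identityʳ K.1#)

    -- x^(Q-1) is 1 except at x = 0. So the sum is that of (1 - x)^(Q-2), which vanishes, minus its
    -- value 1 at x = 0.
    Σjacobi-last : Σjacobi (Q ∸ 1) K.≈ K.- K.1#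
    Σjacobi-last = begin
      Σjacobi (Q ∸ 1)
        ≈⟨ ΣKK.ΣK-cong (λ x → K.solve 2 (λ u v → u K.:* v K.:= v K.:+ (K.:- ((K.con (+ 1) K.:- u) K.:* v))) K.refl (x K.^ (Q ∸ 1)) (w x)) ⟩
      ΣKK.ΣK (λ x → w x K.+ (K.- ((K.1# K.- x K.^ (Q ∸ 1)) K.* w x)))
        ≈⟨ ΣKK.ΣK-+ w (λ x → K.- ((K.1# K.- x K.^ (Q ∸ 1)) K.* w x)) ⟩
      ΣKK.ΣK w K.+ ΣKK.ΣK (λ x → K.- ((K.1# K.- x K.^ (Q ∸ 1)) K.* w x))
        ≈⟨ K.+-cong (K.trans (K.sym (ΣKK.reindex-- (K._^ (Q ∸ 2)) (K.^-congˡ (Q ∸ 2)) K.1#)) (power-sum-K (Q ∸ 2) 2<Q Q∸2<Q∸1))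
             (ΣKK.ΣK-single (λ x → K.- ((K.1# K.- x K.^ (Q ∸ 1)) K.* w x)) K.0# (λ e → K.-‿cong (K.*-cong (K.+-congˡ (K.-‿cong (K.^-congˡ (Q ∸ 1) e))) (w-cong e)))
               (λ x x≉0 → K.trans (K.-‿cong (K.trans (K.*-congʳ (x^[Q-1]-indicator x≉0)) (K.zeroˡ (w x)))) K.-0#≈0#)) ⟩
      K.0# K.- (K.1# K.- K.0# K.^ (Q ∸ 1)) K.* w K.0#
        ≈⟨ K.trans (K.+-identityˡ _) (K.-‿cong (K.trans (K.*-cong (1-0^ 0<Q∸1) (K.trans (K.^-congˡ (Q ∸ 2) (K.trans (K.+-congˡ K.-0#≈0#) (K.+-identityʳ K.1#))) (K.1^n (Q ∸ 2)))) (K.*-identityˡ K.1#))) ⟩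
      K.- K.1# ∎
      where
      open K.≈-Reasoning
      w : K.Carrier → K.Carrier
      w x = (K.1# K.- x) K.^ (Q ∸ 2)
      w-cong : ∀ {x y} → x K.≈ y → w x K.≈ w y
      w-cong e = K.^-congˡ (Q ∸ 2) (K.+-congˡ (K.-‿cong e))

    -- Split 1 = x + (1 - x). The second part is x^c (1 - x)^(Q-1), whose last factor is 1 except at
    -- x = 1; its sum is a vanishing power sum minus 1.
    Σjacobi-step : ∀ c → 0 < c → c < Q ∸ 1 → Σjacobi c K.≈ Σjacobi (suc c) K.- K.1#
    Σjacobi-step c 0<c c<Q-1 = begin
      Σjacobi c
        ≈⟨ ΣKK.ΣK-cong (λ x → K.trans (split x) (K.+-congˡ (K.trans (K.*-congˡ (K.^-congʳ (K.1# K.- x) 1+[Q∸2]≡Q∸1))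
             (K.solve 2 (λ u v → u K.:* v K.:= u K.:+ (K.:- (u K.:* (K.con (+ 1) K.:- v)))) K.refl (x K.^ c) ((K.1# K.- x) K.^ (Q ∸ 1)))))) ⟩
      ΣKK.ΣK (λ x → jacobi (suc c) x K.+ (x K.^ c K.+ (K.- v x)))
        ≈⟨ ΣKK.ΣK-+ (jacobi (suc c)) (λ x → x K.^ c K.+ (K.- v x)) ⟩
      Σjacobi (suc c) K.+ ΣKK.ΣK (λ x → x K.^ c K.+ (K.- v x))
        ≈⟨ K.+-congˡ (ΣKK.ΣK-+ (K._^ c) (λ x → K.- v x)) ⟩
      Σjacobi (suc c) K.+ (ΣKK.ΣK (K._^ c) K.+ ΣKK.ΣK (λ x → K.- v x))
        ≈⟨ K.+-congˡ (K.+-cong (power-sum-K c 0<c c<Q-1) (ΣKK.ΣK-single (λ x → K.- v x) K.1# (λ e → K.-‿cong (v-cong e))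
             (λ x x≉1 → K.trans (K.-‿cong (K.trans (K.*-congˡ (x^[Q-1]-indicator (λ e → x≉1 (K.sym (K.x-y≈0⇒x≈y e))))) (K.zeroʳ (x K.^ c)))) K.-0#≈0#))) ⟩
      Σjacobi (suc c) K.+ (K.0# K.- v K.1#)
        ≈⟨ K.+-congˡ (K.trans (K.+-identityˡ _) (K.-‿cong (K.trans (K.*-cong (K.1^n c) (K.trans (K.+-congˡ (K.-‿cong (K.^-congˡ (Q ∸ 1) (K.-‿inverseʳ K.1#)))) (1-0^ 0<Q∸1))) (K.*-identityˡ K.1#)))) ⟩
      Σjacobi (suc c) K.- K.1# ∎
      where
      open K.≈-Reasoning
      v : K.Carrier → K.Carrier
      v x = x K.^ c K.* (K.1# K.- (K.1# K.- x) K.^ (Q ∸ 1))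
      v-cong : ∀ {x y} → x K.≈ y → v x K.≈ v y
      v-cong e = K.*-cong (K.^-congˡ c e) (K.+-congˡ (K.-‿cong (K.^-congˡ (Q ∸ 1) (K.+-congˡ (K.-‿cong e)))))
      split : ∀ x → jacobi c x K.≈ jacobi (suc c) x K.+ x K.^ c K.* (K.1# K.- x) K.^ suc (Q ∸ 2)
      split x = K.solve 3 (λ x u w → u K.:* w K.:= (x K.:* u) K.:* w K.:+ u K.:* ((K.con (+ 1) K.:- x) K.:* w)) K.refl x (x K.^ c) ((K.1# K.- x) K.^ (Q ∸ 2))

    -- The exponent descends from Q - 1, losing 1 from the sum at each step. The result vanishes
    -- exactly when p divides r + 1, the case that `G-value` leaves to Frobenius.
    Σjacobi≈ : ∀ r → r < Q ∸ 1 → Σjacobi (Q ∸ 1 ∸ r) K.≈ K.- K.⌜ suc r ⌝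
    Σjacobi≈ zero    _       = K.trans Σjacobi-last (K.-‿cong (K.sym K.⌜1⌝))
    Σjacobi≈ (suc r) 1+r<Q-1 = K.trans (Σjacobi-step (Q ∸ 1 ∸ suc r) (ℕ.m<n⇒0<n∸m 1+r<Q-1) (ℕ.∸-monoʳ-< {Q ∸ 1} {suc r} {0} (s≤s z≤n) (ℕ.<⇒≤ 1+r<Q-1)))
      (K.trans (K.+-congʳ (K.trans (K.reflexive (≡.cong Σjacobi (≡.sym (ℕ.+-∸-assoc 1 {Q ∸ 1} {suc r} (ℕ.<⇒≤ 1+r<Q-1))))) (Σjacobi≈ r (ℕ.<-trans (ℕ.n<1+n r) 1+r<Q-1))))
        (K.solve 1 (λ r → (K.:- r) K.:- K.con (+ 1) K.:= K.:- (K.con (+ 1) K.:+ r)) K.refl K.⌜ suc r ⌝))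

    J-inverse : ∀ r → r < Q ∸ 1 → ¬ p ∣ suc r → ∃[ u ] J r * u ≈ 1#
    J-inverse r r<Q-1 p∤1+r = τ-sum-invertible (λ i → jacobi (Q ∸ 1 ∸ r) (K.from i)) λ e →
      p∤1+r (K.⌜m⌝≈0⇒p∣m (suc r) (K.trans (K.sym (K.-‿involutive _)) (K.trans (K.-‿cong (K.trans (K.sym (Σjacobi≈ r r<Q-1)) e)) K.-0#≈0#)))

    -- ψ(x) = 1 - ϖ s(x), where s(x) has residue tr(x). The constant 1 contributes a vanishing power
    -- sum, and the cofactor of ϖ has residue 1 by `sum-x^[Q-2]*tr`.
    G-1 : HasValue 1 (G 1)
    G-1 = - U , (begin
      G 1
        ≈⟨ ΣK-cong (λ x → trans (*-cong (τ-cong (K.^-congʳ x (ℕ.∸-+-assoc Q 1 1))) (ψ≈ x))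
             (solve 3 (λ t w s → t :* (con (+ 1) :- w :* s) := t :+ :- w :* (t :* s)) refl (τ (x K.^ (Q ∸ 2))) ϖ (s x))) ⟩
      ΣK (λ x → τ (x K.^ (Q ∸ 2)) + - ϖ * (τ (x K.^ (Q ∸ 2)) * s x))
        ≈⟨ ΣT.ΣK-+ (λ x → τ (x K.^ (Q ∸ 2))) (λ x → - ϖ * (τ (x K.^ (Q ∸ 2)) * s x)) ⟩
      ΣK (λ x → τ (x K.^ (Q ∸ 2))) + ΣK (λ x → - ϖ * (τ (x K.^ (Q ∸ 2)) * s x))
        ≈⟨ +-cong (ΣT.power-sum-∤ (Q ∸ 2) (Q∸1∤ (Q ∸ 2) 2<Q Q∸2<Q∸1)) (ΣT.ΣK-* (- ϖ) (λ x → τ (x K.^ (Q ∸ 2)) * s x)) ⟩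
      0# + - ϖ * U
        ≈⟨ solve 2 (λ w u → con (+ 0) :+ (:- w) :* u := (w :* con (+ 1)) :* (:- u)) refl ϖ U ⟩
      ϖ ^ 1 * - U ∎) , λ e → K.1≉0 (K.trans (K.sym (K.-‿involutive K.1#)) (K.trans (K.-‿cong (K.sym πU)) (K.trans (K.sym (π.-‿homo U)) e)))
      where
      open ≈-Reasoning
      s : K.Carrier → Carrier
      s x = sum {trℕ x} (λ i → ζ ^ toℕ i)
      U = ΣK (λ x → τ (x K.^ (Q ∸ 2)) * s x)
      ψ≈ : ∀ x → ψ x ≈ 1# - ϖ * s x
      ψ≈ x = trans (solve 1 (λ z → z := con (+ 1) :- (con (+ 1) :- z)) refl (ψ x)) (+-congˡ (-‿cong (sym (geometric ζ (trℕ x)))))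
      πs : ∀ x → π (s x) K.≈ tr x
      πs x = K.trans (π.sum-homo {trℕ x} (λ i → ζ ^ toℕ i)) (K.trans (K.sum-cong-≋ {trℕ x} λ i →
          K.trans (π.^-homo ζ (toℕ i)) (K.trans (K.^-congˡ (toℕ i) π-ζ) (K.1^n (toℕ i))))
        (K.trans (K.sum-const (trℕ x) K.1#) (K.trans (K.*-identityʳ _) (K.sym (tr≈⌜trℕ⌝ x)))))
      πU : π U K.≈ K.- K.1#
      πU = K.trans (πΣK (λ x → τ (x K.^ (Q ∸ 2)) * s x)) (K.trans (ΣKK.ΣK-cong λ x → K.trans (πτ* (x K.^ (Q ∸ 2)) (s x)) (K.*-congˡ {x K.^ (Q ∸ 2)} (πs x))) sum-x^[Q-2]*tr)

    -- Stickelberger's congruence: if p ∣ r then Frobenius leads from r to r / p,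
    -- otherwise a Jacobi sum leads to r - 1.
    G-value : ∀ r → 0 < r → r < Q ∸ 1 → HasValue (S r) (G r)
    G-value = <-rec (λ r → 0 < r → r < Q ∸ 1 → HasValue (S r) (G r)) step
      where
      step : ∀ r → (∀ {s} → s < r → 0 < s → s < Q ∸ 1 → HasValue (S s) (G s)) → 0 < r → r < Q ∸ 1 → HasValue (S r) (G r)
      step (suc r) rec 0<r r<Q-1 with p ∣.∣? suc r
      ... | yes (divides s 1+r≡sp) = reduce s 1+r≡sp (rec (s<1+r s 1+r≡sp) (0<s s 1+r≡sp) (ℕ.<-trans (s<1+r s 1+r≡sp) r<Q-1))
        where
        0<s : ∀ s → suc r ≡ s ℕ.* p → 0 < s
        0<s zero    ()
        0<s (suc s) _ = s≤s z≤n
        s<1+r : ∀ s → suc r ≡ s ℕ.* p → s < suc r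
        s<1+r s e = ≡.subst (s <_) (≡.sym e) (ℕ.m<m*n s p {{ℕ.>-nonZero (0<s s e)}} 1<p)
        reduce : ∀ s → suc r ≡ s ℕ.* p → HasValue (S s) (G s) → HasValue (S (suc r)) (G (suc r))
        reduce s e (u , G≈ , πu≉0) = u , trans (reflexive (≡.cong G e)) (trans (G-*p s (≡.subst (_< Q ∸ 1) e r<Q-1))
          (trans G≈ (*-congʳ (^-congʳ ϖ (≡.trans (≡.sym (S-*p s)) (≡.cong S (≡.sym e))))))) , πu≉0
      step (suc zero) rec 0<r r<Q-1 | no p∤1 = ≡.subst (λ s → HasValue s (G 1)) (≡.sym (≡.trans (S-suc 0 p∤1) (≡.cong suc S-0))) G-1
      step (suc (suc r)) rec 0<r r<Q-1 | no p∤r = combine (rec (ℕ.n<1+n (suc r)) (s≤s z≤n) r'<Q-1) G-1 (J-inverse (suc r) r'<Q-1 p∤r)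
        where
        open ≈-Reasoning
        r'<Q-1 : suc r < Q ∸ 1
        r'<Q-1 = ℕ.<-trans (ℕ.n<1+n (suc r)) r<Q-1
        combine : HasValue (S (suc r)) (G (suc r)) → HasValue 1 (G 1) → ∃[ u ] J (suc r) * u ≈ 1# → HasValue (S (suc (suc r))) (G (suc (suc r)))
        combine (u , Gr≈ , πu≉0) (u₁ , G1≈ , πu₁≉0) (w , Jw≈1) = u * u₁ * w , (begin
          G (suc (suc r))                                       ≈⟨ sym (*-identityʳ _) ⟩
          G (suc (suc r)) * 1#                                  ≈⟨ *-congˡ (sym Jw≈1) ⟩
          G (suc (suc r)) * (J (suc r) * w)                     ≈⟨ sym (*-assoc _ _ w) ⟩
          G (suc (suc r)) * J (suc r) * w                       ≈⟨ *-congʳ (sym (G*G (suc r) r<Q-1)) ⟩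
          G (suc r) * G 1 * w                                   ≈⟨ *-congʳ (*-cong Gr≈ G1≈) ⟩
          (ϖ ^ S (suc r) * u) * (ϖ ^ 1 * u₁) * w                ≈⟨ solve 5 (λ z s u v w → (s :* u) :* ((z :* con (+ 1)) :* v) :* w := (z :* s) :* (u :* v :* w)) refl ϖ (ϖ ^ S (suc r)) u u₁ w ⟩
          ϖ ^ suc (S (suc r)) * (u * u₁ * w)                    ≈⟨ *-congʳ (^-congʳ ϖ (≡.sym (S-suc (suc r) p∤r))) ⟩
          ϖ ^ S (suc (suc r)) * (u * u₁ * w)                    ∎) , πuu₁w≉0
          where
          πw≉0 : ¬ π w K.≈ K.0#
          πw≉0 e = K.1≉0 (K.trans (K.sym π.1#-homo) (K.trans (π.cong (sym Jw≈1)) (K.trans (π.*-homo _ w) (K.trans (K.*-congˡ e) (K.zeroʳ _)))))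
          πuu₁w≉0 : ¬ π (u * u₁ * w) K.≈ K.0#
          πuu₁w≉0 e = K.*-≉0 (K.*-≉0 πu≉0 πu₁≉0) πw≉0 (K.trans (K.sym (K.trans (π.*-homo _ w) (K.*-congʳ (π.*-homo u u₁)))) e)

  -- The coefficients of (Q - 1) ψ in powers of τ. The two ends are special because x^0 and x^(Q-1)
  -- agree except at 0: the value at 0 makes the first Q - 1, and both together must give -1, the
  -- sum of ψ over nonzero x.
  ψ̂ : ℕ → Carrier
  ψ̂ zero    = ⌜ Q ∸ 1 ⌝
  ψ̂ (suc r) with suc r ℕ.≟ Q ∸ 1
  ... | yes _ = - ⌜ Q ⌝
  ... | no  _ = G (suc r)

  ψ̂-middle : ∀ r → suc r < Q ∸ 1 → ψ̂ (suc r) ≡ G (suc r)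
  ψ̂-middle r 1+r<Q-1 with suc r ℕ.≟ Q ∸ 1
  ... | yes 1+r≡Q-1 = contradiction 1+r≡Q-1 (ℕ.<⇒≢ 1+r<Q-1)
  ... | no  _       = ≡.refl

  ψ̂-last : ∀ r → suc r ≡ Q ∸ 1 → ψ̂ (suc r) ≡ - ⌜ Q ⌝
  ψ̂-last r 1+r≡Q-1 with suc r ℕ.≟ Q ∸ 1
  ... | yes _       = ≡.refl
  ... | no  1+r≢Q-1 = contradiction 1+r≡Q-1 1+r≢Q-1

  private
    L = Q ∸ 2

    i<Q∸1 : ∀ (i : Fin (suc L)) → toℕ i < Q ∸ 1
    i<Q∸1 i = ≡.subst (toℕ i <_) 1+[Q∸2]≡Q∸1 (Fin.toℕ<n i)

    1+i<Q∸1 : ∀ (i : Fin L) → suc (toℕ i) < Q ∸ 1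
    1+i<Q∸1 i = ≡.subst (suc (toℕ i) <_) 1+[Q∸2]≡Q∸1 (s≤s (Fin.toℕ<n i))

    module _ {x} (x≉0 : ¬ x K.≈ K.0#) where
      open ≈-Reasoning

      -- `A` is the orthogonality kernel of the powers of x / y: it is Q - 1 for y = x and 0
      -- otherwise, also at y = 0. `H` omits the term of index 0, whose coefficient in the expansion
      -- is not a Gauss sum.
      H A : K.Carrier → Carrier
      H y = sum {L} (λ i → τ (y K.^ (Q ∸ 1 ∸ suc (toℕ i)) K.* x K.^ suc (toℕ i)))
      A y = sum {suc L} (λ i → τ (y K.^ (Q ∸ 1 ∸ toℕ i) K.* x K.^ toℕ i))

      A-cong : ∀ {y z} → y K.≈ z → A y ≈ A z
      A-cong y≈z = sum-cong-≋ {suc L} λ i → τ-cong (K.*-congʳ {x K.^ toℕ i} (K.^-congˡ (Q ∸ 1 ∸ toℕ i) y≈z))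

      A-x : A x ≈ ⌜ Q ∸ 1 ⌝
      A-x = trans (sum-cong-≋ {suc L} λ i → trans (τ-cong (K.trans (K.sym (K.^-homo-* x (Q ∸ 1 ∸ toℕ i) (toℕ i)))
          (K.trans (K.^-congʳ x (ℕ.m∸n+n≡m (ℕ.<⇒≤ (i<Q∸1 i)))) (K.x^[Q-1] x≉0)))) τ-1)
        (trans (sum-const (suc L) 1#) (trans (*-identityʳ _) (⌜⌝-cong 1+[Q∸2]≡Q∸1)))

      A-≉ : ∀ y → ¬ y K.≈ x → A y ≈ 0#
      A-≉ y y≉x with y K.≟ K.0#
      ... | yes y≈0 = sum-0 {suc L} λ i → trans (τ-cong (K.trans (K.*-congʳ {x K.^ toℕ i} (K.trans (K.^-congˡ (Q ∸ 1 ∸ toℕ i) y≈0) (K.0^n (ℕ.m<n⇒0<n∸m (i<Q∸1 i))))) (K.zeroˡ (x K.^ toℕ i)))) τ-0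
      ... | no  y≉0 = trans (sum-cong-≋ {suc L} λ i → τ-cong (powers i)) (ΣT.root-of-unity-sum (suc L) g^≈1 g≉1)
        where
        y⁻¹ = proj₁ (K.inverse y≉0)
        yy⁻¹≈1 = proj₂ (K.inverse y≉0)
        g = x K.* y⁻¹
        gy≈x : g K.* y K.≈ x
        gy≈x = K.trans (K.*-assoc x y⁻¹ y) (K.trans (K.*-congˡ (K.trans (K.*-comm y⁻¹ y) yy⁻¹≈1)) (K.*-identityʳ x))
        g≉0 : ¬ g K.≈ K.0#
        g≉0 e = x≉0 (K.trans (K.sym gy≈x) (K.trans (K.*-congʳ e) (K.zeroˡ y)))
        g≉1 : ¬ g K.≈ K.1#
        g≉1 e = y≉x (K.trans (K.sym (K.*-identityˡ y)) (K.trans (K.*-congʳ (K.sym e)) gy≈x))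
        g^≈1 : g K.^ suc L K.≈ K.1#
        g^≈1 = K.trans (K.^-congʳ g 1+[Q∸2]≡Q∸1) (K.x^[Q-1] g≉0)
        powers : ∀ (i : Fin (suc L)) → y K.^ (Q ∸ 1 ∸ toℕ i) K.* x K.^ toℕ i K.≈ g K.^ toℕ i
        powers i = K.trans (K.*-congˡ (K.trans (K.^-congˡ (toℕ i) (K.sym gy≈x)) (K.^-distrib-* g y (toℕ i))))
          (K.trans (K.solve 3 (λ u v w → u K.:* (v K.:* w) K.:= v K.:* (u K.:* w)) K.refl (y K.^ (Q ∸ 1 ∸ toℕ i)) (g K.^ toℕ i) (y K.^ toℕ i))
            (K.trans (K.*-congˡ (K.trans (K.sym (K.^-homo-* y (Q ∸ 1 ∸ toℕ i) (toℕ i))) (K.trans (K.^-congʳ y (ℕ.m∸n+n≡m (ℕ.<⇒≤ (i<Q∸1 i)))) (K.x^[Q-1] y≉0)))) (K.*-identityʳ _)))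

      Σψτ[Q-1] : ΣK (λ y → ψ y * τ (y K.^ (Q ∸ 1))) ≈ - 1#
      Σψτ[Q-1] = begin
        ΣK (λ y → ψ y * τ (y K.^ (Q ∸ 1)))
          ≈⟨ ΣK-cong (λ y → solve 2 (λ u v → u :* v := u :+ :- (u :* (con (+ 1) :- v))) refl (ψ y) (τ (y K.^ (Q ∸ 1)))) ⟩
        ΣK (λ y → ψ y + - (ψ y * (1# - τ (y K.^ (Q ∸ 1)))))
          ≈⟨ ΣT.ΣK-+ ψ (λ y → - (ψ y * (1# - τ (y K.^ (Q ∸ 1))))) ⟩
        ΣK ψ + ΣK (λ y → - (ψ y * (1# - τ (y K.^ (Q ∸ 1)))))
          ≈⟨ +-cong Σψ≈0 (ΣT.ΣK-single (λ y → - (ψ y * (1# - τ (y K.^ (Q ∸ 1))))) K.0# (λ e → -‿cong (*-cong (ψ-cong e) (+-congˡ (-‿cong (τ-cong (K.^-congˡ (Q ∸ 1) e))))))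
               λ y y≉0 → trans (-‿cong (trans (*-congˡ (x≈y⇒x-y≈0 (sym (trans (τ-cong (K.x^[Q-1] y≉0)) τ-1)))) (zeroʳ (ψ y)))) -0#≈0#) ⟩
        0# - ψ K.0# * (1# - τ (K.0# K.^ (Q ∸ 1)))
          ≈⟨ +-congˡ (-‿cong (*-cong ψ-0 (+-congˡ (-‿cong (trans (τ-cong (K.0^n (ℕ.m<n⇒0<n∸m 1<Q))) τ-0))))) ⟩
        0# - 1# * (1# - 0#)
          ≈⟨ solve 0 (con (+ 0) :- con (+ 1) :* (con (+ 1) :- con (+ 0)) := :- con (+ 1)) refl ⟩
        - 1# ∎

      ΣψH : ΣK (λ y → ψ y * H y) ≈ ⌜ Q ∸ 1 ⌝ * ψ x + 1#
      ΣψH = begin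
        ΣK (λ y → ψ y * H y)
          ≈⟨ ΣK-cong (λ y → trans (solve 3 (λ u h t → u :* h := u :* (t :+ h) :+ :- (u :* t)) refl (ψ y) (H y) (τ (y K.^ (Q ∸ 1))))
               (+-congʳ (*-congˡ (+-congʳ (τ-cong (K.sym (K.*-identityʳ (y K.^ (Q ∸ 1))))))))) ⟩
        ΣK (λ y → ψ y * A y + - (ψ y * τ (y K.^ (Q ∸ 1))))
          ≈⟨ ΣT.ΣK-+ (λ y → ψ y * A y) (λ y → - (ψ y * τ (y K.^ (Q ∸ 1)))) ⟩
        ΣK (λ y → ψ y * A y) + ΣK (λ y → - (ψ y * τ (y K.^ (Q ∸ 1))))
          ≈⟨ +-cong (trans (ΣT.ΣK-single (λ y → ψ y * A y) x (λ e → *-cong (ψ-cong e) (A-cong e)) (λ y y≉x → trans (*-congˡ (A-≉ y y≉x)) (zeroʳ (ψ y)))) (trans (*-congˡ A-x) (*-comm _ _)))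
               (trans (sum-neg {Q} (λ i → ψ (K.from i) * τ (K.from i K.^ (Q ∸ 1)))) (-‿cong Σψτ[Q-1])) ⟩
        ⌜ Q ∸ 1 ⌝ * ψ x + - - 1#
          ≈⟨ +-congˡ (-‿involutive 1#) ⟩
        ⌜ Q ∸ 1 ⌝ * ψ x + 1# ∎

      middle : sum {L} (λ i → ψ̂ (suc (toℕ i)) * τ (x K.^ suc (toℕ i))) ≈ ⌜ Q ∸ 1 ⌝ * ψ x + 1#
      middle = begin
        sum {L} (λ i → ψ̂ (suc (toℕ i)) * τ (x K.^ suc (toℕ i)))
          ≈⟨ sum-cong-≋ {L} (λ i → trans (*-congʳ (reflexive (ψ̂-middle (toℕ i) (1+i<Q∸1 i)))) (*-distribʳ-sum {Q} (τ (x K.^ suc (toℕ i))) (λ j → τ (K.from j K.^ (Q ∸ 1 ∸ suc (toℕ i))) * ψ (K.from j)))) ⟩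
        sum {L} (λ i → ΣK (λ y → (τ (y K.^ (Q ∸ 1 ∸ suc (toℕ i))) * ψ y) * τ (x K.^ suc (toℕ i))))
          ≈⟨ ∑-comm {L} {Q} (λ i j → (τ (K.from j K.^ (Q ∸ 1 ∸ suc (toℕ i))) * ψ (K.from j)) * τ (x K.^ suc (toℕ i))) ⟩
        ΣK (λ y → sum {L} (λ i → (τ (y K.^ (Q ∸ 1 ∸ suc (toℕ i))) * ψ y) * τ (x K.^ suc (toℕ i))))
          ≈⟨ ΣK-cong (λ y → trans (sum-cong-≋ {L} λ i → trans (solve 3 (λ u v w → (u :* v) :* w := v :* (u :* w)) refl (τ (y K.^ (Q ∸ 1 ∸ suc (toℕ i)))) (ψ y) (τ (x K.^ suc (toℕ i))))
               (*-congˡ (sym (τ-* (y K.^ (Q ∸ 1 ∸ suc (toℕ i))) (x K.^ suc (toℕ i))))))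
               (sym (*-distribˡ-sum {L} (ψ y) (λ i → τ (y K.^ (Q ∸ 1 ∸ suc (toℕ i)) K.* x K.^ suc (toℕ i)))))) ⟩
        ΣK (λ y → ψ y * H y)
          ≈⟨ ΣψH ⟩
        ⌜ Q ∸ 1 ⌝ * ψ x + 1# ∎

  -- For x ≠ 0 the inner coefficients give (Q - 1) ψ(x) + 1, and the ends Q - 1 and -Q take the 1
  -- away. At x = 0 only the first term is left.
  fourier : ∀ x → ⌜ Q ∸ 1 ⌝ * ψ x ≈ sum {Q} (λ i → ψ̂ (toℕ i) * τ (x K.^ toℕ i))
  fourier x = sym (≡.subst (λ k → sum {k} (λ i → ψ̂ (toℕ i) * τ (x K.^ toℕ i)) ≈ ⌜ Q ∸ 1 ⌝ * ψ x) 2+[Q∸2]≡Q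
    (trans (+-cong (trans (*-congˡ τ-1) (*-identityʳ _)) (sum-snoc L (λ i → ψ̂ (suc i) * τ (x K.^ suc i)))) (cases (x K.≟ K.0#))))
    where
    open ≈-Reasoning
    cases : Dec (x K.≈ K.0#) → ⌜ Q ∸ 1 ⌝ + (sum {L} (λ i → ψ̂ (suc (toℕ i)) * τ (x K.^ suc (toℕ i))) + ψ̂ (suc L) * τ (x K.^ suc L)) ≈ ⌜ Q ∸ 1 ⌝ * ψ x
    cases (no x≉0) = begin
      ⌜ Q ∸ 1 ⌝ + (sum {L} (λ i → ψ̂ (suc (toℕ i)) * τ (x K.^ suc (toℕ i))) + ψ̂ (suc L) * τ (x K.^ suc L))
        ≈⟨ +-congˡ (+-cong (middle x≉0) (*-cong (trans (reflexive (ψ̂-last L 1+[Q∸2]≡Q∸1)) (-‿cong (⌜⌝-cong (≡.sym (m∸1+1≡m K.1≤Q)))))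
             (trans (τ-cong (K.trans (K.^-congʳ x 1+[Q∸2]≡Q∸1) (K.x^[Q-1] x≉0))) τ-1))) ⟩
      ⌜ Q ∸ 1 ⌝ + ((⌜ Q ∸ 1 ⌝ * ψ x + 1#) + - (1# + ⌜ Q ∸ 1 ⌝) * 1#)
        ≈⟨ solve 2 (λ q u → q :+ ((q :* u :+ con (+ 1)) :+ :- (con (+ 1) :+ q) :* con (+ 1)) := q :* u) refl ⌜ Q ∸ 1 ⌝ (ψ x) ⟩
      ⌜ Q ∸ 1 ⌝ * ψ x ∎
    cases (yes x≈0) = begin
      ⌜ Q ∸ 1 ⌝ + (sum {L} (λ i → ψ̂ (suc (toℕ i)) * τ (x K.^ suc (toℕ i))) + ψ̂ (suc L) * τ (x K.^ suc L))
        ≈⟨ +-congˡ (+-cong (sum-0 {L} λ i → vanish (toℕ i)) (vanish L)) ⟩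
      ⌜ Q ∸ 1 ⌝ + (0# + 0#)
        ≈⟨ solve 1 (λ q → q :+ (con (+ 0) :+ con (+ 0)) := q :* con (+ 1)) refl ⌜ Q ∸ 1 ⌝ ⟩
      ⌜ Q ∸ 1 ⌝ * 1#
        ≈⟨ *-congˡ (sym (trans (ψ-cong x≈0) ψ-0)) ⟩
      ⌜ Q ∸ 1 ⌝ * ψ x ∎
      where
      vanish : ∀ i → ψ̂ (suc i) * τ (x K.^ suc i) ≈ 0#
      vanish i = trans (*-congˡ {ψ̂ (suc i)} (trans (τ-cong (K.trans (K.^-congˡ (suc i) x≈0) (K.0^n {suc i} (s≤s z≤n)))) τ-0)) (zeroʳ _)

  π-pow≉0 : ∀ {x} k → ¬ π x K.≈ K.0# → ¬ π (x ^ k) K.≈ K.0#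
  π-pow≉0 {x} k πx≉0 e = K.^-≉0 k πx≉0 (K.trans (K.sym (π.^-homo x k)) e)

  π⌜Q-1⌝≉0 : ¬ π ⌜ Q ∸ 1 ⌝ K.≈ K.0#
  π⌜Q-1⌝≉0 e = K.-‿≉0 K.1≉0 (K.trans (K.sym (K.trans (K.solve 1 (λ q → q K.:= (K.con (+ 1) K.:+ q) K.:- K.con (+ 1)) K.refl K.⌜ Q ∸ 1 ⌝)
    (K.trans (K.+-congʳ (K.trans (K.⌜⌝-cong (m∸1+1≡m K.1≤Q)) K.⌜Q⌝≈0)) (K.+-identityˡ _)))) (K.trans (K.sym (π.⌜⌝-homo (Q ∸ 1))) e))

  ϖ^[p-1]k : ∀ k → ϖ ^ ((p ∸ 1) ℕ.* k) ≈ ⌜ p ⌝ ^ k * ε ^ k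
  ϖ^[p-1]k k = trans (sym (^-assocʳ ϖ (p ∸ 1) k)) (trans (^-congˡ k ϖ^[p-1]) (^-distrib-* ⌜ p ⌝ ε k))

  -- The factor ε^M only serves ψ̂ (Q - 1) = - p^M, where ϖ^(M(p-1)) = p^M ε^M.
  ψ̂-value : ∀ r → r ≤ Q ∸ 1 → HasValue (S r) (ε ^ M * ψ̂ r)
  ψ̂-value zero _ = ε ^ M * ⌜ Q ∸ 1 ⌝ , trans (sym (*-identityˡ _)) (*-congʳ (^-congʳ ϖ (≡.sym S-0)))
    , λ e → K.*-≉0 (π-pow≉0 M πε≉0) π⌜Q-1⌝≉0 (K.trans (K.sym (π.*-homo (ε ^ M) ⌜ Q ∸ 1 ⌝)) e)
  ψ̂-value (suc r) 1+r≤Q-1 with suc r ℕ.≟ Q ∸ 1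
  ... | yes 1+r≡Q-1 = - 1# , (begin
    ε ^ M * - ⌜ Q ⌝                              ≈⟨ *-congˡ (-‿cong (⌜⌝-^ p M)) ⟩
    ε ^ M * - (⌜ p ⌝ ^ M)                        ≈⟨ solve 2 (λ e q → e :* (:- q) := (q :* e) :* (:- con (+ 1))) refl (ε ^ M) (⌜ p ⌝ ^ M) ⟩
    (⌜ p ⌝ ^ M * ε ^ M) * - 1#                   ≈⟨ *-congʳ (sym (ϖ^[p-1]k M)) ⟩
    ϖ ^ ((p ∸ 1) ℕ.* M) * - 1#                   ≈⟨ *-congʳ (^-congʳ ϖ (≡.sym (≡.trans (≡.cong S 1+r≡Q-1) (S-p^m∸1 M)))) ⟩
    ϖ ^ S (suc r) * - 1#                         ∎)
    , λ e → K.-‿≉0 K.1≉0 (K.trans (K.sym (K.trans (π.-‿homo 1#) (K.-‿cong π.1#-homo))) e)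
    where open ≈-Reasoning
  ... | no  1+r≢Q-1 = scale′ (G-value 2<Q (suc r) (s≤s z≤n) 1+r<Q-1)
    where
    1+r<Q-1 : suc r < Q ∸ 1
    1+r<Q-1 = ℕ.≤∧≢⇒< 1+r≤Q-1 1+r≢Q-1
    2<Q : 0 < Q ∸ 2
    2<Q = ℕ.≤-trans (s≤s z≤n) (ℕ.≤-pred (≡.subst (suc (suc r) ≤_) (≡.sym 1+[Q∸2]≡Q∸1) 1+r<Q-1))
    scale′ : HasValue (S (suc r)) (G (suc r)) → HasValue (S (suc r)) (ε ^ M * G (suc r))
    scale′ (u , G≈ , πu≉0) = ε ^ M * u , trans (*-congˡ G≈) (solve 3 (λ e z u → e :* (z :* u) := z :* (e :* u)) refl (ε ^ M) (ϖ ^ S (suc r)) u)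
      , λ e → K.*-≉0 (π-pow≉0 M πε≉0) πu≉0 (K.trans (K.sym (π.*-homo (ε ^ M) u)) e)

  -- The weights of a trace code

  module TraceCodeWeights {b ℓ₃ ℓ₄} (D : CodeData K p M b ℓ₃ ℓ₄) where

    open CodeData D
    open IndexedSums T
    open ExponentVectors ns s Q (p ℕ.^ e) S
    module F = Characteristic F pr e 0<e F-order
    open RingMorphisms.IsRingMonomorphism ι-embedding using (isRingHomomorphism; injective)
    module ι = HomKit (Defs.ring F) (Defs.ring K) isRingHomomorphism

    q : ℕ
    q = p ℕ.^ e

    1<q : 1 < q
    1<q = K.1<p^ 0<e

    module ΣF = MultiplicativeSums F F-order 1<q T (τ ∘ ι)
      (τ-cong ∘ ι.cong) (trans (τ-cong ι.0#-homo) τ-0) (trans (τ-cong ι.1#-homo) τ-1)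
      (λ x y → trans (τ-cong (ι.*-homo x y)) (τ-* (ι x) (ι y)))
      (λ x≉1 → 1-τ-invertible λ e → x≉1 (injective (K.trans e (K.sym ι.1#-homo))))

    q^m≡Q : q ℕ.^ m ≡ Q
    q^m≡Q = ≡.trans (K.^^≡ e m) (≡.cong (p ℕ.^_) (≡.trans (ℕ.*-comm e m) (≡.sym M≡m*e)))

    ι-fixed : ∀ x → ι x K.^ q K.≈ ι x
    ι-fixed x = K.trans (K.sym (ι.^-homo x q)) (ι.cong (F.x^Q x))

    fixed⇒∈ι : ∀ {y} → y K.^ q K.≈ y → ∃[ x ] y K.≈ ι x
    fixed⇒∈ι {y} y^q≈y = let (i , y≈) = K.fixed-by-^ 1<q (ι ∘ F.from) (λ i j ι≈ → F.from-injective (injective ι≈)) (λ i → ι-fixed (F.from i)) y y^q≈y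
                         in F.from i , y≈

    Trq : K.Carrier → K.Carrier
    Trq = trace K q m

    abstract
      Trq∈ι : ∀ x → ∃[ y ] Trq x K.≈ ι y
      Trq∈ι x = fixed⇒∈ι (K.Tr-fixed e m x q^m≡Q)

    Trq-ι* : ∀ c x → Trq (ι c K.* x) K.≈ ι c K.* Trq x
    Trq-ι* c x = K.Tr-* e m x (ι-fixed c)

    tr-Trq : ∀ x → tr x K.≈ K.Tr p e (Trq x)
    tr-Trq x = ≡.subst (λ i → K.Tr p i x K.≈ K.Tr p e (Trq x)) (≡.sym M≡m*e) (K.Tr-tower e m x)

    Trq≈⇒tr≈ : ∀ {x y} → Trq x K.≈ Trq y → tr x K.≈ tr y
    Trq≈⇒tr≈ {x} {y} Trq≈ = K.trans (tr-Trq x) (K.trans (K.Tr-cong p e Trq≈) (K.sym (tr-Trq y)))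

    indicator : F.Carrier → Carrier
    indicator c with c F.≟ F.0#
    ... | yes _ = 1#
    ... | no  _ = 0#

    -- Orthogonality over F. The absolute trace of ι(x) y depends only on x c, where c is the trace
    -- of y to F; when c ≠ 0, a suitable translation of F raises it by 1.
    Σψ[ιa*y] : ∀ y c → Trq y K.≈ ι c → ΣF.ΣK (λ x → ψ (ι x K.* y)) ≈ indicator c * ⌜ q ⌝
    Σψ[ιa*y] y c Trqy≈ιc with c F.≟ F.0#
    ... | yes c≈0 = trans (ΣF.ΣK-cong λ x → ψ-tr-0 (K.trans (Trq≈⇒tr≈ (K.trans (Trq-ι* x y)
            (K.trans (K.*-congˡ (K.trans Trqy≈ιc (K.trans (ι.cong c≈0) ι.0#-homo))) (K.trans (K.zeroʳ (ι x)) (K.sym Trq-0))))) tr-0))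
          (trans (sum-const q 1#) (*-comm _ _))
      where
      Trq-0 : Trq K.0# K.≈ K.0#
      Trq-0 = K.trans (K.Tr-cong q m (K.sym (K.zeroˡ K.0#))) (K.trans (K.Tr-* e m K.0# (K.0^n (ℕ.<⇒≤ 1<q))) (K.zeroˡ _))
    ... | no c≉0 = trans (translate ∃-tr≈1) (sym (zeroˡ _))
      where
      translate : ∃[ x ] tr x K.≈ K.1# → ΣF.ΣK (λ x → ψ (ι x K.* y)) ≈ 0#
      translate (x₀ , tr≈1) = equidistributed (λ i → ι (F.from i) K.* y) σ λ i → K.trans (tr-cong (K.*-congʳ (ι.cong (F.from∘to _))))
          (K.trans (tr-cong (K.trans (K.*-congʳ (ι.+-homo (F.from i) x₁)) (K.distribʳ y _ _))) (K.trans (tr-+ _ _) (K.+-congˡ tr[ιx₁y]≈1)))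
        where
        c⁻¹ = proj₁ (F.inverse c≉0)
        d = proj₁ (Trq∈ι x₀)
        -- The trace of ι(x₁) y to F is then x₁ c = d, the same as that of x₀, whose absolute trace
        -- is 1.
        x₁ = d F.* c⁻¹
        σ : Perm.Permutation q q
        σ = F.permutation (F._+ x₁) (F._- x₁) F.+-congʳ F.+-congʳ
          (λ x → F.solve 2 (λ x z → x F.:- z F.:+ z F.:= x) F.refl x x₁)
          (λ x → F.solve 2 (λ x z → x F.:+ z F.:- z F.:= x) F.refl x x₁)
        x₁c≈d : x₁ F.* c F.≈ d
        x₁c≈d = F.trans (F.*-assoc d c⁻¹ c) (F.trans (F.*-congˡ (F.trans (F.*-comm c⁻¹ c) (proj₂ (F.inverse c≉0)))) (F.*-identityʳ d))
        tr[ιx₁y]≈1 : tr (ι x₁ K.* y) K.≈ K.1#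
        tr[ιx₁y]≈1 = K.trans (Trq≈⇒tr≈ (K.trans (Trq-ι* x₁ y) (K.trans (K.*-congˡ Trqy≈ιc)
          (K.trans (K.sym (ι.*-homo x₁ c)) (K.trans (ι.cong x₁c≈d) (K.sym (proj₂ (Trq∈ι x₀)))))))) tr≈1

    indicator-0 : ∀ {c} → c F.≈ F.0# → indicator c ≈ 1#
    indicator-0 {c} c≈0 with c F.≟ F.0#
    ... | yes _   = refl
    ... | no  c≉0 = contradiction c≈0 c≉0

    indicator-≉0 : ∀ {c} → ¬ c F.≈ F.0# → indicator c ≈ 0#
    indicator-≉0 {c} c≉0 with c F.≟ F.0#
    ... | yes c≈0 = contradiction c≈0 c≉0
    ... | no  _   = refl

    zeros+weight : ∀ (c : Word F ns) → ΣL (elements ns) (λ j → indicator (c j)) + ⌜ hammingWeight F F-order c ⌝ ≈ ⌜ List.length (elements ns) ⌝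
    zeros+weight c = ΣL-filter (λ j → ¬? (c j F.≟ F.0#)) (elements ns) (λ j → indicator-≉0) (λ j ¬c≉0 → indicator-0 (decidable-stable (c j F.≟ F.0#) ¬c≉0))

    χ : ProductGroup ns → Fin k → K.Carrier
    χ j i = K.product λ l → γ l K.^ (coord (s i) l ℕ.* coord j l)

    evaluate : Vector K.Carrier k → ProductGroup ns → K.Carrier
    evaluate α j = K.sum λ i → α i K.* χ j i

    open ReducedPolynomials K order 1<Q using (monomial; coefficients-vanishᵛ; r≤Q∸1)

    ψ̂ᵛ : Exponents → Carrier
    ψ̂ᵛ v = product λ i → ψ̂ (r v i)

    τ-product : ∀ {n} (f : Vector K.Carrier n) → product (λ i → τ (f i)) ≈ τ (K.product f)
    τ-product {zero}  f = sym τ-1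
    τ-product {suc n} f = trans (*-congˡ (τ-product (f ∘ Fin.suc))) (sym (τ-* _ _))

    Πχ^r : ∀ v j → K.product (λ i → χ j i K.^ r v i) K.≈ K.product (λ l → (γ l K.^ E v l) K.^ coord j l)
    Πχ^r v j = begin
      K.product (λ i → χ j i K.^ r v i)
        ≈⟨ K.product-cong {k} (λ i → K.trans (K.product-^ (λ l → γ l K.^ (coord (s i) l ℕ.* coord j l)) (r v i))
             (K.product-cong {h} λ l → K.trans (K.^-assocʳ (γ l) (coord (s i) l ℕ.* coord j l) (r v i))
               (K.trans (K.^-congʳ (γ l) (rearrange (coord (s i) l) (coord j l) (r v i))) (K.sym (K.^-assocʳ (γ l) (coord j l) (r v i ℕ.* coord (s i) l)))))) ⟩
      K.product (λ i → K.product (λ l → (γ l K.^ coord j l) K.^ (r v i ℕ.* coord (s i) l)))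
        ≈⟨ K.product-comm {k} {h} (λ i l → (γ l K.^ coord j l) K.^ (r v i ℕ.* coord (s i) l)) ⟩
      K.product (λ l → K.product (λ i → (γ l K.^ coord j l) K.^ (r v i ℕ.* coord (s i) l)))
        ≈⟨ K.product-cong {h} (λ l → K.trans (K.product-pow (γ l K.^ coord j l) (λ i → r v i ℕ.* coord (s i) l))
             (K.trans (K.^-assocʳ (γ l) (coord j l) (E v l)) (K.trans (K.^-congʳ (γ l) (ℕ.*-comm (coord j l) (E v l))) (K.sym (K.^-assocʳ (γ l) (E v l) (coord j l)))))) ⟩
      K.product (λ l → (γ l K.^ E v l) K.^ coord j l) ∎
      where
      open K.≈-Reasoning
      rearrange : ∀ x y z → x ℕ.* y ℕ.* z ≡ y ℕ.* (z ℕ.* x)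
      rearrange x y z = ≡.trans (≡.cong (ℕ._* z) (ℕ.*-comm x y)) (≡.trans (ℕ.*-assoc y x z) (≡.cong (y ℕ.*_) (ℕ.*-comm x z)))

    Y : Exponents → ProductGroup ns → K.Carrier
    Y v j = K.product (λ l → (γ l K.^ E v l) K.^ coord j l)

    -- One use of `fourier` for each of the k summands of the argument of ψ. Multiplied out, there
    -- is one term per exponent vector, and in it the dependences on α, x and j separate.
    expand : ∀ α j x → ⌜ Q ∸ 1 ⌝ ^ k * ψ (ι x K.* evaluate α j) ≈
             ΣV k (λ v → (ψ̂ᵛ v * τ (monomial α v)) * (τ (ι (x F.^ ∣ v ∣ᵛ)) * τ (Y v j)))
    expand α j x = begin
      ⌜ Q ∸ 1 ⌝ ^ k * ψ (ι x K.* evaluate α j)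
        ≈⟨ *-cong (sym (product-const k ⌜ Q ∸ 1 ⌝)) (trans (ψ-cong (K.*-distribˡ-sum {k} (ι x) (λ i → α i K.* χ j i))) (ψ-sum {k} z)) ⟩
      product {k} (λ _ → ⌜ Q ∸ 1 ⌝) * product (λ i → ψ (z i))
        ≈⟨ sym (product-* {k} (λ _ → ⌜ Q ∸ 1 ⌝) (λ i → ψ (z i))) ⟩
      product (λ i → ⌜ Q ∸ 1 ⌝ * ψ (z i))
        ≈⟨ product-cong {k} (λ i → fourier (z i)) ⟩
      product (λ i → sum {Q} (λ r → ψ̂ (toℕ r) * τ (z i K.^ toℕ r)))
        ≈⟨ product-∑ k (λ i r → ψ̂ (toℕ r) * τ (z i K.^ toℕ r)) ⟩
      ΣV k (λ v → product (λ i → ψ̂ (r v i) * τ (z i K.^ r v i)))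
        ≈⟨ ΣV-cong k (λ v → trans (product-* {k} (λ i → ψ̂ (r v i)) (λ i → τ (z i K.^ r v i)))
             (trans (*-congˡ (trans (τ-product {k} (λ i → z i K.^ r v i)) (trans (τ-cong (split v)) (trans (τ-* _ _) (*-congˡ (τ-* _ _))))))
               (sym (*-assoc _ _ _)))) ⟩
      ΣV k (λ v → (ψ̂ᵛ v * τ (monomial α v)) * (τ (ι (x F.^ ∣ v ∣ᵛ)) * τ (Y v j))) ∎
      where
      open ≈-Reasoning
      z : Fin k → K.Carrier
      z i = ι x K.* (α i K.* χ j i)
      split : ∀ v → K.product (λ i → z i K.^ r v i) K.≈ monomial α v K.* (ι (x F.^ ∣ v ∣ᵛ) K.* Y v j)
      split v = K.trans (K.product-cong {k} λ i → K.trans (K.^-distrib-* (ι x) (α i K.* χ j i) (r v i)) (K.*-congˡ (K.^-distrib-* (α i) (χ j i) (r v i))))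
        (K.trans (K.product-* {k} (λ i → ι x K.^ r v i) (λ i → α i K.^ r v i K.* χ j i K.^ r v i))
          (K.trans (K.*-cong (K.trans (K.product-pow (ι x) (r v)) (K.sym (ι.^-homo x ∣ v ∣ᵛ)))
              (K.trans (K.product-* {k} (λ i → α i K.^ r v i) (λ i → χ j i K.^ r v i)) (K.*-congˡ (Πχ^r v j))))
            (K.solve 3 (λ u a y → u K.:* (a K.:* y) K.:= a K.:* (u K.:* y)) K.refl _ _ _)))

    ∣A∣ : ℕ
    ∣A∣ = List.length (elements ns)

    A-sum : Exponents → Carrier
    A-sum v = ΣL (elements ns) (λ j → τ (Y v j))

    F-sum : Exponents → Carrier
    F-sum v = ΣF.ΣK (λ x → τ (ι (x F.^ ∣ v ∣ᵛ)))

    γ^≈1⇒nₗ∣ : ∀ l c → γ l K.^ c K.≈ K.1# → lookup ns l ∣ c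
    γ^≈1⇒nₗ∣ l = K.primitive-root-order (lookup ns l) (γ-primitive l)
      where instance _ = lookup⁺ ns≢0 l

    nₗ∣⇒γ^≈1 : ∀ l {c} → lookup ns l ∣ c → γ l K.^ c K.≈ K.1#
    nₗ∣⇒γ^≈1 l {c} (divides d c≡) = K.trans (K.^-congʳ (γ l) (≡.trans c≡ (ℕ.*-comm d (lookup ns l))))
      (K.trans (K.sym (K.^-assocʳ (γ l) (lookup ns l) d)) (K.trans (K.^-congˡ d (proj₁ (γ-primitive l))) (K.1^n d)))

    A-sum-∣ : ∀ v → (∀ l → lookup ns l ∣ E v l) → A-sum v ≈ ⌜ ∣A∣ ⌝
    A-sum-∣ v ∣E = ΣL-const (elements ns) λ j → trans (τ-cong (K.trans (K.product-cong {h} λ l → K.trans (K.^-congˡ (coord j l) (nₗ∣⇒γ^≈1 l (∣E l))) (K.1^n (coord j l))) (K.product-1 h))) τ-1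

    A-sum-∤ : ∀ v l → ¬ lookup ns l ∣ E v l → A-sum v ≈ 0#
    A-sum-∤ v l ∤E = trans (ΣL-cong (elements ns) λ j → sym (τ-product {h} (λ l → (γ l K.^ E v l) K.^ coord j l)))
      (trans (Σ-elements ns (λ l c → τ ((γ l K.^ E v l) K.^ c)))
        (product-0 (λ l → sum {lookup ns l} (λ x → τ ((γ l K.^ E v l) K.^ toℕ x))) l
          (ΣT.root-of-unity-sum (lookup ns l)
            (K.trans (K.^-assocʳ (γ l) (E v l) (lookup ns l)) (nₗ∣⇒γ^≈1 l (∣.n∣m*n (E v l))))
            (λ γ^E≈1 → ∤E (γ^≈1⇒nₗ∣ l (E v l) γ^E≈1)))))

    -- Taking p-th powers is injective on K: if n_l = d p, then already γ_l^d = 1, against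
    -- primitivity.
    p∤nₗ : ∀ l → ¬ p ∣ lookup ns l
    p∤nₗ l (divides d nₗ≡d*p) = proj₂ (γ-primitive l) d 0<d d<nₗ (begin
      γ l K.^ d                              ≈⟨ K.sym (K.x^Q _) ⟩
      (γ l K.^ d) K.^ Q                      ≈⟨ K.^-congʳ _ (≡.cong (p ℕ.^_) (≡.sym (m∸1+1≡m 0<M))) ⟩
      (γ l K.^ d) K.^ (p ℕ.* p ℕ.^ M-1)      ≈⟨ K.sym (K.^-assocʳ _ p (p ℕ.^ M-1)) ⟩
      ((γ l K.^ d) K.^ p) K.^ (p ℕ.^ M-1)    ≈⟨ K.^-congˡ (p ℕ.^ M-1) (K.trans (K.^-assocʳ (γ l) d p) (K.trans (K.^-congʳ (γ l) (≡.sym nₗ≡d*p)) (proj₁ (γ-primitive l)))) ⟩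
      K.1# K.^ (p ℕ.^ M-1)                   ≈⟨ K.1^n (p ℕ.^ M-1) ⟩
      K.1#                                   ∎)
      where
      open K.≈-Reasoning
      instance _ = lookup⁺ ns≢0 l
      M-1 = M ∸ 1
      0<d : 0 < d
      0<d = ℕ.n≢0⇒n>0 λ { ≡.refl → ℕ.≢-nonZero⁻¹ (lookup ns l) nₗ≡d*p }
      d<nₗ : d < lookup ns l
      d<nₗ = ≡.subst (d <_) (≡.sym nₗ≡d*p) (ℕ.m<m*n d p {{ℕ.>-nonZero 0<d}} K.1<p)

    -- The order of the group is the product of the n_l, none of which is divisible by p.
    π⌜∣A∣⌝≉0 : ¬ π ⌜ ∣A∣ ⌝ K.≈ K.0#
    π⌜∣A∣⌝≉0 e = K.product-≉0 (λ l → K.sum {lookup ns l} (λ _ → K.1#)) (λ l e′ →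
        p∤nₗ l (K.⌜m⌝≈0⇒p∣m (lookup ns l) (K.trans (K.sym (K.trans (K.sum-const (lookup ns l) K.1#) (K.*-identityʳ _))) e′)))
      (K.trans (K.sym (Σᴷ.Σ-elements ns (λ _ _ → K.1#))) (K.trans (Σᴷ.ΣL-const (elements ns) (λ _ → K.product-1 h)) (K.trans (K.sym (π.⌜⌝-homo ∣A∣)) e)))
      where module Σᴷ = IndexedSums (Defs.ring K)

    IsWord : Vector K.Carrier k → Word F ns → Set _
    IsWord α c = ∀ j → ι (c j) K.≈ Trq (evaluate α j)

    wt : Word F ns → ℕ
    wt = hammingWeight F F-order

    private
      B : Carrier
      B = ⌜ Q ∸ 1 ⌝ ^ k

      0Q : Fin Q
      0Q = fromℕ< (ℕ.<⇒≤ 1<Q)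

      v₀ : Exponents
      v₀ = Vec.replicate k 0Q

      r-v₀ : ∀ i → r v₀ i ≡ 0
      r-v₀ i = ≡.trans (≡.cong toℕ (Vec.lookup-replicate i 0Q)) (Fin.toℕ-fromℕ< (ℕ.<⇒≤ 1<Q))

      ∣v∣≡0⇒v≡v₀ : ∀ v → ∣ v ∣ᵛ ≡ 0 → v ≡ v₀
      ∣v∣≡0⇒v≡v₀ v ∣v∣≡0 = lookup-ext v v₀ λ i → Fin.toℕ-injective (≡.trans (Σℕ≡0⇒≡0 (r v) ∣v∣≡0 i) (≡.sym (r-v₀ i)))

      ∣v₀∣≡0 : ∣ v₀ ∣ᵛ ≡ 0
      ∣v₀∣≡0 = Σℕ-0 (r v₀) r-v₀

    full-term : Vector K.Carrier k → Exponents → Carrier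
    full-term α v = (ψ̂ᵛ v * τ (monomial α v)) * (F-sum v * A-sum v)

    Σψ-expansion : ∀ α → B * ΣL (elements ns) (λ j → ΣF.ΣK (λ x → ψ (ι x K.* evaluate α j))) ≈ ΣV k (full-term α)
    Σψ-expansion α = begin
      B * ΣL (elements ns) (λ j → ΣF.ΣK (λ x → ψ (ι x K.* evaluate α j)))
        ≈⟨ sym (ΣL-* (elements ns) B (λ j → ΣF.ΣK (λ x → ψ (ι x K.* evaluate α j)))) ⟩
      ΣL (elements ns) (λ j → B * ΣF.ΣK (λ x → ψ (ι x K.* evaluate α j)))
        ≈⟨ ΣL-cong (elements ns) (λ j → trans (sym (ΣF.ΣK-* B (λ x → ψ (ι x K.* evaluate α j)))) (ΣF.ΣK-cong (expand α j))) ⟩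
      ΣL (elements ns) (λ j → ΣF.ΣK (λ x → ΣV k (λ v → c v * (f v x * g v j))))
        ≈⟨ ΣL-cong (elements ns) (λ j → trans (∑-ΣV k (λ i v → c v * (f v (F.from i) * g v j))) (ΣV-cong k λ v →
             trans (ΣF.ΣK-* (c v) (λ x → f v x * g v j)) (*-congˡ (sym (*-distribʳ-sum {q} (g v j) (λ i → f v (F.from i))))))) ⟩
      ΣL (elements ns) (λ j → ΣV k (λ v → c v * (F-sum v * g v j)))
        ≈⟨ ΣL-ΣV (elements ns) k (λ j v → c v * (F-sum v * g v j)) ⟩
      ΣV k (λ v → ΣL (elements ns) (λ j → c v * (F-sum v * g v j)))
        ≈⟨ ΣV-cong k (λ v → trans (ΣL-* (elements ns) (c v) (λ j → F-sum v * g v j)) (*-congˡ (ΣL-* (elements ns) (F-sum v) (g v)))) ⟩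
      ΣV k (full-term α) ∎
      where
      open ≈-Reasoning
      c : Exponents → Carrier
      c v = ψ̂ᵛ v * τ (monomial α v)
      f : Exponents → F.Carrier → Carrier
      f v x = τ (ι (x F.^ ∣ v ∣ᵛ))
      g : Exponents → ProductGroup ns → Carrier
      g v j = τ (Y v j)

    coefficient : Exponents → Carrier
    coefficient v with adm? v
    ... | yes _ = ψ̂ᵛ v * (⌜ q ∸ 1 ⌝ * ⌜ ∣A∣ ⌝)
    ... | no  _ = 0#

    full-term≈coefficient : ∀ α v → v ≢ v₀ → full-term α v ≈ coefficient v * τ (monomial α v)
    full-term≈coefficient α v v≢v₀ with adm? v
    ... | yes (0<v , ∣v , ∣E) = trans (*-congˡ (*-cong (ΣF.power-sum-∣ 0<v ∣v) (A-sum-∣ v ∣E)))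
      (solve 3 (λ c t u → (c :* t) :* u := (c :* u) :* t) refl (ψ̂ᵛ v) (τ (monomial α v)) _)
    ... | no ¬adm = trans (trans (*-congˡ vanish) (zeroʳ _)) (sym (zeroˡ _))
      where
      0<v : 0 < ∣ v ∣ᵛ
      0<v = ℕ.n≢0⇒n>0 (v≢v₀ ∘ ∣v∣≡0⇒v≡v₀ v)
      vanish : F-sum v * A-sum v ≈ 0#
      vanish with (q ∸ 1) ∣.∣? ∣ v ∣ᵛ
      ... | no  ∤v = trans (*-congʳ (ΣF.power-sum-∤ ∣ v ∣ᵛ ∤v)) (zeroˡ _)
      ... | yes ∣v = let (l , ∤E) = Fin.¬∀⟶∃¬ h (λ l → lookup ns l ∣ E v l) (λ l → lookup ns l ∣.∣? E v l) (λ ∣E → ¬adm (0<v , ∣v , ∣E))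
                     in trans (*-congˡ (A-sum-∤ v l ∤E)) (zeroʳ _)

    coefficient-v₀ : coefficient v₀ ≈ 0#
    coefficient-v₀ with adm? v₀
    ... | yes (0<v , _) = contradiction ∣v₀∣≡0 (ℕ.>⇒≢ 0<v)
    ... | no  _         = refl

    -- The exponent vector 0 meets both congruences without being admissible. Up to the factor (Q -
    -- 1)^k its term is the total q |A|, which cancels against the same total in q (|A| - wt).
    full-term-v₀ : ∀ α → full-term α v₀ ≈ B * (⌜ q ⌝ * ⌜ ∣A∣ ⌝)
    full-term-v₀ α = *-cong
      (trans (*-cong (trans (product-cong {k} λ i → reflexive (≡.cong ψ̂ (r-v₀ i))) (product-const k ⌜ Q ∸ 1 ⌝))
                     (trans (τ-cong (K.trans (K.product-cong {k} λ i → K.^-congʳ (α i) (r-v₀ i)) (K.product-1 k))) τ-1)) (*-identityʳ _))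
      (*-cong (trans (ΣF.ΣK-cong λ x → trans (τ-cong (K.trans (ι.cong (F.^-congʳ x ∣v₀∣≡0)) ι.1#-homo)) τ-1) (trans (sum-const q 1#) (*-identityʳ _)))
              (A-sum-∣ v₀ λ l → ≡.subst (lookup ns l ∣_) (≡.sym (Σℕ-0 _ λ i → ≡.cong (ℕ._* coord (s i) l) (r-v₀ i))) (lookup ns l ∣.∣0)))

    weight-formula : ∀ α c → IsWord α c → - B * (⌜ q ⌝ * ⌜ wt c ⌝) ≈ ΣV k (λ v → coefficient v * τ (monomial α v))
    weight-formula α c word = begin
      - B * (⌜ q ⌝ * ⌜ wt c ⌝)
        ≈⟨ solve 4 (λ b q w z → :- b :* (q :* w) := b :* (z :* q) :+ :- (b :* (q :* (z :+ w)))) refl B ⌜ q ⌝ ⌜ wt c ⌝ Z ⟩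
      B * (Z * ⌜ q ⌝) + - (B * (⌜ q ⌝ * (Z + ⌜ wt c ⌝)))
        ≈⟨ +-cong (trans (*-congˡ (sym zeros)) (Σψ-expansion α)) (-‿cong (*-congˡ (*-congˡ (zeros+weight c)))) ⟩
      ΣV k (full-term α) + - (B * (⌜ q ⌝ * ⌜ ∣A∣ ⌝))
        ≈⟨ +-congʳ (trans (ΣV-cong k λ v → solve 2 (λ f t → f := t :+ (f :- t)) refl (full-term α v) (t v)) (ΣV-+ k t (λ v → full-term α v - t v))) ⟩
      (ΣV k t + ΣV k (λ v → full-term α v - t v)) + - (B * (⌜ q ⌝ * ⌜ ∣A∣ ⌝))
        -- Full terms and coefficient terms differ at v₀ alone.
        ≈⟨ +-congʳ (+-congˡ (trans (ΣV-single k (λ v → full-term α v - t v) v₀ (λ v v≢v₀ → x≈y⇒x-y≈0 (full-term≈coefficient α v v≢v₀)))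
             (+-cong (full-term-v₀ α) (trans (-‿cong (trans (*-congʳ coefficient-v₀) (zeroˡ _))) -0#≈0#)))) ⟩
      (ΣV k t + (B * (⌜ q ⌝ * ⌜ ∣A∣ ⌝) + 0#)) + - (B * (⌜ q ⌝ * ⌜ ∣A∣ ⌝))
        ≈⟨ solve 2 (λ s u → (s :+ (u :+ con (+ 0))) :+ :- u := s) refl (ΣV k t) _ ⟩
      ΣV k t ∎
      where
      open ≈-Reasoning
      Z = ΣL (elements ns) (λ j → indicator (c j))
      t : Exponents → Carrier
      t v = coefficient v * τ (monomial α v)
      zeros : ΣL (elements ns) (λ j → ΣF.ΣK (λ x → ψ (ι x K.* evaluate α j))) ≈ Z * ⌜ q ⌝
      zeros = trans (ΣL-cong (elements ns) λ j → trans (Σψ[ιa*y] (evaluate α j) (c j) (K.sym (word j))) (*-comm _ _))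
        (trans (ΣL-* (elements ns) ⌜ q ⌝ (λ j → indicator (c j))) (*-comm _ _))

    HasValue-product : ∀ {i} (t : Vector ℕ i) (x : Vector Carrier i) → (∀ j → HasValue (t j) (x j)) → HasValue (Defs.sum t) (product x)
    HasValue-product {zero}  t x val = 1# , sym (*-identityˡ 1#) , λ e → K.1≉0 (K.trans (K.sym π.1#-homo) e)
    HasValue-product {suc i} t x val = combine {t Fin.zero} {Defs.sum (t ∘ Fin.suc)} {x Fin.zero} {product (x ∘ Fin.suc)} (val Fin.zero) (HasValue-product (t ∘ Fin.suc) (x ∘ Fin.suc) (val ∘ Fin.suc))
      where
      combine : ∀ {t t′ y y′} → HasValue t y → HasValue t′ y′ → HasValue (t ℕ.+ t′) (y * y′)
      combine {t} {t′} (u , y≈ , πu≉0) (u′ , y′≈ , πu′≉0) = u * u′ ,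
        trans (*-cong y≈ y′≈) (trans (solve 4 (λ z u z′ u′ → (z :* u) :* (z′ :* u′) := (z :* z′) :* (u :* u′)) refl (ϖ ^ t) u (ϖ ^ t′) u′) (*-congʳ (sym (^-homo-* ϖ t t′)))) ,
        λ e → K.*-≉0 πu≉0 πu′≉0 (K.trans (K.sym (π.*-homo u u′)) e)

    p∸1∣ΣS : ∀ v → Adm v → (p ∸ 1) ∣ ΣS v
    p∸1∣ΣS v (_ , ∣v , _) = Σ-congruence (r v) (∣.∣-trans (p∸1∣p^e∸1 e) ∣v)

    -- `W` plays the part of the valuation of q wt. A precision `n` of at least `W` suffices, as
    -- only powers p^v with v ≤ W are cancelled.
    module _ (W : ℕ) (W-minimal : ∀ v → Adm v → (p ∸ 1) ℕ.* W ≤ ΣS v) (W≤n : W ≤ n) where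

      private
        instance p∸1≢0 : NonZero (p ∸ 1)
                 p∸1≢0 = ℕ.>-nonZero (ℕ.m<n⇒0<n∸m K.1<p)

        -- One factor ε^M from `ψ̂-value` for each of the k coordinates.
        ε^ : Carrier
        ε^ = (ε ^ M) ^ k

        U : Carrier
        U = ε^ * - B

        πU≉0 : ¬ π U K.≈ K.0#
        πU≉0 e′ = K.*-≉0 (π-pow≉0 k (λ e″ → π-pow≉0 M πε≉0 e″)) (λ e″ → K.-‿≉0 (λ e‴ → π-pow≉0 k π⌜Q-1⌝≉0 e‴) (K.trans (K.sym (π.-‿homo B)) e″))
          (K.trans (K.sym (π.*-homo ε^ (- B))) e′)

      N : Carrier
      N = ⌜ q ∸ 1 ⌝ * ⌜ ∣A∣ ⌝

      π-*≉0 : ∀ x y → ¬ π x K.≈ K.0# → ¬ π y K.≈ K.0# → ¬ π (x * y) K.≈ K.0#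
      π-*≉0 x y πx≉0 πy≉0 e′ = K.*-≉0 πx≉0 πy≉0 (K.trans (K.sym (π.*-homo x y)) e′)

      p∣p^ : ∀ i → 0 < i → p ∣ p ℕ.^ i
      p∣p^ (suc i) _ = ∣.m∣m*n (p ℕ.^ i)

      p∤q∸1 : ¬ p ∣ q ∸ 1
      p∤q∸1 p∣q∸1 = ℕ.<⇒≱ K.1<p (∣⇒≤ (∣.∣m+n∣m⇒∣n {p} {q ∸ 1} {1} (≡.subst (p ∣_) q≡ (p∣p^ e 0<e)) p∣q∸1))
        where
        q≡ : q ≡ q ∸ 1 ℕ.+ 1
        q≡ = ≡.trans (≡.sym (m∸1+1≡m (ℕ.<⇒≤ 1<q))) (ℕ.+-comm 1 (q ∸ 1))

      πN≉0 : ¬ π N K.≈ K.0#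
      πN≉0 = π-*≉0 ⌜ q ∸ 1 ⌝ ⌜ ∣A∣ ⌝ (λ e′ → p∤q∸1 (K.⌜m⌝≈0⇒p∣m (q ∸ 1) (K.trans (K.sym (π.⌜⌝-homo (q ∸ 1))) e′))) π⌜∣A∣⌝≉0
      -- What is left of ϖ^((p-1)w) u N once p^W is taken out, by ϖ^(p-1) = p ε. For w = W no factor
      -- p remains.
      leading-part : ℕ → Carrier → Carrier
      leading-part w u = ⌜ p ⌝ ^ (w ∸ W) * (ε ^ w * (u * N))

      leading-part-eq : ∀ w u y → W ≤ w → y ≈ ϖ ^ ((p ∸ 1) ℕ.* w) * u → y * N ≈ ⌜ p ⌝ ^ W * leading-part w u
      leading-part-eq w u y W≤w y≈ = begin
        y * N
          ≈⟨ *-congʳ (trans y≈ (*-congʳ (trans (ϖ^[p-1]k w) (*-congʳ p^w)))) ⟩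
        (((⌜ p ⌝ ^ W * ⌜ p ⌝ ^ (w ∸ W)) * ε ^ w) * u) * N
          ≈⟨ solve 5 (λ a b c u n → (((a :* b) :* c) :* u) :* n := a :* (b :* (c :* (u :* n)))) refl (⌜ p ⌝ ^ W) (⌜ p ⌝ ^ (w ∸ W)) (ε ^ w) u N ⟩
        ⌜ p ⌝ ^ W * leading-part w u ∎
        where
        open ≈-Reasoning
        p^w : ⌜ p ⌝ ^ w ≈ ⌜ p ⌝ ^ W * ⌜ p ⌝ ^ (w ∸ W)
        p^w = trans (^-congʳ ⌜ p ⌝ (≡.sym (ℕ.m+[n∸m]≡n W≤w))) (^-homo-* ⌜ p ⌝ W (w ∸ W))
      leading-part-W : ∀ u → ¬ π u K.≈ K.0# → ¬ π (leading-part W u) K.≈ K.0#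
      leading-part-W u πu≉0 = π-*≉0 (⌜ p ⌝ ^ (W ∸ W)) (ε ^ W * (u * N)) π1≉0 (π-*≉0 (ε ^ W) (u * N) (π-pow≉0 W πε≉0) (π-*≉0 u N πu≉0 πN≉0))
        where
        π1≉0 : ¬ π (⌜ p ⌝ ^ (W ∸ W)) K.≈ K.0#
        π1≉0 e′ = K.1≉0 (K.trans (K.sym π.1#-homo) (K.trans (π.cong (^-congʳ ⌜ p ⌝ (≡.sym (ℕ.n∸n≡0 W)))) e′))
      ε^*ψ̂ᵛ : ∀ v → HasValue (ΣS v) (ε^ * ψ̂ᵛ v)
      ε^*ψ̂ᵛ v = HasValue-resp (HasValue-product (λ i → S (r v i)) (λ i → ε ^ M * ψ̂ (r v i)) (λ i → ψ̂-value (r v i) (r≤Q∸1 (lookup v i))))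
        where
        HasValue-resp : HasValue (ΣS v) (product (λ i → ε ^ M * ψ̂ (r v i))) → HasValue (ΣS v) (ε^ * ψ̂ᵛ v)
        HasValue-resp (u , Π≈ , πu≉0) = u , trans (*-congʳ {ψ̂ᵛ v} (sym (product-const k (ε ^ M))))
          (trans (sym (product-* {k} (λ _ → ε ^ M) (λ i → ψ̂ (r v i)))) Π≈) , πu≉0
      -- θ is the coefficient with p^W split off. Its residue is controlled only at the minimal
      -- exponent vectors, where it must not vanish.
      Leading : Exponents → Carrier → Set _
      Leading v c = ∃[ θ ] (ε^ * c ≈ ⌜ p ⌝ ^ W * θ × (Adm v → ΣS v ≡ (p ∸ 1) ℕ.* W → ¬ π θ K.≈ K.0#))

      leading-adm : ∀ v → Adm v → (p ∸ 1) ∣ ΣS v → HasValue (ΣS v) (ε^ * ψ̂ᵛ v) → Leading v (ψ̂ᵛ v * N)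
      leading-adm v adm (divides w ΣS≡) (u , ≈u , πu≉0) = leading-part w u ,
        trans (sym (*-assoc ε^ (ψ̂ᵛ v) N)) (leading-part-eq w u (ε^ * ψ̂ᵛ v) W≤w (trans ≈u (*-congʳ {u} (^-congʳ ϖ ΣS≡′)))) ,
        λ _ ΣS≡W → ≡.subst (λ i → ¬ π (leading-part i u) K.≈ K.0#) (≡.sym (ℕ.*-cancelˡ-≡ w W (p ∸ 1) (≡.trans (≡.sym ΣS≡′) ΣS≡W))) (leading-part-W u πu≉0)
        where
        ΣS≡′ : ΣS v ≡ (p ∸ 1) ℕ.* w
        ΣS≡′ = ≡.trans ΣS≡ (ℕ.*-comm w (p ∸ 1))
        W≤w : W ≤ w
        W≤w = ℕ.*-cancelˡ-≤ (p ∸ 1) (≡.subst ((p ∸ 1) ℕ.* W ≤_) ΣS≡′ (W-minimal v adm))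
      abstract
        leading : ∀ v → Leading v (coefficient v)
        leading v with adm? v
        ... | yes adm = leading-adm v adm (p∸1∣ΣS v adm) (ε^*ψ̂ᵛ v)
        ... | no ¬adm = 0# , trans (zeroʳ ε^) (sym (zeroʳ _)) , λ adm _ → contradiction adm ¬adm
      Θ : Vector K.Carrier k → Carrier
      Θ α = ΣV k (λ v → proj₁ (leading v) * τ (monomial α v))

      U*q*wt : ∀ α c → IsWord α c → U * ⌜ q ℕ.* wt c ⌝ ≈ ⌜ p ⌝ ^ W * Θ α
      U*q*wt α c word = begin
        U * ⌜ q ℕ.* wt c ⌝
          ≈⟨ trans (*-assoc ε^ (- B) _) (*-congˡ (trans (*-congˡ (⌜⌝-* q (wt c))) (weight-formula α c word))) ⟩
        ε^ * ΣV k (λ v → coefficient v * τ (monomial α v))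
          ≈⟨ sym (ΣV-* k ε^ (λ v → coefficient v * τ (monomial α v))) ⟩
        ΣV k (λ v → ε^ * (coefficient v * τ (monomial α v)))
          ≈⟨ ΣV-cong k (λ v → trans (sym (*-assoc ε^ (coefficient v) _)) (trans (*-congʳ (proj₁ (proj₂ (leading v)))) (*-assoc (⌜ p ⌝ ^ W) _ _))) ⟩
        ΣV k (λ v → ⌜ p ⌝ ^ W * (proj₁ (leading v) * τ (monomial α v)))
          ≈⟨ ΣV-* k (⌜ p ⌝ ^ W) (λ v → proj₁ (leading v) * τ (monomial α v)) ⟩
        ⌜ p ⌝ ^ W * Θ α ∎
        where open ≈-Reasoning

      cancel-p^ : ∀ v {x y} → v ≤ n → ⌜ p ⌝ ^ v * x ≈ ⌜ p ⌝ ^ v * y → π x K.≈ π y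
      cancel-p^ v {x} {y} v≤n e′ = K.x-y≈0⇒x≈y (K.trans (K.sym (K.trans (π.+-homo x (- y)) (K.+-congˡ (π.-‿homo y))))
        (p^v*x≈0⇒π≈0 v v≤n (trans (solve 3 (λ a x y → a :* (x :- y) := a :* x :- a :* y) refl (⌜ p ⌝ ^ v) x y) (x≈y⇒x-y≈0 e′))))

      U*⌜⌝ : ∀ v z → U * ⌜ z ℕ.* p ℕ.^ v ⌝ ≈ ⌜ p ⌝ ^ v * (U * ⌜ z ⌝)
      U*⌜⌝ v z = trans (*-congˡ (trans (⌜⌝-* z (p ℕ.^ v)) (*-congˡ (⌜⌝-^ p v)))) (solve 3 (λ u z w → u :* (z :* w) := w :* (u :* z)) refl U ⌜ z ⌝ (⌜ p ⌝ ^ v))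

      -- Divisibility climbs one power at a time. If q wt = z p^v with v < W, cancelling p^v shows
      -- that U z has residue 0, as a factor p remains on the other side; since U has nonzero
      -- residue, p divides z.
      p^W∣q*wt : ∀ α c → IsWord α c → p ℕ.^ W ∣ q ℕ.* wt c
      p^W∣q*wt α c word = go W ℕ.≤-refl
        where
        go : ∀ v → v ≤ W → p ℕ.^ v ∣ q ℕ.* wt c
        go zero    _   = ∣.1∣ _
        go (suc v) v<W = step (go v (ℕ.<⇒≤ v<W))
          where
          step : p ℕ.^ v ∣ q ℕ.* wt c → p ℕ.^ suc v ∣ q ℕ.* wt c
          step (divides z eq) = ≡.subst (p ℕ.^ suc v ∣_) (≡.sym eq) (∣.*-monoˡ-∣ (p ℕ.^ v) p∣z)
            where
            πUz≈0 : π U K.* K.⌜ z ⌝ K.≈ K.0#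
            πUz≈0 = K.trans (K.sym (K.trans (π.*-homo U ⌜ z ⌝) (K.*-congˡ (π.⌜⌝-homo z))))
              (K.trans (cancel-p^ v (ℕ.≤-trans (ℕ.<⇒≤ v<W) W≤n) (trans (sym (U*⌜⌝ v z)) (trans (*-congˡ (⌜⌝-cong (≡.sym eq))) (trans (U*q*wt α c word)
                (trans (*-congʳ (trans (^-congʳ ⌜ p ⌝ (≡.trans (≡.sym (ℕ.m+[n∸m]≡n v<W)) (≡.sym (ℕ.+-suc v _)))) (^-homo-* ⌜ p ⌝ v (suc (W ∸ suc v))))) (*-assoc _ _ _))))))
                (K.trans (π.*-homo _ _) (K.trans (K.*-congʳ (K.trans (π.*-homo ⌜ p ⌝ _) (K.trans (K.*-congʳ (K.trans (π.⌜⌝-homo p) K.⌜p⌝≈0)) (K.zeroˡ _)))) (K.zeroˡ _))))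
            p∣z : p ∣ z
            p∣z = K.⌜m⌝≈0⇒p∣m z (K.*-zero πU≉0 πUz≈0)

      -- Otherwise the residue of Θ would vanish as a function of α, hence in every coefficient,
      -- including that of the minimal v. Refuting all codewords at once spares the search for a
      -- particular α.
      ¬p^[1+W]∣q*wt : ∀ v → Adm v → ΣS v ≡ (p ∸ 1) ℕ.* W → ¬ (∀ α c → IsWord α c → p ℕ.^ suc W ∣ q ℕ.* wt c)
      ¬p^[1+W]∣q*wt v adm ΣS≡ all = proj₂ (proj₂ (leading v)) adm ΣS≡ (coefficients-vanishᵛ k (λ w → π (proj₁ (leading w))) (λ α → K.trans (K.sym (πΘ α)) (πΘ≈0 α)) v)
        where
        module Σᴷ = IndexedSums (Defs.ring K)
        πΣV : ∀ i (f : Vec (Fin Q) i → Carrier) → π (ΣV i f) K.≈ Σᴷ.ΣV i (λ w → π (f w))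
        πΣV zero    f = K.refl
        πΣV (suc i) f = K.trans (π.sum-homo {Q} (λ x → ΣV i (λ w → f (x Vec.∷ w)))) (K.sum-cong-≋ {Q} λ x → πΣV i (λ w → f (x Vec.∷ w)))
        πΘ : ∀ α → π (Θ α) K.≈ Σᴷ.ΣV k (λ w → π (proj₁ (leading w)) K.* monomial α w)
        πΘ α = K.trans (πΣV k (λ w → proj₁ (leading w) * τ (monomial α w))) (Σᴷ.ΣV-cong k λ w → K.trans (π.*-homo _ _) (K.*-congˡ (π-τ _)))
        πΘ≈0 : ∀ α → π (Θ α) K.≈ K.0#
        πΘ≈0 α = vanish (all α c word)
          where
          c : Word F ns
          c j = proj₁ (Trq∈ι (evaluate α j))
          word : IsWord α c
          word j = K.sym (proj₂ (Trq∈ι (evaluate α j)))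
          vanish : p ℕ.^ suc W ∣ q ℕ.* wt c → π (Θ α) K.≈ K.0#
          vanish (divides z eq) = K.trans (cancel-p^ W W≤n (trans (sym (U*q*wt α c word))
              (trans (*-congˡ (⌜⌝-cong (≡.trans eq (≡.sym (ℕ.*-assoc z p (p ℕ.^ W)))))) (U*⌜⌝ W (z ℕ.* p)))))
            (K.trans (π.*-homo U _) (K.trans (K.*-congˡ (K.trans (π.⌜⌝-homo (z ℕ.* p)) (K.⌜p*⌝≈0 z))) (K.zeroʳ _)))

-- Digit sums in base p

module DigitSums {p} (1<p : 1 < p) where

  private
    instance
      p≢0 : NonZero p
      p≢0 = ℕ.>-nonZero (ℕ.<⇒≤ 1<p)

    Σ : Expansion p → ℕ
    Σ ds = sumₗ (List.map toℕ ds)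

    digit-injective : ∀ (c d : Fin p) m n → toℕ c ℕ.+ m ℕ.* p ≡ toℕ d ℕ.+ n ℕ.* p → toℕ c ≡ toℕ d
    digit-injective c d m n eq = ≡.trans (≡.sym (mod c m)) (≡.trans (≡.cong (ℕ._% p) eq) (mod d n))
      where
      mod : ∀ (c : Fin p) m → (toℕ c ℕ.+ m ℕ.* p) ℕ.% p ≡ toℕ c
      mod c m = ≡.trans (ℕ.[m+kn]%n≡m%n (toℕ c) m p) (ℕ.m<n⇒m%n≡m (Fin.toℕ<n c))

  -- Two expansions of the same number may differ in leading zeros.
  digitSum-unique : ∀ (cs ds : Expansion p) → fromDigits cs ≡ fromDigits ds → Σ cs ≡ Σ ds
  digitSum-unique []       []       eq = ≡.refl
  digitSum-unique []       (d ∷ ds) eq = ≡.cong₂ ℕ._+_ (≡.sym (ℕ.m+n≡0⇒m≡0 (toℕ d) (≡.sym eq)))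
    (digitSum-unique [] ds (≡.sym (ℕ.m*n≡0⇒m≡0 (fromDigits ds) p (ℕ.m+n≡0⇒n≡0 (toℕ d) (≡.sym eq)))))
  digitSum-unique (c ∷ cs) []       eq = ≡.cong₂ ℕ._+_ (ℕ.m+n≡0⇒m≡0 (toℕ c) eq)
    (digitSum-unique cs [] (ℕ.m*n≡0⇒m≡0 (fromDigits cs) p (ℕ.m+n≡0⇒n≡0 (toℕ c) eq)))
  digitSum-unique (c ∷ cs) (d ∷ ds) eq with digit-injective c d (fromDigits cs) (fromDigits ds) eq
  ... | c≡d = ≡.cong₂ ℕ._+_ c≡d (digitSum-unique cs ds (ℕ.*-cancelʳ-≡ (fromDigits cs) (fromDigits ds) p
    (ℕ.+-cancelˡ-≡ (toℕ c) _ _ (≡.trans eq (≡.cong (ℕ._+ fromDigits ds ℕ.* p) (≡.sym c≡d))))))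

  module _ .{{nonTrivial : ℕ.NonTrivial p}} where

    private
      digits : ℕ → Expansion p
      digits n = proj₁ (toDigits p {fromWitness (ℕ.nonTrivial⇒n>1 p)} n)

      fromDigits-digits : ∀ n → fromDigits (digits n) ≡ n
      fromDigits-digits n = proj₂ (toDigits p {fromWitness (ℕ.nonTrivial⇒n>1 p)} n)

    digitSum-fromDigits : ∀ ds n → fromDigits ds ≡ n → digitSum p n ≡ Σ ds
    digitSum-fromDigits ds n eq = digitSum-unique (digits n) ds (≡.trans (fromDigits-digits n) (≡.sym eq))

    digitSum-0 : digitSum p 0 ≡ 0
    digitSum-0 = digitSum-fromDigits [] 0 ≡.refl

    digitSum-*p : ∀ n → digitSum p (n ℕ.* p) ≡ digitSum p n
    digitSum-*p n = ≡.trans (digitSum-fromDigits (0′ ∷ digits n) (n ℕ.* p)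
        (≡.cong₂ (λ c m → c ℕ.+ m ℕ.* p) 0′≡0 (fromDigits-digits n)))
      (≡.cong (ℕ._+ digitSum p n) 0′≡0)
      where
      0′ : Fin p
      0′ = fromℕ< (ℕ.<⇒≤ 1<p)
      0′≡0 : toℕ 0′ ≡ 0
      0′≡0 = Fin.toℕ-fromℕ< (ℕ.<⇒≤ 1<p)

    digitSum-suc : ∀ n → ¬ p ∣ suc n → digitSum p (suc n) ≡ suc (digitSum p n)
    digitSum-suc n p∤1+n = increment (digits n) (fromDigits-digits n)
      where
      increment : ∀ ds → fromDigits ds ≡ n → digitSum p (suc n) ≡ suc (digitSum p n)
      increment [] 0≡n = ≡.trans (digitSum-fromDigits (fromℕ< 1<p ∷ []) (suc n)
          (≡.trans (≡.cong (ℕ._+ 0) (Fin.toℕ-fromℕ< 1<p)) (≡.cong suc 0≡n)))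
        (≡.trans (≡.cong (ℕ._+ 0) (Fin.toℕ-fromℕ< 1<p)) (≡.cong suc (≡.sym (digitSum-fromDigits [] n 0≡n))))
      increment (d ∷ ds) eq with suc (toℕ d) ℕ.<? p
      ... | yes 1+d<p = ≡.trans (digitSum-fromDigits (fromℕ< 1+d<p ∷ ds) (suc n)
          (≡.trans (≡.cong (ℕ._+ fromDigits ds ℕ.* p) (Fin.toℕ-fromℕ< 1+d<p)) (≡.cong suc eq)))
        (≡.trans (≡.cong (ℕ._+ Σ ds) (Fin.toℕ-fromℕ< 1+d<p)) (≡.cong suc (≡.sym (digitSum-fromDigits (d ∷ ds) n eq))))
      -- The last digit is p - 1, so p would divide the successor.
      ... | no  1+d≮p = contradiction (≡.subst (p ∣_) (≡.cong suc eq) (∣.∣m∣n⇒∣m+n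
          (∣.∣-reflexive (ℕ.≤-antisym (ℕ.≮⇒≥ 1+d≮p) (Fin.toℕ<n d))) (∣.n∣m*n (fromDigits ds)))) p∤1+n

-- The objective as a rational number

module Objective (e : ℕ) where

  private
    value : (N d : ℕ) .{{_ : NonZero d}} → ℚ.ℚ
    value N d = (+ N ℚ./ d) ℚ.- (+ e ℚ./ 1)

    -- The denominator is `suc d`, since `mkℚᵘ` takes its predecessor. In this unnormalised form the
    -- comparison with t is a cross multiplication of integers.
    valueᵘ : ℕ → ℕ → ℚᵘ.ℚᵘ
    valueᵘ N d = (ℚᵘ.mkℚᵘ (+ N) d) ℚᵘ.- (ℚᵘ.mkℚᵘ (+ e) 0)

    toℚᵘ-value : ∀ N d → ℚ.toℚᵘ (value N (suc d)) ℚᵘ.≃ valueᵘ N d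
    toℚᵘ-value N d = ℚᵘ.≃-trans (ℚ.toℚᵘ-homo-+ (+ N ℚ./ suc d) (ℚ.- (+ e ℚ./ 1)))
      (ℚᵘ.+-cong (ℚ.toℚᵘ-fromℚᵘ (ℚᵘ.mkℚᵘ (+ N) d))
        (ℚᵘ.≃-trans (ℚ.toℚᵘ-homo‿- (+ e ℚ./ 1)) (ℚᵘ.-‿cong (ℚ.toℚᵘ-fromℚᵘ (ℚᵘ.mkℚᵘ (+ e) 0)))))

    toℚᵘ-t : ∀ t → ℚ.toℚᵘ (+ t ℚ./ 1) ℚᵘ.≃ ℚᵘ.mkℚᵘ (+ t) 0
    toℚᵘ-t t = ℚ.toℚᵘ-fromℚᵘ (ℚᵘ.mkℚᵘ (+ t) 0)

    open RingKit ℤ.+-*-commutativeRing using (solve; con; _:=_; _:+_; _:*_; _:-_; :-_)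

    numerator : ∀ N d → (+ N ℤ.* + 1 ℤ.+ (ℤ.- + e) ℤ.* + suc d) ℤ.* + 1 ≡ + N ℤ.- + e ℤ.* + suc d
    numerator N d = solve 3 (λ n e d → (n :* con (+ 1) :+ (:- e) :* d) :* con (+ 1) := n :- e :* d) ≡.refl (+ N) (+ e) (+ suc d)

    target : ∀ t d → + t ℤ.* + (suc d ℕ.* 1) ≡ + (suc d ℕ.* (t ℕ.+ e)) ℤ.- + e ℤ.* + suc d
    target t d = begin
      + t ℤ.* + (suc d ℕ.* 1)                            ≡⟨ ≡.cong (λ i → + t ℤ.* + i) (ℕ.*-identityʳ (suc d)) ⟩
      + t ℤ.* + suc d                                    ≡⟨ solve 3 (λ t e d → t :* d := d :* (t :+ e) :- e :* d) ≡.refl (+ t) (+ e) (+ suc d) ⟩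
      + suc d ℤ.* (+ t ℤ.+ + e) ℤ.- + e ℤ.* + suc d      ≡⟨ ≡.cong (ℤ._- + e ℤ.* + suc d) (≡.sym (ℤ.pos-* (suc d) (t ℕ.+ e))) ⟩
      + (suc d ℕ.* (t ℕ.+ e)) ℤ.- + e ℤ.* + suc d        ∎
      where open ≡.≡-Reasoning

    back : ∀ d i → i ≡ (i ℤ.- + e ℤ.* + suc d) ℤ.+ + e ℤ.* + suc d
    back d i = solve 2 (λ i u → i := (i :- u) :+ u) ≡.refl i (+ e ℤ.* + suc d)

  value≡⇒ : ∀ N d .{{_ : NonZero d}} t → value N d ≡ + t ℚ./ 1 → N ≡ d ℕ.* (t ℕ.+ e)
  value≡⇒ N (suc d) t eq with ℚᵘ.≃-trans (ℚᵘ.≃-sym (toℚᵘ-value N d)) (ℚᵘ.≃-trans (ℚ.toℚᵘ-cong eq) (toℚᵘ-t t))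
  ... | ℚᵘ.*≡* eq′ = ℤ.+-injective (≡.trans (back d (+ N)) (≡.trans
    (≡.cong (λ i → i ℤ.+ + e ℤ.* + suc d) (≡.trans (≡.sym (numerator N d)) (≡.trans eq′ (target t d)))) (≡.sym (back d _))))

  ⇒value≡ : ∀ N d .{{_ : NonZero d}} t → N ≡ d ℕ.* (t ℕ.+ e) → value N d ≡ + t ℚ./ 1
  ⇒value≡ N (suc d) t N≡ = ℚ.toℚᵘ-injective (ℚᵘ.≃-trans (toℚᵘ-value N d) (ℚᵘ.≃-trans
    (ℚᵘ.*≡* (≡.trans (numerator N d) (≡.trans (≡.cong (λ i → + i ℤ.- + e ℤ.* + suc d) N≡) (≡.sym (target t d))))) (ℚᵘ.≃-sym (toℚᵘ-t t))))

  ≤value⇒ : ∀ N d .{{_ : NonZero d}} t → + t ℚ./ 1 ℚ.≤ value N d → d ℕ.* (t ℕ.+ e) ≤ N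
  ≤value⇒ N (suc d) t le with ℚᵘ.≤-respˡ-≃ (toℚᵘ-t t) (ℚᵘ.≤-respʳ-≃ (toℚᵘ-value N d) (ℚ.toℚᵘ-mono-≤ le))
  ... | ℚᵘ.*≤* le′ = ℤ.drop‿+≤+ (ℤ.≤-trans (ℤ.≤-reflexive (back d (+ (suc d ℕ.* (t ℕ.+ e)))))
    (ℤ.≤-trans (ℤ.+-monoˡ-≤ (+ e ℤ.* + suc d) (≡.subst₂ ℤ._≤_ (target t d) (numerator N d) le′)) (ℤ.≤-reflexive (≡.sym (back d (+ N))))))

  ⇒≤value : ∀ N d .{{_ : NonZero d}} t → d ℕ.* (t ℕ.+ e) ≤ N → + t ℚ./ 1 ℚ.≤ value N d
  ⇒≤value N (suc d) t le = ℚ.toℚᵘ-cancel-≤ (ℚᵘ.≤-respˡ-≃ (ℚᵘ.≃-sym (toℚᵘ-t t)) (ℚᵘ.≤-respʳ-≃ (ℚᵘ.≃-sym (toℚᵘ-value N d))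
    (ℚᵘ.*≤* (≡.subst₂ ℤ._≤_ (≡.sym (target t d)) (≡.sym (numerator N d)) (ℤ.+-monoˡ-≤ (ℤ.- (+ e ℤ.* + suc d)) (ℤ.+≤+ le))))))

-- The valuation of the code

any?ᵛ : ∀ {Q ℓ} k {P : Vec (Fin Q) k → Set ℓ} → (∀ v → Dec (P v)) → Dec (∃ P)
any?ᵛ zero    P? = map′ (λ p → Vec.[] , p) (λ { (Vec.[] , p) → p }) (P? Vec.[])
any?ᵛ (suc k) P? = map′ (λ { (i , v , p) → i Vec.∷ v , p }) (λ { (i Vec.∷ v , p) → i , v , p })
  (Fin.any? λ i → any?ᵛ k λ v → P? (i Vec.∷ v))

^-monoʳ-∣ : ∀ p {m n} → m ≤ n → p ℕ.^ m ∣ p ℕ.^ n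
^-monoʳ-∣ p {m} {n} m≤n = ≡.subst (λ i → p ℕ.^ m ∣ p ℕ.^ i) (ℕ.m+[n∸m]≡n m≤n)
  (≡.subst (p ℕ.^ m ∣_) (≡.sym (ℕ.^-distribˡ-+-* p m (n ∸ m))) (∣.m∣m*n (p ℕ.^ (n ∸ m))))

q∸1∣q^m∸1 : ∀ q .{{_ : NonZero q}} m → q ∸ 1 ∣ q ℕ.^ m ∸ 1
q∸1∣q^m∸1 q zero    = (q ∸ 1) ∣.∣0
q∸1∣q^m∸1 q (suc m) = ≡.subst (q ∸ 1 ∣_) split (∣.∣m∣n⇒∣m+n (∣.m∣m*n (q ℕ.^ m)) (q∸1∣q^m∸1 q m))
  where
  split : (q ∸ 1) ℕ.* q ℕ.^ m ℕ.+ (q ℕ.^ m ∸ 1) ≡ q ℕ.^ suc m ∸ 1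
  split = ≡.trans (≡.sym (ℕ.+-∸-assoc ((q ∸ 1) ℕ.* q ℕ.^ m) (ℕ.m^n>0 q m)))
    (≡.cong (_∸ 1) (≡.trans (ℕ.+-comm ((q ∸ 1) ℕ.* q ℕ.^ m) (q ℕ.^ m)) (≡.cong (ℕ._* q ℕ.^ m) (m∸1+1≡m (ℕ.>-nonZero⁻¹ q)))))

module Valuation
  {a ℓ₁ ℓ₂ b ℓ₃ ℓ₄} (K : HeytingField a ℓ₁ ℓ₂) {p} (pr : Prime p) {M} (0<M : 0 < M) (order : HasOrder K (p ℕ.^ M))
  (X : ∀ n → CyclotomicLift K p n) (D : CodeData K p M b ℓ₃ ℓ₄)
  where

  open CodeData D
  private
    instance
      p-nonTrivial : ℕ.NonTrivial p
      p-nonTrivial = prime⇒nonTrivial pr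
      p≢0 : NonZero p
      p≢0 = prime⇒nonZero pr
      p∸1≢0 : NonZero (p ∸ 1)
      p∸1≢0 = ℕ.>-nonZero (ℕ.m<n⇒0<n∸m (prime⇒1<p pr))

    module Digits = DigitSums (prime⇒1<p pr)
    open DigitSumArithmetic pr (λ i → digitSum p i) Digits.digitSum-0 Digits.digitSum-suc Digits.digitSum-*p

    q Q : ℕ
    q = p ℕ.^ e
    Q = p ℕ.^ M

    1<Q : 1 < Q
    1<Q = ℕ.<-≤-trans (prime⇒1<p pr) (≡.subst (ℕ._≤ Q) (ℕ.*-identityʳ p) (ℕ.^-monoʳ-≤ p 0<M))

    q^m≡Q : q ℕ.^ m ≡ Q
    q^m≡Q = ≡.trans (ℕ.^-*-assoc p e m) (≡.cong (p ℕ.^_) (≡.trans (ℕ.*-comm e m) (≡.sym M≡m*e)))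

    wt : Word F ns → ℕ
    wt = hammingWeight F F-order

  open ExponentVectors ns s Q q (λ i → digitSum p i)

  private
    module Obj = Objective e

    C : Word F ns → Set _
    C = TraceCode F K ι q m γ s

    Valuation : ℕ → Set _
    Valuation = IsValuation F F-order p C

    Minimum : ℕ → Set _
    Minimum t = IsMinimumOf (Admissible q m s) (objective pr e) (+ t / 1)

  Σdigits : Vector ℕ k → ℕ
  Σdigits x = Defs.sum (λ i → digitSum p (x i))

  toAdmissible : ∀ v → Adm v → Admissible q m s (r v)
  toAdmissible v (0<v , ∣v , ∣E) = (λ i → ≡.subst (λ n → r v i ≤ n ∸ 1) (≡.sym q^m≡Q) (ℕ.≤-pred (≡.subst (r v i <_) (≡.sym (m∸1+1≡m (ℕ.<⇒≤ 1<Q))) (Fin.toℕ<n (lookup v i))))) , 0<v , ∣v , ∣E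

  fromAdmissible : ∀ x → Admissible q m s x → ∃[ v ] (Adm v × ΣS v ≡ Σdigits x)
  fromAdmissible x (x≤ , 0<x , ∣x , ∣E) = v , (≡.subst (0 <_) (≡.sym (Σℕ-cong r≡x)) 0<x
      , ≡.subst (q ∸ 1 ∣_) (≡.sym (Σℕ-cong r≡x)) ∣x
      , λ l → ≡.subst (lookup ns l ∣_) (≡.sym (Σℕ-cong λ i → ≡.cong (ℕ._* coord (s i) l) (r≡x i))) (∣E l))
    , Σℕ-cong λ i → ≡.cong (λ n → digitSum p n) (r≡x i)
    where
    x<Q : ∀ i → x i < Q
    x<Q i = ≡.subst (x i <_) (m∸1+1≡m (ℕ.<⇒≤ 1<Q)) (s≤s (≡.subst (λ n → x i ≤ n ∸ 1) q^m≡Q (x≤ i)))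
    v : Exponents
    v = Vec.tabulate λ i → fromℕ< (x<Q i)
    r≡x : ∀ i → r v i ≡ x i
    r≡x i = ≡.trans (≡.cong toℕ (Vec.lookup∘tabulate (λ i → fromℕ< (x<Q i)) i)) (Fin.toℕ-fromℕ< (x<Q i))

  -- Descent on the value: each round searches the finitely many exponent vectors for an admissible
  -- one of smaller `ΣS`.
  minimal : ∀ v → Adm v → ∃[ w ] (Adm w × (∀ u → Adm u → ΣS w ≤ ΣS u))
  minimal v adm = <-rec (λ N → ∀ v → Adm v → ΣS v ≡ N → ∃[ w ] (Adm w × (∀ u → Adm u → ΣS w ≤ ΣS u))) step (ΣS v) v adm ≡.refl
    where
    step : ∀ N → (∀ {N′} → N′ < N → ∀ v → Adm v → ΣS v ≡ N′ → ∃[ w ] (Adm w × (∀ u → Adm u → ΣS w ≤ ΣS u))) →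
           ∀ v → Adm v → ΣS v ≡ N → ∃[ w ] (Adm w × (∀ u → Adm u → ΣS w ≤ ΣS u))
    step N rec v adm ΣS≡N with any?ᵛ k (λ u → adm? u ×-dec (ΣS u ℕ.<? N))
    ... | yes (u , adm-u , u<N) = rec u<N u adm-u ≡.refl
    ... | no  ∄ = v , adm , λ u adm-u → ℕ.≤-trans (ℕ.≤-reflexive ΣS≡N) (ℕ.≮⇒≥ λ u<N → ∄ (u , adm-u , u<N))

  p∸1∣ΣS : ∀ v → Adm v → (p ∸ 1) ∣ ΣS v
  p∸1∣ΣS v (_ , ∣v , _) = Σ-congruence (r v) (∣.∣-trans (p∸1∣p^e∸1 e) ∣v)

  characterData : ℕ → CharacterData a ℓ₁ ℓ₂
  characterData n = record
    { K = K ; p = p ; pr = pr ; M = M ; 0<M = 0<M ; order = order ; n = n ; X = X n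
    ; S = λ i → digitSum p i ; S-0 = Digits.digitSum-0 ; S-suc = Digits.digitSum-suc ; S-*p = Digits.digitSum-*p
    }

  -- The lift is taken at precision n = W, which covers every power of p that is cancelled.
  divisible : ∀ W → (∀ v → Adm v → (p ∸ 1) ℕ.* W ≤ ΣS v) → ∀ c → C c → p ℕ.^ W ∣ q ℕ.* wt c
  divisible W W-min c (α , word) = CharacterSums.TraceCodeWeights.p^W∣q*wt (characterData W) D
    W W-min ℕ.≤-refl α c word

  not-divisible : ∀ W → (∀ v → Adm v → (p ∸ 1) ℕ.* W ≤ ΣS v) → ∀ v → Adm v → ΣS v ≡ (p ∸ 1) ℕ.* W →
                  ¬ (∀ c → C c → p ℕ.^ suc W ∣ q ℕ.* wt c)
  not-divisible W W-min v adm ΣS≡ all = CharacterSums.TraceCodeWeights.¬p^[1+W]∣q*wt (characterData W) D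
    W W-min ℕ.≤-refl v adm ΣS≡ λ α c word → all c (α , word)

  p^e*p^ : ∀ t → q ℕ.* p ℕ.^ t ≡ p ℕ.^ (t ℕ.+ e)
  p^e*p^ t = ≡.trans (≡.sym (ℕ.^-distribˡ-+-* p e t)) (≡.cong (p ℕ.^_) (ℕ.+-comm e t))

  ∣q*wt⇒∣wt : ∀ t {n} → p ℕ.^ (t ℕ.+ e) ∣ q ℕ.* n → p ℕ.^ t ∣ n
  ∣q*wt⇒∣wt t {n} ∣qn = ∣.*-cancelˡ-∣ q {{ℕ.m^n≢0 p e}} (≡.subst (_∣ q ℕ.* n) (≡.sym (p^e*p^ t)) ∣qn)

  ∣wt⇒∣q*wt : ∀ t {n} → p ℕ.^ t ∣ n → p ℕ.^ (t ℕ.+ e) ∣ q ℕ.* n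
  ∣wt⇒∣q*wt t {n} ∣n = ≡.subst (_∣ q ℕ.* n) (p^e*p^ t) (∣.*-monoʳ-∣ q ∣n)

  module _ (v : Exponents) (adm : Adm v) (v-minimal : ∀ u → Adm u → ΣS v ≤ ΣS u) where

    private
      W : ℕ
      W = _∣_.quotient (p∸1∣ΣS v adm)

      ΣS≡ : ΣS v ≡ (p ∸ 1) ℕ.* W
      ΣS≡ = ≡.trans (_∣_.equality (p∸1∣ΣS v adm)) (ℕ.*-comm W (p ∸ 1))

      W-minimal : ∀ u → Adm u → (p ∸ 1) ℕ.* W ≤ ΣS u
      W-minimal u adm-u = ≡.subst (_≤ ΣS u) ΣS≡ (v-minimal u adm-u)

      -- As q = p^e divides q wt, W < e would make p^(W+1) divide every q wt. The subtraction
      -- defining `t₀` is therefore exact.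
      e≤W : e ≤ W
      e≤W = ℕ.≮⇒≥ λ W<e → not-divisible W W-minimal v adm ΣS≡ λ c _ → ∣.∣-trans (^-monoʳ-∣ p W<e) (∣.m∣m*n (wt c))

    t₀ : ℕ
    t₀ = W ∸ e

    private
      t₀+e≡W : t₀ ℕ.+ e ≡ W
      t₀+e≡W = ℕ.m∸n+n≡m e≤W

    ΣS≡[p-1][t₀+e] : ΣS v ≡ (p ∸ 1) ℕ.* (t₀ ℕ.+ e)
    ΣS≡[p-1][t₀+e] = ≡.trans ΣS≡ (≡.cong ((p ∸ 1) ℕ.*_) (≡.sym t₀+e≡W))

    valuation : Valuation t₀
    valuation = (λ c c∈C → ∣q*wt⇒∣wt t₀ (≡.subst (λ i → p ℕ.^ i ∣ q ℕ.* wt c) (≡.sym t₀+e≡W) (divisible W W-minimal c c∈C)))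
      , λ u p^u∣wt → ℕ.≮⇒≥ λ t₀<u → not-divisible W W-minimal v adm ΣS≡ λ c c∈C →
          ≡.subst (λ i → p ℕ.^ suc i ∣ q ℕ.* wt c) t₀+e≡W (∣wt⇒∣q*wt (suc t₀) (∣.∣-trans (^-monoʳ-∣ p t₀<u) (p^u∣wt c c∈C)))

    minimum : Minimum t₀
    minimum = (r v , toAdmissible v adm , Obj.⇒value≡ (ΣS v) (p ∸ 1) t₀ ΣS≡[p-1][t₀+e])
      , λ x x-adm → Obj.⇒≤value (Σdigits x) (p ∸ 1) t₀ (below (fromAdmissible x x-adm))
      where
      below : ∀ {N} → ∃[ u ] (Adm u × ΣS u ≡ N) → (p ∸ 1) ℕ.* (t₀ ℕ.+ e) ≤ N
      below (u , adm-u , ΣS≡N) = ≡.subst₂ _≤_ ΣS≡[p-1][t₀+e] ΣS≡N (v-minimal u adm-u)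

    valuation-unique : ∀ t → Valuation t → t ≡ t₀
    valuation-unique t (p^t∣ , t-greatest) = ℕ.≤-antisym (proj₂ valuation t p^t∣) (t-greatest t₀ (proj₁ valuation))

    minimum-unique : ∀ t → Minimum t → t ≡ t₀
    minimum-unique t ((x , x-adm , x≡t) , t-least) = ℕ.≤-antisym
      (cancel (≡.subst ((p ∸ 1) ℕ.* (t ℕ.+ e) ≤_) ΣS≡[p-1][t₀+e] (Obj.≤value⇒ (ΣS v) (p ∸ 1) t (t-least (r v) (toAdmissible v adm)))))
      (cancel (≡.subst ((p ∸ 1) ℕ.* (t₀ ℕ.+ e) ≤_) (Obj.value≡⇒ (Σdigits x) (p ∸ 1) t x≡t) (Obj.≤value⇒ (Σdigits x) (p ∸ 1) t₀ (proj₂ minimum x x-adm))))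
      where
      cancel : ∀ {i j} → (p ∸ 1) ℕ.* (i ℕ.+ e) ≤ (p ∸ 1) ℕ.* (j ℕ.+ e) → i ≤ j
      cancel {i} {j} le = ℕ.+-cancelʳ-≤ e i j (ℕ.*-cancelˡ-≤ (p ∸ 1) le)

  -- Without admissible vectors the minimality condition is void, so `divisible` applies to every
  -- `W` and no exponent is greatest. This happens for k = 0, where all weights are 0.
  valuation⇒Adm : ∀ t → Valuation t → ¬ ¬ ∃ Adm
  valuation⇒Adm t (_ , greatest) ∄adm = ℕ.<⇒≱ (ℕ.n<1+n t) (greatest (suc t) λ c c∈C → ∣q*wt⇒∣wt (suc t)
    (divisible (suc t ℕ.+ e) (λ v adm → contradiction (v , adm) ∄adm) c c∈C))

  minimum⇒Adm : ∀ t → Minimum t → ∃ Adm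
  minimum⇒Adm t ((x , x-adm , _) , _) = let (v , adm , _) = fromAdmissible x x-adm in v , adm

  -- Each side determines t, and both hold at `t₀`. So it is enough that each side yields an
  -- admissible vector from which the descent can start; on the left, the search removes a double
  -- negation.
  valuation⇔minimum : ∀ t → Valuation t ⇔ Minimum t
  valuation⇔minimum t = mk⇔
    (λ val → let (u , adm-u) = decidable-stable (any?ᵛ k adm?) (valuation⇒Adm t val) ; (v , adm , v-minimal) = minimal u adm-u
             in ≡.subst Minimum (≡.sym (valuation-unique v adm v-minimal t val)) (minimum v adm v-minimal))
    (λ min → let (u , adm-u) = minimum⇒Adm t min ; (v , adm , v-minimal) = minimal u adm-u
             in ≡.subst Valuation (≡.sym (minimum-unique v adm v-minimal t min)) (valuation v adm v-minimal))

  nₗ∣Q∸1 : ∀ l → lookup ns l ∣ Q ∸ 1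
  nₗ∣Q∸1 l = K′.primitive-root-order (lookup ns l) (γ-primitive l) (Q ∸ 1) (K′.x^[Q-1] γ≉0)
    where
    module K′ = Characteristic K pr M 0<M order
    instance _ = lookup⁺ ns≢0 l
    γ≉0 : ¬ γ l K′.≈ K′.0#
    γ≉0 γ≈0 = K′.1≉0 (K′.trans (K′.sym (proj₁ (γ-primitive l))) (K′.trans (K′.^-congˡ (lookup ns l) γ≈0) (K′.0^n (ℕ.>-nonZero⁻¹ (lookup ns l)))))

  -- Take every r_i equal to q^m - 1, a multiple of q - 1 and of each n_l.
  ∃-Adm : 1 ≤ k → ∃ Adm
  ∃-Adm 1≤k = let (v , adm , _) = fromAdmissible (λ _ → q ℕ.^ m ∸ 1) admissible in v , adm
    where
    ∣Σ : ∀ {i d} (f : Vector ℕ i) → (∀ j → d ∣ f j) → d ∣ Defs.sum f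
    ∣Σ {zero}  f ∣f = _ ∣.∣0
    ∣Σ {suc i} f ∣f = ∣.∣m∣n⇒∣m+n (∣f Fin.zero) (∣Σ (f ∘ Fin.suc) (∣f ∘ Fin.suc))
    positive : ∀ {i c} → 1 ≤ i → 0 < c → 0 < Defs.sum {i} (λ _ → c)
    positive {suc i} _ 0<c = ℕ.<-≤-trans 0<c (ℕ.m≤m+n _ _)
    admissible : Admissible q m s (λ _ → q ℕ.^ m ∸ 1)
    admissible = (λ i → ℕ.≤-refl)
      , positive 1≤k (≡.subst (λ n → 0 < n ∸ 1) (≡.sym q^m≡Q) (ℕ.m<n⇒0<n∸m 1<Q))
      , ∣Σ {k} _ (λ i → q∸1∣q^m∸1 q {{ℕ.m^n≢0 p e}} m)
      , λ l → ∣Σ {k} _ λ i → ∣.∣m⇒∣m*n (coord (s i) l) (≡.subst (λ n → lookup ns l ∣ n ∸ 1) (≡.sym q^m≡Q) (nₗ∣Q∸1 l))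

  valuation-exists : 1 ≤ k → ∃ Valuation
  valuation-exists 1≤k = let (u , adm-u) = ∃-Adm 1≤k ; (v , adm , v-minimal) = minimal u adm-u in t₀ v adm v-minimal , valuation v adm v-minimal

open import Data.Nat.Base using (_^_)

theorem4p3 : ∀ {a b ℓ₁ ℓ₂ ℓ₃ ℓ₄} (p e : ℕ) (p-prime : Prime p) → 1 ≤ e →
    let q = p ^ e in
    ∀ {h} (ns : Vec ℕ h) → All NonZero ns →
    (N : ℕ) → IsExponent ns N → gcd N q ≡ 1 →
    (m : ℕ) → IsMultiplicativeOrder N q m →
    (F : HeytingField a ℓ₁ ℓ₂) (F-order : HasOrder F q) →
    (K : HeytingField b ℓ₃ ℓ₄) → HasOrder K (q ^ m) →
    (ι : HeytingField.Carrier F → HeytingField.Carrier K) → IsFieldEmbedding F K ι →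
    (γ : Vector (HeytingField.Carrier K) h) →
    (∀ l → IsPrimitiveRootOfUnity K (lookup ns l) (γ l)) →
    (k : ℕ) (s : Vector (ProductGroup ns) k) →
    let C = TraceCode F K ι q m γ s in
    (∀ t → IsValuation F F-order p C t ⇔
    IsMinimumOf (Admissible q m s) (objective p-prime e) (+ t / 1)) ×
    (1 ≤ k → ∃ (IsValuation F F-order p C))
theorem4p3 p e p-prime 1≤e ns ns≢0 N _ _ m (1≤m , _) F F-order K K-order ι ι-embedding γ γ-primitive k s =
  Val.valuation⇔minimum , Val.valuation-exists
  where
  0<M : 0 < m ℕ.* e
  0<M = ℕ.*-mono-≤ 1≤m 1≤e
  order : HasOrder K (p ^ (m ℕ.* e))
  order = ≡.subst (HasOrder K) (≡.trans (ℕ.^-*-assoc p e m) (≡.cong (p ^_) (ℕ.*-comm e m))) K-order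
  lift : ∀ n → CyclotomicLift K p n
  lift = Ramify.cyclotomicLift K p-prime (m ℕ.* e) 0<M order (WittLift.teichmüllerLift K p-prime (m ℕ.* e) 0<M order)
  codeData : CodeData K p (m ℕ.* e) _ _ _
  codeData = record
    { e = e ; 0<e = 1≤e ; m = m ; M≡m*e = ≡.refl ; F = F ; F-order = F-order ; ι = ι ; ι-embedding = ι-embedding
    ; ns = ns ; ns≢0 = ns≢0 ; γ = γ ; γ-primitive = γ-primitive ; s = s
    }
  module Val = Valuation K p-prime 0<M order lift codeData
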